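{- Let $k\ge 3$. There is a constant $c>0$ such that for all sufficiently large $n$ there exist at least $c\cdot 2^n$ pairwise non-isomorphic centrally symmetric combinatorial $(2k-1)$-spheres on the vertex set $V_n=\{\pm1,\dots,\pm n\}$ that are cs-$(k-1)$-neighborly with respect to $V_n$.
   Context: A combinatorial $(2k-1)$-sphere is a simplicial complex PL homeomorphic to the boundary of a $2k$-simplex. A simplicial complex $\Gamma$ on $V_n$ is centrally symmetric if $\sigma\in\Gamma$ implies $-\sigma=\{ -v:v\in\sigma\}\in\Gamma$ and no face contains a pair $\{v,-v\}$. $\Gamma$ is cs-$i$-neighborly with respect to $V_n$ if every subset of $V_n$ of size at most $i$ containing no pair $\{v,-v\}$ is a face of $\Gamma$. -}

module Defs where

open import Data.Nat using (ℕ; zero; suc; _+_; _≤_)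
open import Data.Bool using (Bool; true; false; not; _∧_; _∨_)
open import Data.Fin using (Fin; splitAt; _↑ˡ_; _↑ʳ_)
open import Data.Fin.Subset using (Subset; _⊆_; _∈_; _∉_; _∪_; ⁅_⁆; ∣_∣; inside)
open import Data.Vec using (Vec; []; _∷_; tabulate; lookup)
open import Data.Sum using ([_,_]′)
open import Data.Product using (Σ; _×_)
open import Function.Bundles using (_↔_; Inverse)
open import Relation.Binary.PropositionalEquality using (_≡_)

-- A (raw) simplicial complex on the ground set Fin m: the Boolean
-- indicator of its set of faces.
RawComplex : ℕ → Set
RawComplex m = Subset m → Bool

IsComplex : {m : ℕ} → RawComplex m → Set
IsComplex {m} K =
  ((σ τ : Subset m) → τ ⊆ σ → K σ ≡ true → K τ ≡ true) ×
  ((v : Fin m) → K ⁅ v ⁆ ≡ true)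

-- image of a subset under a bijection, given through its inverse g
pull : {m m' : ℕ} → (Fin m' → Fin m) → Subset m → Subset m'
pull g σ = tabulate (λ j → lookup σ (g j))

Iso : {m m' : ℕ} → RawComplex m → RawComplex m' → Set
Iso {m} {m'} K L =
  Σ (Fin m ↔ Fin m') λ f → (σ : Subset m) → K σ ≡ L (pull (Inverse.from f) σ)

subB : {m : ℕ} → Subset m → Subset m → Bool
subB [] [] = true
subB (x ∷ xs) (y ∷ ys) = (not x ∨ y) ∧ subB xs ys

-- Stellar subdivision of K at the face σ; the new vertex is index 0,
-- old vertices are shifted by suc.
-- faces: { τ ∈ K : σ ⊄ τ }  ∪  { τ ∪ {a} : σ ⊄ τ, τ ∪ σ ∈ K }
stellar : {m : ℕ} → RawComplex m → Subset m → RawComplex (suc m)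
stellar K σ (false ∷ τ) = not (subB σ τ) ∧ K τ
stellar K σ (true ∷ τ) = not (subB σ τ) ∧ K (τ ∪ σ)

-- Combinatorial (PL) equivalence, à la Alexander–Newman: the equivalence
-- relation generated by simplicial isomorphisms and stellar subdivisions
-- (at faces of size ≥ 2; subdivision at a vertex is an isomorphism).
data PLEquiv : {m m' : ℕ} → RawComplex m → RawComplex m' → Set where
  iso    : {m m' : ℕ} {K : RawComplex m} {L : RawComplex m'} →
           Iso K L → PLEquiv K L
  subdiv : {m : ℕ} (K : RawComplex m) (σ : Subset m) →
           IsComplex K → K σ ≡ true → 2 ≤ ∣ σ ∣ → PLEquiv K (stellar K σ)
  symm   : {m m' : ℕ} {K : RawComplex m} {L : RawComplex m'} →
           PLEquiv K L → PLEquiv L K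
  trans  : {m m' m'' : ℕ} {K : RawComplex m} {L : RawComplex m'}
           {M : RawComplex m''} → PLEquiv K L → PLEquiv L M → PLEquiv K M

fullB : {m : ℕ} → Subset m → Bool
fullB [] = true
fullB (x ∷ xs) = x ∧ fullB xs

boundarySimplex : (m : ℕ) → RawComplex m
boundarySimplex m σ = not (fullB σ)

-- combinatorial d-sphere: a simplicial complex PL homeomorphic to the
-- boundary of the (d+1)-simplex (which has d+2 vertices)
CombSphere : (d : ℕ) → {m : ℕ} → RawComplex m → Set
CombSphere d K = IsComplex K × PLEquiv K (boundarySimplex (suc (suc d)))

-- V_n = {±1,…,±n} encoded as Fin (n + n): i ↦ +(i+1) for i < n,
-- n + i ↦ -(i+1).  neg is v ↦ -v.
neg : (n : ℕ) → Fin (n + n) → Fin (n + n)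
neg n i = [ (λ a → n ↑ʳ a) , (λ b → b ↑ˡ n) ]′ (splitAt n i)

CentSym : (n : ℕ) → RawComplex (n + n) → Set
CentSym n K =
  ((σ : Subset (n + n)) → K σ ≡ true → K (pull (neg n) σ) ≡ true) ×
  ((σ : Subset (n + n)) (v : Fin (n + n)) → v ∈ σ → neg n v ∈ σ → K σ ≡ false)

CSNeighborly : (n i : ℕ) → RawComplex (n + n) → Set
CSNeighborly n i K =
  (σ : Subset (n + n)) → ∣ σ ∣ ≤ i →
  ((v : Fin (n + n)) → v ∈ σ → neg n v ∉ σ) → K σ ≡ true

{-# OPTIONS --safe #-}
module Submission where

-- Idea.  The spheres grow by one antipodal pair {v, -v} at a time: a ball B₀ of Δ without interior faces in -B₀ is replaced by
-- the cone from v over ∂B₀, and -B₀ by the cone from -v over -∂B₀.  B₀ is the first term of a decreasing family B₀ ⊇ B₁ ⊇ …,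
-- which extends to the suspension of Δ by ±w with the terms w * Bₑ ∪ (-w) * Bₑ₊₁, the signs of w being exchanged for odd e.
-- In dimension 3 the ball is the star of an edge, so that Δ undergoes two stellar subdivisions.  Passing to the complement of
-- the ball and suspending twice gives the family for a sphere two dimensions higher; its balls contain all faces with up to
-- one vertex more, hence the neighborliness.  When a ball grows by the star of a face A ∪ C that it meets in A * ∂C * L, the
-- coned sphere changes by an exchange of A * ∂C * L with ∂A * C * L, which preserves the PL type; such steps and their
-- inverses connect every ball that occurs with the empty one, over which the cone changes nothing.
--
-- The link of the new vertex of a 3-sphere is an octahedron, and the next edge joins this vertex to one of three pairwise
-- adjacent vertices of the octahedron, which gives 3 ^ M choices for M steps.  An isomorphism that fixes the first pairs and
-- the apices of all suspensions fixes all later vertices in the order of their creation, so that the choices are equal.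
-- Hence an isomorphism class contains at most (2n) ^ D of the spheres, where D does not depend on n, and 3 ^ M / (2n) ^ D
-- outgrows 2 ^ n.

open import Defs hiding (trans)
open import Data.Nat using (ℕ; zero; suc; _+_; _*_; _∸_; _^_; _≤_; _<_; z≤n; s≤s)
import Data.Nat.Properties as ℕₚ
open ℕₚ using (≤-trans; ≤-refl; ≤-reflexive)
open import Data.Bool using (Bool; true; false; not; _∧_; _∨_; T; if_then_else_)
open import Data.Vec using (Vec; []; _∷_; tabulate; lookup; replicate)
import Data.Vec.Properties as Vecₚ
open import Data.Fin using (Fin; zero; suc; toℕ; fromℕ<; splitAt; _↑ˡ_; _↑ʳ_; combine; finToFun; funToFin)
import Data.Fin.Properties as Finₚ
open import Data.Fin.Subset using (Subset; _∈_; ⁅_⁆; ∣_∣; outside) renaming (_∪_ to _∪ₛ_)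
import Data.Fin.Subset.Properties as Subₚ
open import Data.List as List using (List; length)
open import Data.List.Relation.Unary.All using (All)
open import Data.List.Relation.Unary.AllPairs using (AllPairs)
open import Data.Product using (Σ; _×_; _,_; proj₁; proj₂)
open import Data.Sum using (_⊎_; inj₁; inj₂; [_,_]′)
open import Data.Empty using (⊥; ⊥-elim)
open import Data.Unit using (tt)
open import Function using (_∘_; id)
open import Function.Bundles using (_↔_; Inverse; mk↔ₛ′)
open import Relation.Nullary using (¬_; Dec; yes; no)
open import Relation.Binary.PropositionalEquality using (_≡_; _≢_; refl; sym; trans; cong; cong₂; subst)
open import Data.List.Relation.Unary.Any using (Any; index)
import Data.List.Relation.Unary.Any.Properties as Anyₚ
import Data.List.Relation.Unary.All.Properties as Allₚ
open import Relation.Nullary.Decidable using (map′; _×-dec_; ¬?; decidable-stable)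
open import Relation.Binary.Bundles using (DecSetoid)
import Data.List.Membership.Setoid.Properties as Memₚ
import Data.List.Relation.Unary.Unique.DecSetoid.Properties as Uniqueₚ
open import Data.Nat.Solver using (module +-*-Solver)

-- After time 0 the sphere `Δ o (suc L) m` need not be the double suspension of `Δ o L m`, although
-- the balls are built in that suspension; only the link of its two newest positive vertices is
-- known to be the lower sphere. This obstacle shapes the proof. The families `NN` and `JJ` mark a
-- region where the suspension can be trusted: members of `NN` are faces of the actual sphere, and
-- `JJ` is closed there under passing to larger faces. Balls with faces in `NN` and interior in `JJ`
-- therefore keep an open interior in the actual sphere, and `Tim` renews the region at each time.
-- The assumption k ≥ 3 enters through rigidity. It gives k - 1 ≥ 2, so the antipodal pairs are
-- exactly the non-edges, and an isomorphism that fixes a vertex fixes its antipode. Hence only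
-- positive vertices must be recognised. The vertex of time j is recognised by a triangle to which
-- no later vertex is ever joined, and the next edge by the fact that its subdivision destroys it.

∧-i : ∀ {a b} → T a → T b → T (a ∧ b)
∧-i {true} {true} _ _ = tt

∧-l : ∀ {a b} → T (a ∧ b) → T a
∧-l {true} _ = tt

∧-r : ∀ {a b} → T (a ∧ b) → T b
∧-r {true} p = p

¬-i : ∀ {a} → ¬ T a → T (not a)
¬-i {true} f = f tt
¬-i {false} _ = tt

¬-e : ∀ {a} → T (not a) → ¬ T a
¬-e {false} _ ()

T? : ∀ b → T b ⊎ ¬ T b
T? true = inj₁ tt
T? false = inj₂ (λ ())

T→≡ : ∀ {b} → T b → b ≡ true
T→≡ {true} _ = refl

≡→T : ∀ {b} → b ≡ true → T b
≡→T refl = tt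

¬T→≡ : ∀ {b} → ¬ T b → b ≡ false
¬T→≡ {true} f = ⊥-elim (f tt)
¬T→≡ {false} _ = refl

T-≡ : ∀ {a b} → (T a → T b) → (T b → T a) → a ≡ b
T-≡ {true} {true} _ _ = refl
T-≡ {true} {false} f _ = ⊥-elim (f tt)
T-≡ {false} {true} _ g = ⊥-elim (g tt)
T-≡ {false} {false} _ _ = refl

-- Signed vertex sets.

-- The trace of a vertex set on one antipodal pair {v, -v}: empty, {v}, {-v} or both.
data Q : Set where
  O P M X : Q

negq : Q → Q
negq O = O
negq P = M
negq M = P
negq X = X

_∪q_ : Q → Q → Q
O ∪q b = b
a ∪q O = a
P ∪q P = P
M ∪q M = M
_ ∪q _ = X

infix 4 _≤q_ _⊑_ _⊥q_ _⊥v_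

data _≤q_ : Q → Q → Set where
  O≤ : ∀ {b} → O ≤q b
  PP : P ≤q P
  PX : P ≤q X
  MM : M ≤q M
  MX : M ≤q X
  XX : X ≤q X

data _⊑_ : ∀ {n} → Vec Q n → Vec Q n → Set where
  []  : [] ⊑ []
  _∷_ : ∀ {n a b} {x y : Vec Q n} → a ≤q b → x ⊑ y → (a ∷ x) ⊑ (b ∷ y)

data _⊥q_ : Q → Q → Set where
  O⊥ : ∀ {b} → O ⊥q b
  ⊥O : ∀ {a} → a ⊥q O
  PM : P ⊥q M
  MP : M ⊥q P

data _⊥v_ : ∀ {n} → Vec Q n → Vec Q n → Set where
  []  : [] ⊥v []
  _∷_ : ∀ {n a b} {x y : Vec Q n} → a ⊥q b → x ⊥v y → (a ∷ x) ⊥v (b ∷ y)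

infixr 6 _∪_

_∪_ : ∀ {n} → Vec Q n → Vec Q n → Vec Q n
[] ∪ [] = []
(a ∷ x) ∪ (b ∷ y) = (a ∪q b) ∷ (x ∪ y)

neg' : ∀ {n} → Vec Q n → Vec Q n
neg' [] = []
neg' (a ∷ x) = negq a ∷ neg' x

∅ : ∀ {n} → Vec Q n
∅ {n} = replicate n O

okq : Q → Bool
okq X = false
okq _ = true

okv : ∀ {n} → Vec Q n → Bool
okv [] = true
okv (a ∷ x) = okq a ∧ okv x

cardq : Q → ℕ
cardq O = 0
cardq P = 1
cardq M = 1
cardq X = 2

card : ∀ {n} → Vec Q n → ℕ
card [] = 0
card (a ∷ x) = cardq a + card x

leq : Q → Q → Bool
leq O _ = true
leq P P = true
leq P X = true
leq M M = true
leq M X = true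
leq X X = true
leq _ _ = false

sub : ∀ {n} → Vec Q n → Vec Q n → Bool
sub [] [] = true
sub (a ∷ x) (b ∷ y) = leq a b ∧ sub x y

leq→ : ∀ {a b} → T (leq a b) → a ≤q b
leq→ {O} _ = O≤
leq→ {P} {P} _ = PP
leq→ {P} {X} _ = PX
leq→ {M} {M} _ = MM
leq→ {M} {X} _ = MX
leq→ {X} {X} _ = XX

→leq : ∀ {a b} → a ≤q b → T (leq a b)
→leq O≤ = tt
→leq PP = tt
→leq PX = tt
→leq MM = tt
→leq MX = tt
→leq XX = tt

sub→ : ∀ {n} {x y : Vec Q n} → T (sub x y) → x ⊑ y
sub→ {x = []} {[]} _ = []
sub→ {x = a ∷ x} {b ∷ y} p = leq→ (∧-l p) ∷ sub→ (∧-r {leq a b} p)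

→sub : ∀ {n} {x y : Vec Q n} → x ⊑ y → T (sub x y)
→sub [] = tt
→sub (p ∷ q) = ∧-i (→leq p) (→sub q)

≤q-refl : ∀ {a} → a ≤q a
≤q-refl {O} = O≤
≤q-refl {P} = PP
≤q-refl {M} = MM
≤q-refl {X} = XX

≤q-trans : ∀ {a b c} → a ≤q b → b ≤q c → a ≤q c
≤q-trans O≤ _ = O≤
≤q-trans PP q = q
≤q-trans PX XX = PX
≤q-trans MM q = q
≤q-trans MX XX = MX
≤q-trans XX XX = XX

⊑-refl : ∀ {n} {x : Vec Q n} → x ⊑ x
⊑-refl {x = []} = []
⊑-refl {x = a ∷ x} = ≤q-refl ∷ ⊑-refl

⊑-trans : ∀ {n} {x y z : Vec Q n} → x ⊑ y → y ⊑ z → x ⊑ z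
⊑-trans [] [] = []
⊑-trans (p ∷ r) (q ∷ s) = ≤q-trans p q ∷ ⊑-trans r s

∅⊑ : ∀ {n} {x : Vec Q n} → ∅ ⊑ x
∅⊑ {x = []} = []
∅⊑ {x = a ∷ x} = O≤ ∷ ∅⊑

≤q∪l : ∀ a b → a ≤q (a ∪q b)
≤q∪l O b = O≤
≤q∪l P O = PP
≤q∪l P P = PP
≤q∪l P M = PX
≤q∪l P X = PX
≤q∪l M O = MM
≤q∪l M P = MX
≤q∪l M M = MM
≤q∪l M X = MX
≤q∪l X O = XX
≤q∪l X P = XX
≤q∪l X M = XX
≤q∪l X X = XX

∪q-comm : ∀ a b → a ∪q b ≡ b ∪q a
∪q-comm O O = refl
∪q-comm O P = refl
∪q-comm O M = refl
∪q-comm O X = refl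
∪q-comm P O = refl
∪q-comm P P = refl
∪q-comm P M = refl
∪q-comm P X = refl
∪q-comm M O = refl
∪q-comm M P = refl
∪q-comm M M = refl
∪q-comm M X = refl
∪q-comm X O = refl
∪q-comm X P = refl
∪q-comm X M = refl
∪q-comm X X = refl

∪q-lub : ∀ {a b c} → a ≤q c → b ≤q c → (a ∪q b) ≤q c
∪q-lub O≤ q = q
∪q-lub PP O≤ = PP
∪q-lub PP PP = PP
∪q-lub PX O≤ = PX
∪q-lub PX PX = PX
∪q-lub PX MX = XX
∪q-lub PX XX = XX
∪q-lub MM O≤ = MM
∪q-lub MM MM = MM
∪q-lub MX O≤ = MX
∪q-lub MX PX = XX
∪q-lub MX MX = MX
∪q-lub MX XX = XX
∪q-lub XX O≤ = XX
∪q-lub XX PX = XX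
∪q-lub XX MX = XX
∪q-lub XX XX = XX

≤q-antisym : ∀ {a b} → a ≤q b → b ≤q a → a ≡ b
≤q-antisym O≤ O≤ = refl
≤q-antisym PP _ = refl
≤q-antisym MM _ = refl
≤q-antisym XX _ = refl

∪-comm : ∀ {n} (x y : Vec Q n) → x ∪ y ≡ y ∪ x
∪-comm [] [] = refl
∪-comm (a ∷ x) (b ∷ y) = cong₂ _∷_ (∪q-comm a b) (∪-comm x y)

⊑∪l : ∀ {n} {x y : Vec Q n} → x ⊑ x ∪ y
⊑∪l {x = []} {[]} = []
⊑∪l {x = a ∷ x} {b ∷ y} = ≤q∪l a b ∷ ⊑∪l

⊑∪r : ∀ {n} {x y : Vec Q n} → y ⊑ x ∪ y
⊑∪r {x = x} {y} = subst (y ⊑_) (∪-comm y x) ⊑∪l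

∪-lub : ∀ {n} {x y z : Vec Q n} → x ⊑ z → y ⊑ z → x ∪ y ⊑ z
∪-lub [] [] = []
∪-lub (p ∷ r) (q ∷ s) = ∪q-lub p q ∷ ∪-lub r s

⊑-antisym : ∀ {n} {x y : Vec Q n} → x ⊑ y → y ⊑ x → x ≡ y
⊑-antisym [] [] = refl
⊑-antisym (p ∷ r) (q ∷ s) = cong₂ _∷_ (≤q-antisym p q) (⊑-antisym r s)

∪-mono : ∀ {n} {x y z w : Vec Q n} → x ⊑ y → z ⊑ w → x ∪ z ⊑ y ∪ w
∪-mono p q = ∪-lub (⊑-trans p ⊑∪l) (⊑-trans q ⊑∪r)

⊑→∪ : ∀ {n} {x y : Vec Q n} → x ⊑ y → y ∪ x ≡ y
⊑→∪ p = ⊑-antisym (∪-lub ⊑-refl p) ⊑∪l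

negq-inv : ∀ a → negq (negq a) ≡ a
negq-inv O = refl
negq-inv P = refl
negq-inv M = refl
negq-inv X = refl

neg-inv : ∀ {n} (x : Vec Q n) → neg' (neg' x) ≡ x
neg-inv [] = refl
neg-inv (a ∷ x) = cong₂ _∷_ (negq-inv a) (neg-inv x)

negq-mono : ∀ {a b} → a ≤q b → negq a ≤q negq b
negq-mono O≤ = O≤
negq-mono PP = MM
negq-mono PX = MX
negq-mono MM = PP
negq-mono MX = PX
negq-mono XX = XX

neg-mono : ∀ {n} {x y : Vec Q n} → x ⊑ y → neg' x ⊑ neg' y
neg-mono [] = []
neg-mono (p ∷ q) = negq-mono p ∷ neg-mono q

neg-mono⁻ : ∀ {n} {x y : Vec Q n} → x ⊑ neg' y → neg' x ⊑ y
neg-mono⁻ {x = x} {y} p = subst (neg' x ⊑_) (neg-inv y) (neg-mono p)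

neg-mono⁺ : ∀ {n} {x y : Vec Q n} → neg' x ⊑ y → x ⊑ neg' y
neg-mono⁺ {x = x} {y} p = subst (_⊑ neg' y) (neg-inv x) (neg-mono p)

neg-∪ : ∀ {n} (x y : Vec Q n) → neg' (x ∪ y) ≡ neg' x ∪ neg' y
neg-∪ x y = ⊑-antisym (neg-mono⁻ (∪-lub (neg-mono⁺ ⊑∪l) (neg-mono⁺ ⊑∪r)))
                      (∪-lub (neg-mono ⊑∪l) (neg-mono ⊑∪r))

neg-∅ : ∀ {n} → neg' (∅ {n}) ≡ ∅
neg-∅ {zero} = refl
neg-∅ {suc n} = cong (O ∷_) neg-∅

okq-neg : ∀ a → okq (negq a) ≡ okq a
okq-neg O = refl
okq-neg P = refl
okq-neg M = refl
okq-neg X = refl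

okv-neg : ∀ {n} (x : Vec Q n) → okv (neg' x) ≡ okv x
okv-neg [] = refl
okv-neg (a ∷ x) = cong₂ _∧_ (okq-neg a) (okv-neg x)

okq-down : ∀ {a b} → a ≤q b → T (okq b) → T (okq a)
okq-down O≤ _ = tt
okq-down PP _ = tt
okq-down MM _ = tt

okv-down : ∀ {n} {x y : Vec Q n} → x ⊑ y → T (okv y) → T (okv x)
okv-down [] _ = tt
okv-down {y = b ∷ y} (p ∷ q) k = ∧-i (okq-down p (∧-l k)) (okv-down q (∧-r {okq b} k))

cardq-neg : ∀ a → cardq (negq a) ≡ cardq a
cardq-neg O = refl
cardq-neg P = refl
cardq-neg M = refl
cardq-neg X = refl

card-neg : ∀ {n} (x : Vec Q n) → card (neg' x) ≡ card x
card-neg [] = refl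
card-neg (a ∷ x) = cong₂ _+_ (cardq-neg a) (card-neg x)

cardq-mono : ∀ {a b} → a ≤q b → cardq a ≤ cardq b
cardq-mono O≤ = z≤n
cardq-mono PP = ≤-refl
cardq-mono PX = s≤s z≤n
cardq-mono MM = ≤-refl
cardq-mono MX = s≤s z≤n
cardq-mono XX = ≤-refl

card-mono : ∀ {n} {x y : Vec Q n} → x ⊑ y → card x ≤ card y
card-mono [] = z≤n
card-mono (p ∷ q) = ℕₚ.+-mono-≤ (cardq-mono p) (card-mono q)

card-∅ : ∀ {n} → card (∅ {n}) ≡ 0
card-∅ {zero} = refl
card-∅ {suc n} = card-∅ {n}

⊥q-sym : ∀ {a b} → a ⊥q b → b ⊥q a
⊥q-sym O⊥ = ⊥O
⊥q-sym ⊥O = O⊥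
⊥q-sym PM = MP
⊥q-sym MP = PM

⊥v-sym : ∀ {n} {x y : Vec Q n} → x ⊥v y → y ⊥v x
⊥v-sym [] = []
⊥v-sym (p ∷ q) = ⊥q-sym p ∷ ⊥v-sym q

⊥q-neg : ∀ {a b} → a ⊥q b → negq a ⊥q negq b
⊥q-neg O⊥ = O⊥
⊥q-neg ⊥O = ⊥O
⊥q-neg PM = MP
⊥q-neg MP = PM

⊥v-neg : ∀ {n} {x y : Vec Q n} → x ⊥v y → neg' x ⊥v neg' y
⊥v-neg [] = []
⊥v-neg (p ∷ q) = ⊥q-neg p ∷ ⊥v-neg q

⊥v-∅ : ∀ {n} {x : Vec Q n} → x ⊥v ∅
⊥v-∅ {x = []} = []
⊥v-∅ {x = a ∷ x} = ⊥O ∷ ⊥v-∅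

⊥q-drop : ∀ {a c s} → a ⊥q c → a ≤q (s ∪q c) → a ≤q s
⊥q-drop O⊥ _ = O≤
⊥q-drop {s = O} ⊥O q = q
⊥q-drop {s = P} ⊥O q = q
⊥q-drop {s = M} ⊥O q = q
⊥q-drop {s = X} ⊥O q = q
⊥q-drop {s = O} PM ()
⊥q-drop {s = P} PM _ = PP
⊥q-drop {s = M} PM ()
⊥q-drop {s = X} PM _ = PX
⊥q-drop {s = O} MP ()
⊥q-drop {s = P} MP ()
⊥q-drop {s = M} MP _ = MM
⊥q-drop {s = X} MP _ = MX

⊥v-drop : ∀ {n} {a c s : Vec Q n} → a ⊥v c → a ⊑ (s ∪ c) → a ⊑ s
⊥v-drop {s = []} [] [] = []
⊥v-drop {s = s ∷ ss} (p ∷ r) (q ∷ t) = ⊥q-drop p q ∷ ⊥v-drop r t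

cardq-∪ : ∀ {a b} → a ⊥q b → cardq (a ∪q b) ≡ cardq a + cardq b
cardq-∪ O⊥ = refl
cardq-∪ {O} ⊥O = refl
cardq-∪ {P} ⊥O = refl
cardq-∪ {M} ⊥O = refl
cardq-∪ {X} ⊥O = refl
cardq-∪ PM = refl
cardq-∪ MP = refl

card-∪ : ∀ {n} {x y : Vec Q n} → x ⊥v y → card (x ∪ y) ≡ card x + card y
card-∪ [] = refl
card-∪ {x = a ∷ x} {b ∷ y} (p ∷ q) =
  trans (cong₂ _+_ (cardq-∪ p) (card-∪ q)) (+-swap (cardq a) (cardq b) (card x) (card y))
  where
  +-swap : ∀ a b c d → (a + b) + (c + d) ≡ (a + c) + (b + d)
  +-swap a b c d = trans (ℕₚ.+-assoc a b (c + d))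
    (trans (cong (a +_) (trans (sym (ℕₚ.+-assoc b c d)) (trans (cong (_+ d) (ℕₚ.+-comm b c)) (ℕₚ.+-assoc c b d))))
           (sym (ℕₚ.+-assoc a c (b + d))))

⊥v-¬⊑ : ∀ {n} {a c : Vec Q n} → a ⊥v c → a ⊑ c → card a ≡ 0
⊥v-¬⊑ [] [] = refl
⊥v-¬⊑ (O⊥ ∷ d) (_ ∷ s) = ⊥v-¬⊑ d s
⊥v-¬⊑ (⊥O ∷ d) (O≤ ∷ s) = ⊥v-¬⊑ d s

-- Families of balls and their suspension.

-- A family of vertex sets of one complex, indexed by the number of alternations of sign.
Pred : ℕ → Set
Pred n = Vec Q n → Bool

Fam : ℕ → Set
Fam n = ℕ → Pred n

par : ℕ → Bool
par zero = true
par (suc e) = not (par e)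

-- `a` and `b` are membership in Bₑ and Bₑ₊₁, and the first argument is the parity of e. At `O` only
-- `a` counts because the family decreases.
selB : Bool → Q → Bool → Bool → Bool
selB _ O a b = a
selB true P a b = a
selB true M a b = b
selB false P a b = b
selB false M a b = a
selB _ X a b = false

-- The two cones are glued along the smaller ball Bₑ₊₁, so a face without apex is interior exactly
-- when it is interior to Bₑ₊₁.
selI : Bool → Q → Bool → Bool → Bool
selI _ O a b = b
selI true P a b = a
selI true M a b = b
selI false P a b = b
selI false M a b = a
selI _ X a b = false

-- A change of the term e of a family enters its suspension in two places, at index e through `F`
-- and at index e - 1 through `G`. Two arguments let these happen one after the other.
mixB : ∀ {n} → Fam n → Fam n → Fam (suc n)
mixB F G e (v ∷ x) = selB (par e) v (F e x) (G (suc e) x)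

mixI : ∀ {n} → Fam n → Fam n → Fam (suc n)
mixI F G e (v ∷ x) = selI (par e) v (F e x) (G (suc e) x)

stepB : ∀ {n} → Fam n → Fam (suc n)
stepB F = mixB F F

stepI : ∀ {n} → Fam n → Fam (suc n)
stepI F = mixI F F

module _ where
  private variable a b c d a' b' : Bool

  selB-mono : ∀ p v → (T a → T a') → (T b → T b') → T (selB p v a b) → T (selB p v a' b')
  selB-mono _ O f g = f
  selB-mono true P f g = f
  selB-mono true M f g = g
  selB-mono false P f g = g
  selB-mono false M f g = f
  selB-mono _ X f g ()

  selI-mono : ∀ p v → (T a → T a') → (T b → T b') → T (selI p v a b) → T (selI p v a' b')
  selI-mono _ O f g = g
  selI-mono true P f g = f
  selI-mono true M f g = g
  selI-mono false P f g = g
  selI-mono false M f g = f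
  selI-mono _ X f g ()

  selIB : ∀ p v → (T a → T a') → (T b → T b') → (T b → T a') → T (selI p v a b) → T (selB p v a' b')
  selIB _ O f g h = h
  selIB true P f g h = f
  selIB true M f g h = g
  selIB false P f g h = g
  selIB false M f g h = f
  selIB _ X f g h ()

  selB-dec : ∀ p v → (T c → T a) → (T d → T a) → (T c → T b) → T (selB (not p) v c d) → T (selB p v a b)
  selB-dec _ O f g h = f
  selB-dec true P f g h = g
  selB-dec true M f g h = h
  selB-dec false P f g h = h
  selB-dec false M f g h = g
  selB-dec _ X f g h ()

  selI-dec : ∀ p v → (T d → T a) → (T d → T b) → (T c → T b) → T (selI (not p) v c d) → T (selI p v a b)
  selI-dec _ O f g h = g
  selI-dec true P f g h = f
  selI-dec true M f g h = h
  selI-dec false P f g h = h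
  selI-dec false M f g h = f
  selI-dec _ X f g h ()

  selB-down : ∀ p {u v} → u ≤q v → (T a → T a') → (T b → T a') → (T b → T b') → T (selB p v a b) → T (selB p u a' b')
  selB-down true (O≤ {O}) f g h = f
  selB-down true (O≤ {P}) f g h = f
  selB-down true (O≤ {M}) f g h = g
  selB-down false (O≤ {O}) f g h = f
  selB-down false (O≤ {P}) f g h = g
  selB-down false (O≤ {M}) f g h = f
  selB-down true PP f g h = f
  selB-down false PP f g h = h
  selB-down true MM f g h = h
  selB-down false MM f g h = f
  selB-down _ (O≤ {X}) f g h ()
  selB-down _ PX f g h ()
  selB-down _ MX f g h ()
  selB-down _ XX f g h ()

  selI-up : ∀ p {u v} → u ≤q v → (T c → T a → T a') → (T c → T b → T a') → (T d → T b → T b') →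
            T (selI p v c d) → T (selI p u a b) → T (selI p v a' b')
  selI-up true (O≤ {O}) f g h j = h j
  selI-up true (O≤ {P}) f g h j = g j
  selI-up true (O≤ {M}) f g h j = h j
  selI-up false (O≤ {O}) f g h j = h j
  selI-up false (O≤ {P}) f g h j = h j
  selI-up false (O≤ {M}) f g h j = g j
  selI-up true PP f g h j = f j
  selI-up false PP f g h j = h j
  selI-up true MM f g h j = h j
  selI-up false MM f g h j = f j
  selI-up _ {v = X} q f g h ()

  selB-ok : ∀ p v → T (selB p v a b) → T (okq v)
  selB-ok p O _ = tt
  selB-ok p P _ = tt
  selB-ok p M _ = tt
  selB-ok _ X ()

  selI-ok : ∀ p v → T (selI p v a b) → T (okq v)
  selI-ok p O _ = tt
  selI-ok p P _ = tt
  selI-ok p M _ = tt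
  selI-ok _ X ()

  selB-any : ∀ p v → T (selB p v a b) → T a ⊎ T b
  selB-any _ O t = inj₁ t
  selB-any true P t = inj₁ t
  selB-any true M t = inj₂ t
  selB-any false P t = inj₂ t
  selB-any false M t = inj₁ t
  selB-any _ X ()

  selB-selI : ∀ p v → (T a → T d → ⊥) → (T b → T d → ⊥) → (T a → T c → ⊥) →
              T (selB p v a b) → T (selI (not p) (negq v) c d) → ⊥
  selB-selI _ O f g h = f
  selB-selI true P f g h = h
  selB-selI true M f g h = g
  selB-selI false P f g h = g
  selB-selI false M f g h = h
  selB-selI _ X f g h ()

-- Members of even and of odd index are measured in two complexes, which differ only in links of single vertices.
record Amb {n} (D : Bool → Pred n) (N J : Fam n) : Set where
  field
    D-ok  : ∀ p {x} → T (D p x) → T (okv x)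
    D-cl  : ∀ p {x y} → x ⊑ y → T (D p y) → T (D p x)
    N⊂D   : ∀ e {x} → T (N e x) → T (D (par e) x)
    J⊂N   : ∀ e {x} → T (J e x) → T (N e x)
    J-op  : ∀ e {x y} → x ⊑ y → T (D (par e) y) → T (J e x) → T (J e y)
    N-dec : ∀ e {x} → T (N (suc e) x) → T (N e x)
    J-dec : ∀ e {x} → T (J (suc e) x) → T (J e x)

record St (n : ℕ) : Set where
  constructor st
  field
    B I : Fam n

open St public

record Good {n} (D : Bool → Pred n) (N J : Fam n) (s : St n) : Set where
  field
    B-cl  : ∀ e {x y} → x ⊑ y → T (B s e y) → T (B s e x)
    I-op  : ∀ e {x y} → x ⊑ y → T (D (par e) y) → T (I s e x) → T (I s e y)
    I⊂B   : ∀ e {x} → T (I s e x) → T (B s e x)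
    B⊂N   : ∀ e {x} → T (B s e x) → T (N e x)
    I⊂J   : ∀ e {x} → T (I s e x) → T (J e x)
    B-dec : ∀ e {x} → T (B s (suc e) x) → T (B s e x)
    I-dec : ∀ e {x} → T (I s (suc e) x) → T (I s e x)
    D0    : ∀ e {x} → T (B s e x) → T (I s (suc e) (neg' x)) → ⊥

Disj10 : ∀ {n} → St n → Set
Disj10 s = ∀ x → T (B s 1 x) → T (I s 0 (neg' x)) → ⊥

Disj00 : ∀ {n} → St n → Set
Disj00 s = ∀ x → T (B s 0 x) → T (I s 0 (neg' x)) → ⊥

mixS : ∀ {n} → St n → St n → St (suc n)
mixS s t = st (mixB (B s) (B t)) (mixI (I s) (I t))

stepS : ∀ {n} → St n → St (suc n)
stepS s = mixS s s

-- s and t are consecutive states: t is larger, but only by so much that t stays below s after a shift of the index.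
record Near {n} (s t : St n) : Set where
  field
    B≤ : ∀ e {x} → T (B s e x) → T (B t e x)
    I≤ : ∀ e {x} → T (I s e x) → T (I t e x)
    B× : ∀ e {x} → T (B t (suc e) x) → T (B s e x)
    I× : ∀ e {x} → T (I t (suc e) x) → T (I s e x)

near-refl : ∀ {n D N J} {s : St n} → Good D N J s → Near s s
near-refl g = record { B≤ = λ _ p → p ; I≤ = λ _ p → p ; B× = Good.B-dec g ; I× = Good.I-dec g }

-- All fields but `I-op` combine those of s and t. For `I-op`, `D'` need not be a suspension; but a
-- face of `D'` above a member of `stepI J` is again in `stepI J`, and this makes its base a face of
-- the complex in which the openness of s or t applies.
mix-good : ∀ {n} {D : Bool → Pred n} {N J} {D' : Bool → Pred (suc n)} {s t : St n} →
           Amb D N J → Amb D' (stepB N) (stepI J) → Good D N J s → Good D N J t → Near s t →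
           Good D' (stepB N) (stepI J) (mixS s t)
mix-good {n} {D} {N} {J} {D'} {s} {t} am am' gs gt nr = record
  { B-cl = cl ; I-op = op
  ; I⊂B = λ { e {v ∷ x} → selIB (par e) v (S.I⊂B e) (R.I⊂B (suc e)) (λ p → S.I⊂B e (I× e p)) }
  ; B⊂N = λ { e {v ∷ x} → selB-mono (par e) v (S.B⊂N e) (R.B⊂N (suc e)) }
  ; I⊂J = λ { e {v ∷ x} → selI-mono (par e) v (S.I⊂J e) (R.I⊂J (suc e)) }
  ; B-dec = λ { e {v ∷ x} → selB-dec (par e) v (S.B-dec e) (λ p → S.B-dec e (B× (suc e) p)) (B≤ (suc e)) }
  ; I-dec = λ { e {v ∷ x} → selI-dec (par e) v (λ p → S.I-dec e (I× (suc e) p)) (R.I-dec (suc e)) (I≤ (suc e)) }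
  ; D0 = λ { e {v ∷ x} → selB-selI (par e) v (λ p q → R.D0 e (B≤ e p) (R.I-dec (suc e) q))
                            (R.D0 (suc e)) (S.D0 e) }
  }
  where
  module S = Good gs
  module R = Good gt
  module A = Amb am
  module A' = Amb am'
  open Near nr
  cl : ∀ e {x y} → x ⊑ y → T (mixB (B s) (B t) e y) → T (mixB (B s) (B t) e x)
  cl e (p ∷ q) = selB-down (par e) p (S.B-cl e q) (λ r → S.B-cl e q (B× e r)) (R.B-cl (suc e) q)
  op : ∀ e {x y} → x ⊑ y → T (D' (par e) y) → T (mixI (I s) (I t) e x) → T (mixI (I s) (I t) e y)
  op e {u ∷ x} {v ∷ y} (p ∷ q) d i =
    selI-up (par e) p (λ j → S.I-op e q (dy e j)) (λ j r → S.I-op e q (dy e j) (I× e r)) (λ j → R.I-op (suc e) q (dy (suc e) j))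
            (A'.J-op e (p ∷ q) d (selI-mono (par e) u (S.I⊂J e) (R.I⊂J (suc e)) i)) i
    where
    dy : ∀ e → T (J e y) → T (D (par e) y)
    dy e j = A.N⊂D e (A.J⊂N e j)

mix-d10 : ∀ {n} {D : Bool → Pred n} {N J} {s t : St n} → Good D N J s → Good D N J t → Near s t → Disj10 s → Disj10 (mixS s t)
mix-d10 gs gt nr d (O ∷ x) p q = Good.D0 gt 0 (Good.B-dec gt 0 (Near.B≤ nr 1 p)) q
mix-d10 gs gt nr d (P ∷ x) p q = Good.D0 gt 0 (Good.B-dec gt 0 (Good.B-dec gt 1 p)) q
mix-d10 gs gt nr d (M ∷ x) p q = d x p q

-- Coning needs this condition. Faces without the apex or with its positive sign are settled by
-- `D0`; with the negative sign a face of B₁ would have to lie in -I₀, which `Disj10` excludes. So a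
-- suspension restores what passing to the complement loses.
mix-d00 : ∀ {n} {D : Bool → Pred n} {N J} {s t : St n} → Good D N J s → Good D N J t → Near s t → Disj10 t → Disj00 (mixS s t)
mix-d00 gs gt nr d (O ∷ x) p q = Good.D0 gt 0 (Near.B≤ nr 0 p) q
mix-d00 gs gt nr d (P ∷ x) p q = Good.D0 gt 0 (Near.B≤ nr 0 p) q
mix-d00 gs gt nr d (M ∷ x) p q = d x p (Near.I≤ nr 0 q)

sgn : Bool → Q
sgn true = P
sgn false = M

-- Elementary growth of a ball and its suspension.

-- The ball (B , I) grows to (B' , I') by the star of A ∪ C, which meets it in A * ∂C * L.
record Add {n} (D B I B' I' : Pred n) (A C : Vec Q n) : Set where
  field
    dis : A ⊥v C
    dAC : T (D (A ∪ C))
    a1  : ∀ {x} → C ⊑ x → T (B x) → ⊥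
    a2  : ∀ {x} → A ⊑ x → T (D x) → ¬ T (I x) → T (D (x ∪ C)) × (C ⊑ x ⊎ T (B x))
    B'→ : ∀ {x} → T (B' x) → T (B x) ⊎ (C ⊑ x × T (D (x ∪ A)))
    B≤  : ∀ {x} → T (B x) → T (B' x)
    B'C : ∀ {x} → C ⊑ x → T (D (x ∪ A)) → T (B' x)
    I'→ : ∀ {x} → T (I' x) → T (I x) ⊎ A ⊑ x
    I≤  : ∀ {x} → T (I x) → T (I' x)
    I'A : ∀ {x} → A ⊑ x → T (D x) → T (I' x)

record El {n} (D : Bool → Pred n) (s t : St n) (e : ℕ) (A C : Vec Q n) : Set where
  field
    add : Add (D (par e)) (B s e) (I s e) (B t e) (I t e) A C
    oB  : ∀ i → i ≢ e → ∀ x → B s i x ≡ B t i x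
    oI  : ∀ i → i ≢ e → ∀ x → I s i x ≡ I t i x

suc≢ : ∀ i → suc i ≢ i
suc≢ i p = ℕₚ.1+n≢n p

module _ {n} {D : Bool → Pred n} {N J} {s t : St n} {e A C}
         (gs : Good D N J s) (gt : Good D N J t) (l : El D s t e A C) where
  open El l
  el-near : Near s t
  el-near = record { B≤ = b≤ ; I≤ = i≤ ; B× = b× ; I× = i× }
    where
    b≤ : ∀ i {x} → T (B s i x) → T (B t i x)
    b≤ i {x} p with i ℕₚ.≟ e
    ... | yes refl = Add.B≤ add p
    ... | no q = subst T (oB i q x) p
    i≤ : ∀ i {x} → T (I s i x) → T (I t i x)
    i≤ i {x} p with i ℕₚ.≟ e
    ... | yes refl = Add.I≤ add p
    ... | no q = subst T (oI i q x) p
    b× : ∀ i {x} → T (B t (suc i) x) → T (B s i x)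
    b× i {x} p with i ℕₚ.≟ e
    ... | yes refl = Good.B-dec gs i (subst T (sym (oB (suc i) (suc≢ i) x)) p)
    ... | no q = subst T (sym (oB i q x)) (Good.B-dec gt i p)
    i× : ∀ i {x} → T (I t (suc i) x) → T (I s i x)
    i× i {x} p with i ℕₚ.≟ e
    ... | yes refl = Good.I-dec gs i (subst T (sym (oI (suc i) (suc≢ i) x)) p)
    ... | no q = subst T (sym (oI i q x)) (Good.I-dec gt i p)

module _ {n} {D : Bool → Pred n} {N J} {D' : Bool → Pred (suc n)} {s t : St n} {e A C}
         (am : Amb D N J) (am' : Amb D' (stepB N) (stepI J))
         (gs : Good D N J s) (gt : Good D N J t) (l : El D s t e A C) where
  private
    module S = Good gs
    module R = Good gt
    module Am = Amb am
    module Am' = Amb am'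
    module E = El l
    module Ad = Add E.add
    open Near (el-near gs gt l)

    CJ : ∀ {x} → A ⊑ x → T (D (par e) x) → T (N e x)
    CJ a d = Am.J⊂N e (R.I⊂J e (Ad.I'A a d))

    IA : T (I t e A)
    IA = Ad.I'A ⊑-refl (Am.D-cl (par e) ⊑∪l Ad.dAC)

    JA : T (J e A)
    JA = R.I⊂J e IA

    J→D : ∀ i {x} → T (J i x) → T (D (par i) x)
    J→D i j = Am.N⊂D i (Am.J⊂N i j)

  -- The cone over the new star is added together with its base, of which the old ball contains only
  -- the part over the boundary of `C`. The cone is thus met in the join of the apex, `A`, the
  -- boundary of `C` and the link, and the apex joins `A`.
  up-same : Add (D' (par e)) (mixB (B s) (B t) e) (mixI (I s) (I t) e) (stepB (B t) e) (stepI (I t) e) (sgn (par e) ∷ A) (O ∷ C)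
  up-same = record
    { dis = ⊥O ∷ Ad.dis
    ; dAC = dac (par e) refl
    ; a1 = λ { {v ∷ x} (_ ∷ c) b → [ Ad.a1 c , (λ r → Ad.a1 c (B× e r)) ]′ (selB-any (par e) v b) }
    ; a2 = λ { {v ∷ x} (u ∷ a) d i → a2' (par e) refl v x u a d i }
    ; B'→ = λ { {v ∷ x} → b→ (par e) refl v x }
    ; B≤ = λ { {v ∷ x} → selB-mono (par e) v (B≤ e) id }
    ; B'C = λ { {v ∷ x} (_ ∷ c) d → bc (par e) refl v x c d }
    ; I'→ = λ { {v ∷ x} → i→ (par e) v x }
    ; I≤ = λ { {v ∷ x} → selI-mono (par e) v (I≤ e) id }
    ; I'A = λ { {v ∷ x} (u ∷ a) d → ia (par e) refl v x u a d }
    }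
    where
    N' : ∀ p → p ≡ par e → ∀ {x} → T (N e x) → T (D' (par e) (sgn p ∷ x))
    N' true q {x} t = Am'.N⊂D e (subst (λ p → T (selB p P (N e x) (N (suc e) x))) q t)
    N' false q {x} t = Am'.N⊂D e (subst (λ p → T (selB p M (N e x) (N (suc e) x))) q t)
    dac : ∀ p → p ≡ par e → T (D' (par e) ((sgn p ∷ A) ∪ (O ∷ C)))
    dac true q = N' true q (CJ ⊑∪l Ad.dAC)
    dac false q = N' false q (CJ ⊑∪l Ad.dAC)
    J' : ∀ p → p ≡ par e → ∀ {x} → A ⊑ x → T (D' (par e) (sgn p ∷ x)) → T (D (par e) x)
    J' true q {x} a d = J→D e (subst (λ p → T (selI p P (J e x) (J (suc e) x))) (sym q)
      (Am'.J-op e (PP ∷ a) d (subst (λ p → T (selI p P (J e A) (J (suc e) A))) q JA)))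
    J' false q {x} a d = J→D e (subst (λ p → T (selI p M (J e x) (J (suc e) x))) (sym q)
      (Am'.J-op e (MM ∷ a) d (subst (λ p → T (selI p M (J e A) (J (suc e) A))) q JA)))
    a2' : ∀ p → p ≡ par e → ∀ v x → sgn p ≤q v → A ⊑ x → T (D' (par e) (v ∷ x)) → ¬ T (selI p v (I s e x) (I t (suc e) x)) →
          T (D' (par e) ((v ∷ x) ∪ (O ∷ C))) × ((O ∷ C) ⊑ (v ∷ x) ⊎ T (selB p v (B s e x) (B t (suc e) x)))
    a2' true q P x PP a d i with Ad.a2 a (J' true q a d) i
    ... | dc , inj₁ c = N' true q (CJ (⊑-trans a ⊑∪l) dc) , inj₁ (O≤ ∷ c)
    ... | dc , inj₂ b = N' true q (CJ (⊑-trans a ⊑∪l) dc) , inj₂ b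
    a2' false q M x MM a d i with Ad.a2 a (J' false q a d) i
    ... | dc , inj₁ c = N' false q (CJ (⊑-trans a ⊑∪l) dc) , inj₁ (O≤ ∷ c)
    ... | dc , inj₂ b = N' false q (CJ (⊑-trans a ⊑∪l) dc) , inj₂ b
    a2' true q X x PX a d i = ⊥-elim (Am'.D-ok (par e) d)
    a2' false q X x MX a d i = ⊥-elim (Am'.D-ok (par e) d)
    new : ∀ p → p ≡ par e → ∀ {x} → T (B t e x) → T (B s e x) ⊎ (C ⊑ x × T (D' (par e) (sgn p ∷ (x ∪ A))))
    new p q b with Ad.B'→ b
    ... | inj₁ r = inj₁ r
    ... | inj₂ (c , d) = inj₂ (c , N' p q (CJ ⊑∪r d))
    b→ : ∀ p → p ≡ par e → ∀ v x → T (selB p v (B t e x) (B t (suc e) x)) →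
         T (selB p v (B s e x) (B t (suc e) x)) ⊎ ((O ∷ C) ⊑ (v ∷ x) × T (D' (par e) ((v ∷ x) ∪ (sgn p ∷ A))))
    b→ true q O x b = [ inj₁ , (λ r → inj₂ (O≤ ∷ proj₁ r , proj₂ r)) ]′ (new true q b)
    b→ true q P x b = [ inj₁ , (λ r → inj₂ (O≤ ∷ proj₁ r , proj₂ r)) ]′ (new true q b)
    b→ true q M x b = inj₁ b
    b→ false q O x b = [ inj₁ , (λ r → inj₂ (O≤ ∷ proj₁ r , proj₂ r)) ]′ (new false q b)
    b→ false q P x b = inj₁ b
    b→ false q M x b = [ inj₁ , (λ r → inj₂ (O≤ ∷ proj₁ r , proj₂ r)) ]′ (new false q b)
    b→ _ q X x ()
    bc : ∀ p → p ≡ par e → ∀ v x → C ⊑ x → T (D' (par e) ((v ∷ x) ∪ (sgn p ∷ A))) → T (selB p v (B t e x) (B t (suc e) x))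
    bc true q O x c d = Ad.B'C c (J' true q ⊑∪r d)
    bc true q P x c d = Ad.B'C c (J' true q ⊑∪r d)
    bc true q M x c d = ⊥-elim (Am'.D-ok (par e) d)
    bc true q X x c d = ⊥-elim (Am'.D-ok (par e) d)
    bc false q O x c d = Ad.B'C c (J' false q ⊑∪r d)
    bc false q P x c d = ⊥-elim (Am'.D-ok (par e) d)
    bc false q M x c d = Ad.B'C c (J' false q ⊑∪r d)
    bc false q X x c d = ⊥-elim (Am'.D-ok (par e) d)
    i→ : ∀ p v x → T (selI p v (I t e x) (I t (suc e) x)) → T (selI p v (I s e x) (I t (suc e) x)) ⊎ (sgn p ∷ A) ⊑ (v ∷ x)
    i→ true O x i = inj₁ i
    i→ true P x i = [ inj₁ , (λ a → inj₂ (PP ∷ a)) ]′ (Ad.I'→ i)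
    i→ true M x i = inj₁ i
    i→ false O x i = inj₁ i
    i→ false P x i = inj₁ i
    i→ false M x i = [ inj₁ , (λ a → inj₂ (MM ∷ a)) ]′ (Ad.I'→ i)
    i→ _ X x ()
    ia : ∀ p → p ≡ par e → ∀ v x → sgn p ≤q v → A ⊑ x → T (D' (par e) (v ∷ x)) → T (selI p v (I t e x) (I t (suc e) x))
    ia true q P x PP a d = Ad.I'A a (J' true q a d)
    ia false q M x MM a d = Ad.I'A a (J' false q a d)
    ia true q X x PX a d = ⊥-elim (Am'.D-ok (par e) d)
    ia false q X x MX a d = ⊥-elim (Am'.D-ok (par e) d)

  -- Here the base of the added cone already lies in Bᵢ, since even the enlarged Bᵢ₊₁ does (`B×`).
  -- The cone is met along its base as well as over the boundary of `C`, that is, over the boundary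
  -- of `C` with the apex added, and the apex joins `C`.
  up-opp : ∀ i → e ≡ suc i →
           Add (D' (par i)) (stepB (B s) i) (stepI (I s) i) (mixB (B s) (B t) i) (mixI (I s) (I t) i) (O ∷ A) (sgn (not (par i)) ∷ C)
  up-opp i refl = record
    { dis = O⊥ ∷ Ad.dis
    ; dAC = N' (par i) refl (CJ ⊑∪l Ad.dAC)
    ; a1 = λ { {v ∷ x} (u ∷ c) b → a1' (par i) v x u c b }
    ; a2 = λ { {v ∷ x} (_ ∷ a) d k → a2' (par i) refl v x a d k }
    ; B'→ = λ { {v ∷ x} → b→ (par i) refl v x }
    ; B≤ = λ { {v ∷ x} → selB-mono (par i) v id (B≤ (suc i)) }
    ; B'C = λ { {v ∷ x} (u ∷ c) d → bc (par i) refl v x u c d }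
    ; I'→ = λ { {v ∷ x} → i→ (par i) v x }
    ; I≤ = λ { {v ∷ x} → selI-mono (par i) v id (I≤ (suc i)) }
    ; I'A = λ { {v ∷ x} (_ ∷ a) d → ia (par i) refl v x a d }
    }
    where
    N' : ∀ p → p ≡ par i → ∀ {x} → T (N e x) → T (D' (par i) (sgn (not p) ∷ x))
    N' true q {x} t = Am'.N⊂D i (subst (λ p → T (selB p M (N i x) (N e x))) q t)
    N' false q {x} t = Am'.N⊂D i (subst (λ p → T (selB p P (N i x) (N e x))) q t)
    J' : ∀ p → p ≡ par i → ∀ v {x} → A ⊑ x → T (D' (par i) (v ∷ x)) → T (selI p v (J i x) (J e x))
    J' _ refl' v {x} a d = subst (λ p → T (selI p v (J i x) (J e x))) (sym refl') (Am'.J-op i (O≤ ∷ a) d JA)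
    II : ∀ {x} → A ⊑ x → T (D (par i) x) → T (I s i x)
    II a d = S.I-op i a d (I× i IA)
    a1' : ∀ p v x → sgn (not p) ≤q v → C ⊑ x → T (selB p v (B s i x) (B s e x)) → ⊥
    a1' true M x MM c b = Ad.a1 c b
    a1' false P x PP c b = Ad.a1 c b
    a1' true X x MX c ()
    a1' false X x PX c ()
    BB : ∀ {x} → A ⊑ x → T (D (par e) x) → C ⊑ x ⊎ T (B s e x) → T (B s i x)
    BB {x} a d (inj₁ c) = B× i (Ad.B'C c (subst (T ∘ D (par e)) (sym (⊑→∪ a)) d))
    BB a d (inj₂ b) = S.B-dec i b
    a2' : ∀ p → p ≡ par i → ∀ v x → A ⊑ x → T (D' (par i) (v ∷ x)) → ¬ T (selI p v (I s i x) (I s e x)) →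
          T (D' (par i) ((v ∷ x) ∪ (sgn (not p) ∷ C))) × ((sgn (not p) ∷ C) ⊑ (v ∷ x) ⊎ T (selB p v (B s i x) (B s e x)))
    a2' true q O x a d k = N' true q (CJ (⊑-trans a ⊑∪l) (proj₁ r)) , inj₂ (BB a dx (proj₂ r))
      where
      dx = J→D e (J' true q O a d)
      r = Ad.a2 a dx k
    a2' true q P x a d k = ⊥-elim (k (II a (J→D i (J' true q P a d))))
    a2' true q M x a d k with Ad.a2 a (J→D e (J' true q M a d)) k
    ... | dc , inj₁ c = N' true q (CJ (⊑-trans a ⊑∪l) dc) , inj₁ (MM ∷ c)
    ... | dc , inj₂ b = N' true q (CJ (⊑-trans a ⊑∪l) dc) , inj₂ b
    a2' false q O x a d k = N' false q (CJ (⊑-trans a ⊑∪l) (proj₁ r)) , inj₂ (BB a dx (proj₂ r))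
      where
      dx = J→D e (J' false q O a d)
      r = Ad.a2 a dx k
    a2' false q M x a d k = ⊥-elim (k (II a (J→D i (J' false q M a d))))
    a2' false q P x a d k with Ad.a2 a (J→D e (J' false q P a d)) k
    ... | dc , inj₁ c = N' false q (CJ (⊑-trans a ⊑∪l) dc) , inj₁ (PP ∷ c)
    ... | dc , inj₂ b = N' false q (CJ (⊑-trans a ⊑∪l) dc) , inj₂ b
    a2' p q X x a d k = ⊥-elim (Am'.D-ok (par i) d)
    new : ∀ p → p ≡ par i → ∀ {x} → T (B t e x) → T (B s e x) ⊎ (C ⊑ x × T (D' (par i) (sgn (not p) ∷ (x ∪ A))))
    new p q b with Ad.B'→ b
    ... | inj₁ r = inj₁ r
    ... | inj₂ (c , d) = inj₂ (c , N' p q (CJ ⊑∪r d))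
    b→ : ∀ p → p ≡ par i → ∀ v x → T (selB p v (B s i x) (B t e x)) →
         T (selB p v (B s i x) (B s e x)) ⊎ ((sgn (not p) ∷ C) ⊑ (v ∷ x) × T (D' (par i) ((v ∷ x) ∪ (O ∷ A))))
    b→ true q O x b = inj₁ b
    b→ true q P x b = inj₁ b
    b→ true q M x b = [ inj₁ , (λ r → inj₂ (MM ∷ proj₁ r , proj₂ r)) ]′ (new true q b)
    b→ false q O x b = inj₁ b
    b→ false q M x b = inj₁ b
    b→ false q P x b = [ inj₁ , (λ r → inj₂ (PP ∷ proj₁ r , proj₂ r)) ]′ (new false q b)
    b→ _ q X x ()
    bc : ∀ p → p ≡ par i → ∀ v x → sgn (not p) ≤q v → C ⊑ x → T (D' (par i) ((v ∷ x) ∪ (O ∷ A))) → T (selB p v (B s i x) (B t e x))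
    bc true q M x MM c d = Ad.B'C c (J→D e (J' true q M ⊑∪r d))
    bc false q P x PP c d = Ad.B'C c (J→D e (J' false q P ⊑∪r d))
    bc true q X x MX c d = ⊥-elim (Am'.D-ok (par i) d)
    bc false q X x PX c d = ⊥-elim (Am'.D-ok (par i) d)
    i→ : ∀ p v x → T (selI p v (I s i x) (I t e x)) → T (selI p v (I s i x) (I s e x)) ⊎ (O ∷ A) ⊑ (v ∷ x)
    i→ true O x k = [ inj₁ , (λ a → inj₂ (O≤ ∷ a)) ]′ (Ad.I'→ k)
    i→ true P x k = inj₁ k
    i→ true M x k = [ inj₁ , (λ a → inj₂ (O≤ ∷ a)) ]′ (Ad.I'→ k)
    i→ false O x k = [ inj₁ , (λ a → inj₂ (O≤ ∷ a)) ]′ (Ad.I'→ k)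
    i→ false M x k = inj₁ k
    i→ false P x k = [ inj₁ , (λ a → inj₂ (O≤ ∷ a)) ]′ (Ad.I'→ k)
    i→ _ X x ()
    ia : ∀ p → p ≡ par i → ∀ v x → A ⊑ x → T (D' (par i) (v ∷ x)) → T (selI p v (I s i x) (I t e x))
    ia true q O x a d = Ad.I'A a (J→D e (J' true q O a d))
    ia true q P x a d = II a (J→D i (J' true q P a d))
    ia true q M x a d = Ad.I'A a (J→D e (J' true q M a d))
    ia false q O x a d = Ad.I'A a (J→D e (J' false q O a d))
    ia false q M x a d = II a (J→D i (J' false q M a d))
    ia false q P x a d = Ad.I'A a (J→D e (J' false q P a d))
    ia p q X x a d = ⊥-elim (Am'.D-ok (par i) d)

-- Paths of states and their suspension.

record _≈S_ {n} (s t : St n) : Set where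
  field
    ≈B : ∀ e x → B s e x ≡ B t e x
    ≈I : ∀ e x → I s e x ≡ I t e x

-- A stellar subdivision at `A` needs two vertices. At index 0, passing to the complement exchanges
-- `A` with `C`, which may be empty, so the bound restarts at 0; each suspension then adds the apex
-- to `A`, and two of them bring the bound back to 2.
R : ℕ → ℕ → ℕ
R t zero = t
R t (suc e) = 2

-- Only new faces at index 0 may be small, and only steps that shrink a ball must keep their C nonempty:
-- these are the cases in which an exchange is not a mere relabelling.
data Path {n} (D : Bool → Pred n) (Ok : St n → Set) (t : ℕ) : St n → St n → Set where
  done   : ∀ {x} → Path D Ok t x x
  same   : ∀ {x y z} → x ≈S y → Ok y → Path D Ok t y z → Path D Ok t x z
  grow   : ∀ {x y z e A C} → Ok y → El D x y e A C → R t e ≤ card A → Path D Ok t y z → Path D Ok t x z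
  shrink : ∀ {x y z e A C} → Ok y → El D y x e A C → R t e ≤ card A → 1 ≤ card C → Path D Ok t y z → Path D Ok t x z

OkX OkU : ∀ {n} → (Bool → Pred n) → Fam n → Fam n → St n → Set
OkX D N J s = Good D N J s × Disj10 s
OkU D N J s = Good D N J s × Disj00 s

card-sgn : ∀ p → cardq (sgn p) ≡ 1
card-sgn true = refl
card-sgn false = refl

module _ {n} {D : Bool → Pred n} {N J} {D' : Bool → Pred (suc n)} (am : Amb D N J) (am' : Amb D' (stepB N) (stepI J))
         {Ok' : St (suc n) → Set}
         (mk : ∀ {s t} → OkX D N J s → OkX D N J t → Near s t → Ok' (mixS s t))
         {t t'} (le : t' ≤ suc t) (le2 : t' ≤ 2) where

  private
    El₂ : ∀ {x y e A C} → OkX D N J x → OkX D N J y → El D x y e A C →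
          El D' (mixS x y) (stepS y) e (sgn (par e) ∷ A) (O ∷ C)
    El₂ {x} {y} {e} gx gy l = record
      { add = up-same am am' (proj₁ gx) (proj₁ gy) l
      ; oB = λ { j q (v ∷ z) → cong (λ a → selB (par j) v a (B y (suc j) z)) (El.oB l j q z) }
      ; oI = λ { j q (v ∷ z) → cong (λ a → selI (par j) v a (I y (suc j) z)) (El.oI l j q z) } }

    El₁ : ∀ {x y i A C} → OkX D N J x → OkX D N J y → El D x y (suc i) A C →
          El D' (stepS x) (mixS x y) i (O ∷ A) (sgn (not (par i)) ∷ C)
    El₁ {x} {y} {i} gx gy l = record
      { add = up-opp am am' (proj₁ gx) (proj₁ gy) l i refl
      ; oB = λ { j q (v ∷ z) → cong (selB (par j) v (B x j z)) (El.oB l (suc j) (λ r → q (ℕₚ.suc-injective r)) z) }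
      ; oI = λ { j q (v ∷ z) → cong (selI (par j) v (I x j z)) (El.oI l (suc j) (λ r → q (ℕₚ.suc-injective r)) z) } }

    ≈₁ : ∀ {x y A C} → El D x y 0 A C → stepS x ≈S mixS x y
    ≈₁ {x} {y} l = record
      { ≈B = λ { j (v ∷ z) → cong (selB (par j) v (B x j z)) (El.oB l (suc j) (λ ()) z) }
      ; ≈I = λ { j (v ∷ z) → cong (selI (par j) v (I x j z)) (El.oI l (suc j) (λ ()) z) } }

    r-same : ∀ e {A : Vec Q n} → R t e ≤ card A → R t' e ≤ card (sgn (par e) ∷ A)
    r-same zero r = ≤-trans le (s≤s r)
    r-same (suc e) {A} r = subst (λ k → 2 ≤ k + card A) (sym (card-sgn (par (suc e)))) (≤-trans r (ℕₚ.n≤1+n _))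

    r-opp : ∀ i {A : Vec Q n} → 2 ≤ card A → R t' i ≤ card (O ∷ A)
    r-opp zero r = ≤-trans le2 r
    r-opp (suc i) r = r

  -- A change at index e becomes one at index e - 1 on the opposite apex and one at index e, with
  -- `mixS` in between. To keep the family nested, a growth treats the smaller index first and a
  -- shrinking treats it last. For e = 0 only one of the two remains.
  step-path : ∀ {x z} → OkX D N J x → Path D (OkX D N J) t x z → Path D' Ok' t' (stepS x) (stepS z)
  step-path ox done = done
  step-path ox (same {x} {y} p oy w) =
    same (record { ≈B = λ { j (v ∷ z) → cong₂ (selB (par j) v) (_≈S_.≈B p j z) (_≈S_.≈B p (suc j) z) }
                 ; ≈I = λ { j (v ∷ z) → cong₂ (selI (par j) v) (_≈S_.≈I p j z) (_≈S_.≈I p (suc j) z) } })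
         (mk oy oy (near-refl (proj₁ oy))) (step-path oy w)
  step-path ox (grow {e = zero} {A = A} oy l r w) =
    same (≈₁ l) (mk ox oy (el-near (proj₁ ox) (proj₁ oy) l))
      (grow (mk oy oy (near-refl (proj₁ oy))) (El₂ ox oy l) (r-same 0 {A} r) (step-path oy w))
  step-path ox (grow {e = suc i} {A = A} oy l r w) =
    grow (mk ox oy (el-near (proj₁ ox) (proj₁ oy) l)) (El₁ ox oy l) (r-opp i {A} r)
      (grow (mk oy oy (near-refl (proj₁ oy))) (El₂ ox oy l) (r-same (suc i) {A} r) (step-path oy w))
  step-path ox (shrink {x} {y} {e = zero} {A = A} oy l r c w) =
    shrink (mk oy ox nr) (El₂ oy ox l) (r-same 0 {A} r) c
      (same (record { ≈B = λ e z → sym (_≈S_.≈B (≈₁ l) e z) ; ≈I = λ e z → sym (_≈S_.≈I (≈₁ l) e z) })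
            (mk oy oy (near-refl (proj₁ oy))) (step-path oy w))
    where nr = el-near (proj₁ oy) (proj₁ ox) l
  step-path ox (shrink {e = suc i} {A = A} {C} oy l r c w) =
    shrink (mk oy ox (el-near (proj₁ oy) (proj₁ ox) l)) (El₂ oy ox l) (r-same (suc i) {A} r) c
      (shrink (mk oy oy (near-refl (proj₁ oy))) (El₁ oy ox l) (r-opp i {A} r)
        (≤-trans c (ℕₚ.m≤n+m (card C) _)) (step-path oy w))

-- Extension of a family by the complement.

Both : ∀ {n} → Pred n → Bool → Pred n
Both D _ = D

-- Passing to the complement of the ball of index 0 prolongs a family by one term.
extN : ∀ {n} → Pred n → Fam n → Fam n
extN D F zero x = D x
extN D F (suc e) x = F e (neg' x)

-- The complement belongs to the larger state t and the shifted terms to the smaller state s, so the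
-- family stays nested halfway between s and t. The closed complement omits only the interior of the
-- ball, and its own interior omits the whole ball.
extM : ∀ {n} → Pred n → St n → St n → St n
extM D s t = st (λ { zero x → D x ∧ not (I t 0 x) ; (suc e) x → B s e (neg' x) })
                (λ { zero x → D x ∧ not (B t 0 x) ; (suc e) x → I s e (neg' x) })

extS : ∀ {n} → Pred n → St n → St n
extS D s = extM D s s

module _ {n} {D : Pred n} {N J : Fam n} (am : Amb (Both D) N J) (D-sym : ∀ {x} → T (D x) → T (D (neg' x))) where
  private module Am = Amb am

  D-sym⁻ : ∀ {x} → T (D (neg' x)) → T (D x)
  D-sym⁻ {x} d = subst (T ∘ D) (neg-inv x) (D-sym d)

  ext-amb : Amb (Both D) (extN D N) (extN D J)
  ext-amb = record
    { D-ok = Am.D-ok ; D-cl = Am.D-cl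
    ; N⊂D = λ { zero d → d ; (suc e) p → D-sym⁻ (Am.N⊂D e p) }
    ; J⊂N = λ { zero d → d ; (suc e) p → Am.J⊂N e p }
    ; J-op = λ { zero s d _ → d ; (suc e) s d p → Am.J-op e (neg-mono s) (D-sym d) p }
    ; N-dec = λ { zero p → D-sym⁻ (Am.N⊂D 0 p) ; (suc e) p → Am.N-dec e p }
    ; J-dec = λ { zero p → D-sym⁻ (Am.N⊂D 0 (Am.J⊂N 0 p)) ; (suc e) p → Am.J-dec e p } }

  -- The inclusion of term 1 in term 0 is `Disj00`: -B₀ misses the interior of B₀. In turn term 1
  -- and the reflected interior of term 0 are disjoint by the definition of the complement, which
  -- gives `Disj10`.
  ext-ok : ∀ {s t} → OkU (Both D) N J s → OkU (Both D) N J t → Near s t → OkX (Both D) (extN D N) (extN D J) (extM D s t)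
  ext-ok {s} {t} (gs , ds) (gt , dt) nr = record
    { B-cl = λ { zero l p → ∧-i (Am.D-cl true l (∧-l p)) (¬-i (λ i → ¬-e (∧-r {D _} p) (G.I-op 0 l (∧-l p) i)))
               ; (suc e) l p → S.B-cl e (neg-mono l) p }
    ; I-op = λ { zero l d p → ∧-i d (¬-i (λ b → ¬-e (∧-r {D _} p) (G.B-cl 0 l b)))
               ; (suc e) l d p → S.I-op e (neg-mono l) (D-sym d) p }
    ; I⊂B = λ { zero p → ∧-i (∧-l p) (¬-i (λ i → ¬-e (∧-r {D _} p) (G.I⊂B 0 i))) ; (suc e) p → S.I⊂B e p }
    ; B⊂N = λ { zero p → ∧-l p ; (suc e) p → S.B⊂N e p }
    ; I⊂J = λ { zero p → ∧-l p ; (suc e) p → S.I⊂J e p }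
    ; B-dec = λ { zero {x} p → ∧-i (D-sym⁻ (Am.N⊂D 0 (S.B⊂N 0 p)))
                                   (¬-i (λ i → dt _ (B≤ 0 p) (subst (T ∘ I t 0) (sym (neg-inv x)) i)))
                ; (suc e) p → S.B-dec e p }
    ; I-dec = λ { zero {x} p → ∧-i (D-sym⁻ (Am.N⊂D 0 (S.B⊂N 0 (S.I⊂B 0 p)))) (¬-i (λ b → dt x b (I≤ 0 p)))
                ; (suc e) p → S.I-dec e p }
    ; D0 = λ { zero {x} p q → ¬-e (∧-r {D _} p) (I≤ 0 (subst (T ∘ I s 0) (neg-inv x) q))
             ; (suc e) {x} p q → S.D0 e p q }
    } , (λ x p q → ¬-e (∧-r {D _} q) (B≤ 0 p))
    where
    module S = Good gs
    module G = Good gt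
    open Near nr

  private
    neg∪ : ∀ {x A : Vec Q n} → neg' (x ∪ neg' A) ≡ neg' x ∪ A
    neg∪ {x} {A} = trans (neg-∪ x (neg' A)) (cong (neg' x ∪_) (neg-inv A))

  Add-neg : ∀ {E H E' H' : Pred n} {A C} → Add D E H E' H' A C →
            Add D (E ∘ neg') (H ∘ neg') (E' ∘ neg') (H' ∘ neg') (neg' A) (neg' C)
  Add-neg {A = A} {C} a = record
    { dis = ⊥v-neg dis
    ; dAC = subst (T ∘ D) (neg-∪ A C) (D-sym dAC)
    ; a1 = λ l → a1 (neg-mono⁺ l)
    ; a2 = λ {x} l d i → let r = a2 (neg-mono⁺ l) (D-sym d) i in
        D-sym⁻ (subst (T ∘ D) (sym (neg∪ {x} {C})) (proj₁ r)) , [ (λ c → inj₁ (neg-mono⁻ c)) , inj₂ ]′ (proj₂ r)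
    ; B'→ = λ {x} b → [ inj₁ , (λ r → inj₂ (neg-mono⁻ (proj₁ r) , D-sym⁻ (subst (T ∘ D) (sym (neg∪ {x} {A})) (proj₂ r)))) ]′ (B'→ b)
    ; B≤ = B≤
    ; B'C = λ {x} c d → B'C (neg-mono⁺ c) (subst (T ∘ D) (neg∪ {x} {A}) (D-sym d))
    ; I'→ = λ i → [ inj₁ , (λ r → inj₂ (neg-mono⁻ r)) ]′ (I'→ i)
    ; I≤ = I≤
    ; I'A = λ l d → I'A (neg-mono⁺ l) (D-sym d) }
    where open Add a

  -- The complements of the two balls are related by the opposite exchange.
  Add-co : ∀ {s t A C} → Good (Both D) N J s → El (Both D) s t 0 A C →
           Add D (λ x → D x ∧ not (I t 0 x)) (λ x → D x ∧ not (B t 0 x))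
                 (λ x → D x ∧ not (I s 0 x)) (λ x → D x ∧ not (B s 0 x)) C A
  Add-co {s} {t} {A} {C} gs l = record
    { dis = ⊥v-sym dis
    ; dAC = subst (T ∘ D) (∪-comm A C) dAC
    ; a1 = λ a p → ¬-e (∧-r {D _} p) (I'A a (∧-l p))
    ; a2 = λ {x} c d nb → a2' c d nb (T? (B t 0 x)) (T? (I t 0 x))
    ; B'→ = λ {x} p → b→ (∧-l p) (¬-e (∧-r {D _} p)) (T? (I t 0 x))
    ; B≤ = λ p → ∧-i (∧-l p) (¬-i (λ i → ¬-e (∧-r {D _} p) (I≤ i)))
    ; B'C = λ a d → ∧-i (Am.D-cl true ⊑∪l d) (¬-i (λ i → a1 (⊑∪r) (S.I⊂B 0 (S.I-op 0 ⊑∪l d i))))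
    ; I'→ = λ {x} p → i→ (∧-l p) (¬-e (∧-r {D _} p)) (T? (B t 0 x))
    ; I≤ = λ p → ∧-i (∧-l p) (¬-i (λ b → ¬-e (∧-r {D _} p) (B≤ b)))
    ; I'A = λ c d → ∧-i d (¬-i (a1 c)) }
    where
    open Add (El.add l)
    module S = Good gs
    a2' : ∀ {x} → C ⊑ x → T (D x) → ¬ T (D x ∧ not (B t 0 x)) → T (B t 0 x) ⊎ ¬ T (B t 0 x) → T (I t 0 x) ⊎ ¬ T (I t 0 x) →
          T (D (x ∪ A)) × (A ⊑ x ⊎ T (D x ∧ not (I t 0 x)))
    a2' c d nb (inj₂ b) _ = ⊥-elim (nb (∧-i d (¬-i b)))
    a2' c d nb (inj₁ b) i with B'→ b
    ... | inj₁ b₀ = ⊥-elim (a1 c b₀)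
    a2' c d nb (inj₁ b) (inj₂ i) | inj₂ (_ , e) = e , inj₂ (∧-i d (¬-i i))
    a2' c d nb (inj₁ b) (inj₁ i) | inj₂ (_ , e) = e , [ (λ k → ⊥-elim (a1 c (S.I⊂B 0 k))) , inj₁ ]′ (I'→ i)
    b→ : ∀ {x} → T (D x) → ¬ T (I s 0 x) → T (I t 0 x) ⊎ ¬ T (I t 0 x) → T (D x ∧ not (I t 0 x)) ⊎ (A ⊑ x × T (D (x ∪ C)))
    b→ d ni (inj₂ i) = inj₁ (∧-i d (¬-i i))
    b→ d ni (inj₁ i) = [ (λ k → ⊥-elim (ni k)) , (λ a → inj₂ (a , proj₁ (a2 a d ni))) ]′ (I'→ i)
    i→ : ∀ {x} → T (D x) → ¬ T (B s 0 x) → T (B t 0 x) ⊎ ¬ T (B t 0 x) → T (D x ∧ not (B t 0 x)) ⊎ C ⊑ x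
    i→ d nb (inj₂ b) = inj₁ (∧-i d (¬-i b))
    i→ d nb (inj₁ b) = [ (λ k → ⊥-elim (nb k)) , (λ r → inj₂ (proj₁ r)) ]′ (B'→ b)

  private
    co : ∀ {x y A C} → OkU (Both D) N J x → El (Both D) x y 0 A C → El (Both D) (extM D x y) (extS D x) 0 C A
    co gx l = record { add = Add-co (proj₁ gx) l
                     ; oB = λ { zero q x → ⊥-elim (q refl) ; (suc j) q x → refl }
                     ; oI = λ { zero q x → ⊥-elim (q refl) ; (suc j) q x → refl } }
    El-ext : ∀ {x y e A C} → El (Both D) x y e A C → El (Both D) (extM D x y) (extS D y) (suc e) (neg' A) (neg' C)
    El-ext l = record { add = Add-neg (El.add l)
                      ; oB = λ { zero q x → refl ; (suc j) q x → El.oB l j (λ r → q (cong suc r)) (neg' x) }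
                      ; oI = λ { zero q x → refl ; (suc j) q x → El.oI l j (λ r → q (cong suc r)) (neg' x) } }
    ≈₀ : ∀ {x y e A C} → El (Both D) x y (suc e) A C → extS D x ≈S extM D x y
    ≈₀ l = record { ≈B = λ { zero x → cong (λ k → D x ∧ not k) (El.oI l 0 (λ ()) x) ; (suc j) x → refl }
                  ; ≈I = λ { zero x → cong (λ k → D x ∧ not k) (El.oB l 0 (λ ()) x) ; (suc j) x → refl } }
    ≈S-sym : ∀ {x y : St n} → x ≈S y → y ≈S x
    ≈S-sym p = record { ≈B = λ e x → sym (_≈S_.≈B p e x) ; ≈I = λ e x → sym (_≈S_.≈I p e x) }
    cneg : ∀ {k} {A : Vec Q n} → k ≤ card A → k ≤ card (neg' A)
    cneg {k} {A} r = subst (k ≤_) (sym (card-neg A)) r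
  -- A change at index 0 happens twice: in the complement, by the opposite exchange, and in the
  -- reflected ball, now at index 1. Whichever of the two shrinks goes first. When the complement
  -- shrinks, the old bound on `A` supplies the nonempty `C`.
  ext-path : ∀ {x z} → OkU (Both D) N J x → Path (Both D) (OkU (Both D) N J) 2 x z →
             Path (Both D) (OkX (Both D) (extN D N) (extN D J)) 0 (extS D x) (extS D z)
  ext-path ox done = done
  ext-path ox (same p oy w) =
    same (record { ≈B = λ { zero x → cong (λ k → D x ∧ not k) (_≈S_.≈I p 0 x) ; (suc j) x → _≈S_.≈B p j (neg' x) }
                 ; ≈I = λ { zero x → cong (λ k → D x ∧ not k) (_≈S_.≈B p 0 x) ; (suc j) x → _≈S_.≈I p j (neg' x) } })
         (ext-ok oy oy (near-refl (proj₁ oy))) (ext-path oy w)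
  ext-path ox (grow {e = zero} {A} oy l r w) =
    shrink (ext-ok ox oy (el-near (proj₁ ox) (proj₁ oy) l)) (co ox l) z≤n (≤-trans (s≤s z≤n) r)
      (grow (ext-ok oy oy (near-refl (proj₁ oy))) (El-ext l) (cneg {A = A} r) (ext-path oy w))
  ext-path ox (grow {e = suc e} {A} oy l r w) =
    same (≈₀ l) (ext-ok ox oy (el-near (proj₁ ox) (proj₁ oy) l))
      (grow (ext-ok oy oy (near-refl (proj₁ oy))) (El-ext l) (cneg {A = A} r) (ext-path oy w))
  ext-path ox (shrink {e = zero} {A} {C} oy l r c w) =
    shrink (ext-ok oy ox (el-near (proj₁ oy) (proj₁ ox) l)) (El-ext l) (cneg {A = A} r) (cneg {A = C} c)
      (grow (ext-ok oy oy (near-refl (proj₁ oy))) (co oy l) z≤n (ext-path oy w))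
  ext-path ox (shrink {e = suc e} {A} {C} oy l r c w) =
    shrink (ext-ok oy ox (el-near (proj₁ oy) (proj₁ ox) l)) (El-ext l) (cneg {A = A} r) (cneg {A = C} c)
      (same (≈S-sym (≈₀ l)) (ext-ok oy oy (near-refl (proj₁ oy))) (ext-path oy w))

-- The double suspension of an extended family.

emptyS : ∀ {n} → St n
emptyS = st (λ _ _ → false) (λ _ _ → false)

empty-ok : ∀ {n} {D : Bool → Pred n} {N J} → OkU D N J emptyS
empty-ok = record { B-cl = λ _ _ () ; I-op = λ _ _ _ () ; I⊂B = λ _ () ; B⊂N = λ _ () ; I⊂J = λ _ ()
                  ; B-dec = λ _ () ; I-dec = λ _ () ; D0 = λ _ () } , (λ _ ())

-- After the first of the two suspensions the ambient complex is a link of the outer apex. The links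
-- of its two signs may differ in the actual sphere, and the parity of the index tells in which of
-- them a term has to be measured.
Half : ∀ {n} → Pred (suc n) → Bool → Pred n
Half D p x = D (sgn p ∷ x)

stepB-sgn : ∀ {n} (F : Fam n) e {x} → T (F e x) → T (stepB F e (sgn (par e) ∷ x))
stepB-sgn F e t with par e
... | true = t
... | false = t

stepI-sgn : ∀ {n} (F : Fam n) e {x} → T (F e x) → T (stepI F e (sgn (par e) ∷ x))
stepI-sgn F e t with par e
... | true = t
... | false = t

stepI-sgn⁻ : ∀ {n} (F : Fam n) e {x} → T (stepI F e (sgn (par e) ∷ x)) → T (F e x)
stepI-sgn⁻ F e t with par e
... | true = t
... | false = t

sgn≤ : ∀ p → sgn p ≤q sgn p
sgn≤ p = ≤q-refl

okq-sgn : ∀ p {b} → T (okq (sgn p) ∧ b) → T b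
okq-sgn true t = t
okq-sgn false t = t

half-amb : ∀ {n} {D : Pred (suc n)} {N J : Fam n} → Amb (Both D) (stepB N) (stepI J) →
           (∀ e {x} → T (N (suc e) x) → T (N e x)) → (∀ e {x} → T (J (suc e) x) → T (J e x)) →
           (∀ e {x} → T (J e x) → T (N e x)) → Amb (Half D) N J
half-amb {D = D} {N} {J} a nd jd jn = record
  { D-ok = λ p d → okq-sgn p (D-ok p d)
  ; D-cl = λ p l d → D-cl p (sgn≤ p ∷ l) d
  ; N⊂D = λ e t → N⊂D e (stepB-sgn N e t)
  ; J⊂N = jn
  ; J-op = λ e l d j → stepI-sgn⁻ J e (J-op e (sgn≤ (par e) ∷ l) d (stepI-sgn J e j))
  ; N-dec = nd
  ; J-dec = jd }
  where open Amb a

step-N-dec : ∀ {n} {F : Fam n} → (∀ e {x} → T (F (suc e) x) → T (F e x)) → ∀ e {x} → T (stepB F (suc e) x) → T (stepB F e x)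
step-N-dec d e {v ∷ x} = selB-dec (par e) v (d e) (λ p → d e (d (suc e) p)) id

step-J-dec : ∀ {n} {F : Fam n} → (∀ e {x} → T (F (suc e) x) → T (F e x)) → ∀ e {x} → T (stepI F (suc e) x) → T (stepI F e x)
step-J-dec d e {v ∷ x} = selI-dec (par e) v (λ p → d e (d (suc e) p)) (d (suc e)) id

step-J⊂N : ∀ {n} {N J : Fam n} → (∀ e {x} → T (J e x) → T (N e x)) → (∀ e {x} → T (N (suc e) x) → T (N e x)) →
           ∀ e {x} → T (stepI J e x) → T (stepB N e x)
step-J⊂N s d e {v ∷ x} = selIB (par e) v (s e) (s (suc e)) (λ j → d e (s (suc e) j))

upS : ∀ {n} → Pred n → St n → St (suc (suc n))
upS D s = stepS (stepS (extS D s))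

upN upJ : ∀ {n} → Pred n → Fam n → Fam (suc (suc n))
upN D F = stepB (stepB (extN D F))
upJ D F = stepI (stepI (extN D F))

selB-ff : ∀ p v → selB p v false false ≡ false
selB-ff p O = refl
selB-ff true P = refl
selB-ff true M = refl
selB-ff true X = refl
selB-ff false P = refl
selB-ff false M = refl
selB-ff false X = refl

selI-ff : ∀ p v → selI p v false false ≡ false
selI-ff p O = refl
selI-ff true P = refl
selI-ff true M = refl
selI-ff true X = refl
selI-ff false P = refl
selI-ff false M = refl
selI-ff false X = refl

module _ {n} {D : Pred n} {N J : Fam n} {D″ : Pred (suc (suc n))} (am : Amb (Both D) N J)
         (D-sym : ∀ {x} → T (D x) → T (D (neg' x))) (am″ : Amb (Both D″) (upN D N) (upJ D J)) where
  private
    amX = ext-amb am D-sym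
    module AX = Amb amX
    amH : Amb (Half D″) (stepB (extN D N)) (stepI (extN D J))
    amH = half-amb am″ (step-N-dec AX.N-dec) (step-J-dec AX.J-dec) (step-J⊂N AX.J⊂N AX.N-dec)

    OX = OkX (Both D) (extN D N) (extN D J)
    OH = OkX (Half D″) (stepB (extN D N)) (stepI (extN D J))
    OU = OkU (Both D″) (upN D N) (upJ D J)

    mk₁ : ∀ {s t} → OX s → OX t → Near s t → OH (mixS s t)
    mk₁ (gs , ds) (gt , dt) nr = mix-good amX amH gs gt nr , mix-d10 gs gt nr ds

    mk₂ : ∀ {s t} → OH s → OH t → Near s t → OU (mixS s t)
    mk₂ (gs , ds) (gt , dt) nr = mix-good amH am″ gs gt nr , mix-d00 gs gt nr dt

    okX : ∀ {s} → OkU (Both D) N J s → OX (extS D s)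
    okX os = ext-ok am D-sym os os (near-refl (proj₁ os))

    okH : ∀ {s} → OkU (Both D) N J s → OH (stepS (extS D s))
    okH os = mk₁ (okX os) (okX os) (near-refl (proj₁ (okX os)))

  up-ok : ∀ {s} → OkU (Both D) N J s → OU (upS D s)
  up-ok os = mk₂ (okH os) (okH os) (near-refl (proj₁ (okH os)))

  private
    w0 : ∀ (b : Bool) v w → T (selB true v (selB true w b false) (selB false w false false)) → v ≤q P × w ≤q P × T b
    w0 b O O t = O≤ , O≤ , t
    w0 b O P t = O≤ , PP , t
    w0 b P O t = PP , O≤ , t
    w0 b P P t = PP , PP , t
    w0 b M O ()
    w0 b M P ()
    w0 b M M ()
    w0 b M X ()
    w0 b O M ()
    w0 b O X ()
    w0 b P M ()
    w0 b P X ()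
    w0 b X w ()

    w0⁻ : ∀ (b : Bool) v w → v ≤q P → w ≤q P → T b → T (selB true v (selB true w b false) (selB false w false false))
    w0⁻ b O O _ _ t = t
    w0⁻ b O P _ _ t = t
    w0⁻ b P O _ _ t = t
    w0⁻ b P P _ _ t = t

    wI : ∀ (b : Bool) v w → T (selI true v (selI true w b false) (selI false w false false)) → P ≤q v × P ≤q w × T b
    wI b P P t = PP , PP , t
    wI b O O ()
    wI b O P ()
    wI b O M ()
    wI b O X ()
    wI b P O ()
    wI b P M ()
    wI b P X ()
    wI b M O ()
    wI b M P ()
    wI b M M ()
    wI b M X ()
    wI b X w ()

    uP : ∀ {v} → v ≤q P → v ∪q P ≡ P
    uP O≤ = refl
    uP PP = refl

    ok∪P : ∀ v {b} → T (okq (v ∪q P) ∧ b) → v ≤q P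
    ok∪P O _ = O≤
    ok∪P P _ = PP

    ∪∅ : ∀ {m} (x : Vec Q m) → x ∪ ∅ ≡ x
    ∪∅ [] = refl
    ∪∅ (O ∷ x) = cong (O ∷_) (∪∅ x)
    ∪∅ (P ∷ x) = cong (P ∷_) (∪∅ x)
    ∪∅ (M ∷ x) = cong (M ∷_) (∪∅ x)
    ∪∅ (X ∷ x) = cong (X ∷_) (∪∅ x)

    PP→ : ∀ {x} → T (D″ (P ∷ P ∷ x)) → T (D ∅) → T (D x)
    PP→ {x} d d∅ = Amb.J-op am″ 0 {P ∷ P ∷ ∅} (PP ∷ PP ∷ ∅⊑) d d∅

    →PP : ∀ {x} → T (D x) → T (D″ (P ∷ P ∷ x))
    →PP d = Amb.N⊂D am″ 0 d

  -- The complement of the empty ball is the whole of `D`, and coning it from both apices gives the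
  -- star of the edge `P ∷ P ∷ ∅`, whose link in `D″` is `D`.
  first : T (D ∅) → El (Both D″) emptyS (upS D emptyS) 0 (P ∷ P ∷ ∅) ∅
  first d∅ = record
    { add = record
      { dis = ⊥v-∅
      ; dAC = →PP (subst (T ∘ D) (sym (∪∅ ∅)) d∅)
      ; a1 = λ _ ()
      ; a2 = λ {x} _ d _ → subst (T ∘ D″) (sym (∪∅ x)) d , inj₁ ∅⊑
      ; B'→ = λ { {v ∷ w ∷ x} t → inj₂ (∅⊑ , b→ v w x t) }
      ; B≤ = λ ()
      ; B'C = λ { {v ∷ w ∷ x} _ d → bc v w x d }
      ; I'→ = λ { {v ∷ w ∷ x} t → let r = wI (D x ∧ true) v w t in inj₂ (proj₁ r ∷ proj₁ (proj₂ r) ∷ ∅⊑) }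
      ; I≤ = λ ()
      ; I'A = λ { {v ∷ w ∷ x} (a ∷ b ∷ _) d → ia v w x a b d } }
    ; oB = λ { zero q _ → ⊥-elim (q refl) ; (suc i) q (v ∷ w ∷ x) → sym (offB (par (suc i)) (par (suc (suc i))) v w) }
    ; oI = λ { zero q _ → ⊥-elim (q refl) ; (suc i) q (v ∷ w ∷ x) → sym (offI (par (suc i)) (par (suc (suc i))) v w) } }
    where
    b→ : ∀ v w x → T (selB true v (selB true w (D x ∧ true) false) (selB false w false false)) →
         T (D″ ((v ∷ w ∷ x) ∪ (P ∷ P ∷ ∅)))
    b→ v w x t = subst (T ∘ D″) (cong₂ _∷_ (sym (uP (proj₁ r))) (cong₂ _∷_ (sym (uP (proj₁ (proj₂ r)))) (sym (∪∅ x))))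
                   (→PP (∧-l (proj₂ (proj₂ r))))
      where r = w0 (D x ∧ true) v w t
    bc : ∀ v w x → T (D″ ((v ∷ w ∷ x) ∪ (P ∷ P ∷ ∅))) → T (selB true v (selB true w (D x ∧ true) false) (selB false w false false))
    bc v w x d = w0⁻ (D x ∧ true) v w lv lw (∧-i (PP→ d′ d∅) tt)
      where
      k = Amb.D-ok am″ true d
      lv = ok∪P v k
      lw = ok∪P w (∧-r {okq (v ∪q P)} k)
      d′ : T (D″ (P ∷ P ∷ x))
      d′ = subst (T ∘ D″) (cong₂ _∷_ (uP lv) (cong₂ _∷_ (uP lw) (∪∅ x))) d
    ia : ∀ v w x → P ≤q v → P ≤q w → T (D″ (v ∷ w ∷ x)) →
         T (selI true v (selI true w (D x ∧ true) false) (selI false w false false))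
    ia P P x PP PP d = ∧-i (PP→ d d∅) tt
    ia P X x PP PX d = ⊥-elim (Amb.D-ok am″ true d)
    ia X w x PX b d = ⊥-elim (Amb.D-ok am″ true d)
    offB : ∀ p q v w → selB p v (selB p w false false) (selB q w false false) ≡ false
    offB p q v w = trans (cong₂ (selB p v) (selB-ff p w) (selB-ff q w)) (selB-ff p v)
    offI : ∀ p q v w → selI p v (selI p w false false) (selI q w false false) ≡ false
    offI p q v w = trans (cong₂ (selI p v) (selI-ff p w) (selI-ff q w)) (selI-ff p v)

  -- Suspending a path from the empty ball yields one from `upS D emptyS`, which is not the empty
  -- state; `first` bridges the gap.
  up-path : T (D ∅) → ∀ {s} → Path (Both D) (OkU (Both D) N J) 2 emptyS s → Path (Both D″) OU 2 emptyS (upS D s)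
  up-path d∅ w = grow (up-ok empty-ok) (first d∅) (s≤s (s≤s z≤n))
    (step-path amH am″ mk₂ ≤-refl ≤-refl (okH empty-ok)
      (step-path amX amH mk₁ ≤-refl (s≤s z≤n) (okX empty-ok)
        (ext-path am D-sym empty-ok w)))

-- Vertices and embeddings of ground sets.

Vertex : ℕ → Set
Vertex n = Fin n × Bool

bit : ∀ {n} → Vec Q n → Vertex n → Bool
bit x (i , s) = leq (sgn s) (lookup x i)

single : ∀ {n} → Vertex n → Vec Q n
single (zero , s) = sgn s ∷ ∅
single (suc i , s) = O ∷ single (i , s)

upV : ∀ {n} → Vertex n → Vertex (suc n)
upV (i , s) = suc i , s

bit-mono : ∀ {n} {x y : Vec Q n} → x ⊑ y → ∀ v → T (bit x v) → T (bit y v)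
bit-mono (p ∷ q) (zero , s) t = →leq (≤q-trans (leq→ {sgn s} t) p)
bit-mono (p ∷ q) (suc i , s) t = bit-mono q (i , s) t

bits⊑q : ∀ {a b} → (∀ s → T (leq (sgn s) a) → T (leq (sgn s) b)) → a ≤q b
bits⊑q {O} f = O≤
bits⊑q {P} f = leq→ (f true tt)
bits⊑q {M} f = leq→ (f false tt)
bits⊑q {X} {O} f = ⊥-elim (f true tt)
bits⊑q {X} {P} f = ⊥-elim (f false tt)
bits⊑q {X} {M} f = ⊥-elim (f true tt)
bits⊑q {X} {X} f = XX

bits⊑ : ∀ {n} {x y : Vec Q n} → (∀ v → T (bit x v) → T (bit y v)) → x ⊑ y
bits⊑ {x = []} {[]} f = []
bits⊑ {x = a ∷ x} {b ∷ y} f = bits⊑q (λ s → f (zero , s)) ∷ bits⊑ (λ { (i , s) → f (suc i , s) })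

bitq-∪ : ∀ s a b → T (leq (sgn s) (a ∪q b)) → T (leq (sgn s) a) ⊎ T (leq (sgn s) b)
bitq-∪ s O b t = inj₂ t
bitq-∪ s P O t = inj₁ t
bitq-∪ s M O t = inj₁ t
bitq-∪ s X O t = inj₁ t
bitq-∪ true P b t = inj₁ tt
bitq-∪ true M P t = inj₂ tt
bitq-∪ true M X t = inj₂ tt
bitq-∪ true X b t = inj₁ tt
bitq-∪ false P M t = inj₂ tt
bitq-∪ false P X t = inj₂ tt
bitq-∪ false M b t = inj₁ tt
bitq-∪ false X b t = inj₁ tt

bit-∪ : ∀ {n} (x y : Vec Q n) v → T (bit (x ∪ y) v) → T (bit x v) ⊎ T (bit y v)
bit-∪ (a ∷ x) (b ∷ y) (zero , s) t = bitq-∪ s a b t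
bit-∪ (a ∷ x) (b ∷ y) (suc i , s) t = bit-∪ x y (i , s) t

bit-∅ : ∀ {n} (v : Vertex n) → ¬ T (bit ∅ v)
bit-∅ (zero , true) ()
bit-∅ (zero , false) ()
bit-∅ (suc i , s) t = bit-∅ (i , s) t

bit-single : ∀ {n} (v : Vertex n) → T (bit (single v) v)
bit-single (zero , true) = tt
bit-single (zero , false) = tt
bit-single (suc i , s) = bit-single (i , s)

bit-single⁻ : ∀ {n} (v w : Vertex n) → T (bit (single v) w) → w ≡ v
bit-single⁻ (zero , true) (zero , true) t = refl
bit-single⁻ (zero , false) (zero , false) t = refl
bit-single⁻ (zero , s) (suc j , r) t = ⊥-elim (bit-∅ (j , r) t)
bit-single⁻ (suc i , s) (zero , true) ()
bit-single⁻ (suc i , s) (zero , false) ()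
bit-single⁻ (suc i , s) (suc j , r) t = cong upV (bit-single⁻ (i , s) (j , r) t)

single⊑ : ∀ {n} {v : Vertex n} {x} → T (bit x v) → single v ⊑ x
single⊑ {v = v} {x} t = bits⊑ (λ w r → subst (T ∘ bit x) (sym (bit-single⁻ v w r)) t)

⊑single : ∀ {n} {v : Vertex n} {x} → single v ⊑ x → T (bit x v)
⊑single {v = v} l = bit-mono l v (bit-single v)

single-card : ∀ {n} (v : Vertex n) → card (single v) ≡ 1
single-card {suc n} (zero , true) = cong suc (card-∅ {n})
single-card {suc n} (zero , false) = cong suc (card-∅ {n})
single-card (suc i , s) = single-card (i , s)

⊥q-bit : ∀ {a} s → ¬ T (leq (sgn s) a) → a ⊥q sgn s
⊥q-bit {O} s f = O⊥
⊥q-bit {P} true f = ⊥-elim (f tt)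
⊥q-bit {P} false f = PM
⊥q-bit {M} true f = MP
⊥q-bit {M} false f = ⊥-elim (f tt)
⊥q-bit {X} true f = ⊥-elim (f tt)
⊥q-bit {X} false f = ⊥-elim (f tt)

⊥single : ∀ {n} {x : Vec Q n} (v : Vertex n) → ¬ T (bit x v) → x ⊥v single v
⊥single {x = a ∷ x} (zero , s) f = ⊥q-bit s f ∷ ⊥v-∅
⊥single {x = a ∷ x} (suc i , s) f = ⊥O ∷ ⊥single (i , s) f

drop1 : ∀ {n} {C x : Vec Q n} → 1 ≤ card C → C ⊑ x →
        Σ (Vertex n) λ c → Σ (Vec Q n) λ x₁ → x₁ ∪ single c ≡ x × ¬ (C ⊑ x₁)
drop1 {C = O ∷ C} {b ∷ x} r (_ ∷ l) with drop1 {C = C} r l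
... | (i , s) , x₁ , e , f = (suc i , s) , b ∷ x₁ , cong₂ _∷_ (∪q-comm b O) e , (λ { (_ ∷ q) → f q })
drop1 {C = P ∷ C} {P ∷ x} r (PP ∷ l) = (zero , true) , O ∷ x , cong (P ∷_) (⊑→∪ ∅⊑) , (λ { (() ∷ _) })
drop1 {C = P ∷ C} {X ∷ x} r (PX ∷ l) = (zero , true) , M ∷ x , cong (X ∷_) (⊑→∪ ∅⊑) , (λ { (() ∷ _) })
drop1 {C = M ∷ C} {M ∷ x} r (MM ∷ l) = (zero , false) , O ∷ x , cong (M ∷_) (⊑→∪ ∅⊑) , (λ { (() ∷ _) })
drop1 {C = M ∷ C} {X ∷ x} r (MX ∷ l) = (zero , false) , P ∷ x , cong (X ∷_) (⊑→∪ ∅⊑) , (λ { (() ∷ _) })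
drop1 {C = X ∷ C} {X ∷ x} r (XX ∷ l) = (zero , true) , M ∷ x , cong (X ∷_) (⊑→∪ ∅⊑) , (λ { (() ∷ _) })

subB→ : ∀ {m} (σ τ : Subset m) → T (subB σ τ) → ∀ j → T (lookup σ j) → T (lookup τ j)
subB→ (true ∷ σ) (true ∷ τ) t zero _ = tt
subB→ (b ∷ σ) (c ∷ τ) t (suc j) r = subB→ σ τ (∧-r {not b ∨ c} t) j r

→subB : ∀ {m} (σ τ : Subset m) → (∀ j → T (lookup σ j) → T (lookup τ j)) → T (subB σ τ)
→subB [] [] f = tt
→subB (true ∷ σ) (true ∷ τ) f = →subB σ τ (λ j → f (suc j))
→subB (true ∷ σ) (false ∷ τ) f = ⊥-elim (f zero tt)
→subB (false ∷ σ) (c ∷ τ) f = →subB σ τ (λ j → f (suc j))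

lookup-∪ : ∀ {m} (σ τ : Subset m) j → lookup (σ ∪ₛ τ) j ≡ lookup σ j ∨ lookup τ j
lookup-∪ (a ∷ σ) (b ∷ τ) zero = refl
lookup-∪ (a ∷ σ) (b ∷ τ) (suc j) = lookup-∪ σ τ j

∨-split : ∀ {a b} → T (a ∨ b) → T a ⊎ T b
∨-split {true} _ = inj₁ tt
∨-split {false} t = inj₂ t

∨-il : ∀ {a b} → T a → T (a ∨ b)
∨-il {true} _ = tt

∨-ir : ∀ {a b} → T b → T (a ∨ b)
∨-ir {true} _ = tt
∨-ir {false} t = t

-- Intermediate complexes may lack vertices of Vₙ, while `IsComplex` demands every point of its
-- ground set. Listing the m vertices in use lets the ground set grow when a vertex appears.
record Emb (m n : ℕ) : Set where
  field
    emb  : Subset m → Vec Q n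
    g    : Fin m → Vertex n
    p1   : ∀ σ j → bit (emb σ) (g j) ≡ lookup σ j
    p2   : ∀ σ v → T (bit (emb σ) v) → Σ (Fin m) λ j → g j ≡ v
    size : ∀ σ → card (emb σ) ≡ ∣ σ ∣

  mono : ∀ {σ τ} → (∀ j → T (lookup σ j) → T (lookup τ j)) → emb σ ⊑ emb τ
  mono {σ} {τ} f = bits⊑ (λ v t → h v (p2 σ v t) t)
    where
    h : ∀ v → Σ (Fin m) (λ j → g j ≡ v) → T (bit (emb σ) v) → T (bit (emb τ) v)
    h v (j , refl) t = subst T (sym (p1 τ j)) (f j (subst T (p1 σ j) t))

  mono⁻ : ∀ {σ τ} → emb σ ⊑ emb τ → ∀ j → T (lookup σ j) → T (lookup τ j)
  mono⁻ {σ} {τ} l j t = subst T (p1 τ j) (bit-mono l (g j) (subst T (sym (p1 σ j)) t))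

  emb-∪ : ∀ σ τ → emb (σ ∪ₛ τ) ≡ emb σ ∪ emb τ
  emb-∪ σ τ = ⊑-antisym (bits⊑ (λ v t → h v (p2 (σ ∪ₛ τ) v t) t))
    (∪-lub (mono (λ j t → subst T (sym (lookup-∪ σ τ j)) (∨-il t)))
           (mono (λ j t → subst T (sym (lookup-∪ σ τ j)) (∨-ir {lookup σ j} t))))
    where
    h : ∀ v → Σ (Fin m) (λ j → g j ≡ v) → T (bit (emb (σ ∪ₛ τ)) v) → T (bit (emb σ ∪ emb τ) v)
    h v (j , refl) t = [ (λ r → bit-mono (⊑∪l {x = emb σ} {emb τ}) (g j) (subst T (sym (p1 σ j)) r))
                       , (λ r → bit-mono (⊑∪r {x = emb σ}) (g j) (subst T (sym (p1 τ j)) r)) ]′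
                       (∨-split (subst T (trans (p1 (σ ∪ₛ τ) j) (lookup-∪ σ τ j)) t))

  sub-emb : ∀ {σ τ} → T (subB σ τ) → emb σ ⊑ emb τ
  sub-emb {σ} {τ} t = mono (subB→ σ τ t)

  emb-sub : ∀ {σ τ} → emb σ ⊑ emb τ → T (subB σ τ)
  emb-sub {σ} {τ} l = →subB σ τ (mono⁻ l)

Closed : ∀ {n} → Pred n → Set
Closed K = ∀ {x y} → x ⊑ y → T (K y) → T (K x)

record PLG {n} (d : ℕ) (K : Pred n) : Set where
  field
    m    : ℕ
    E    : Emb m n
  open Emb E public
  field
    im   : ∀ {x} → T (K x) → Σ (Subset m) λ σ → emb σ ≡ x
    vert : ∀ j → T (K (emb ⁅ j ⁆))
    pl   : PLEquiv (λ σ → K (emb σ)) (boundarySimplex d)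

-- Exchanges preserve the PL type.

-- K has a face A with link ∂C * L, and K′ arises by replacing A * ∂C * L with ∂A * C * L;
-- equivalently the stellar subdivisions of K at A and of K′ at C coincide.
record Ex {n} (K K′ : Pred n) (A C : Vec Q n) : Set where
  field
    e1  : ∀ {x} → T (K x) → ¬ (A ⊑ x) → T (K′ x) × ¬ (C ⊑ x)
    e1′ : ∀ {x} → T (K′ x) → ¬ (C ⊑ x) → T (K x) × ¬ (A ⊑ x)
    e2  : ∀ {x} → ¬ (A ⊑ x) → T (K (x ∪ A)) → ¬ (C ⊑ x) × T (K′ (x ∪ C))
    e2′ : ∀ {x} → ¬ (C ⊑ x) → T (K′ (x ∪ C)) → ¬ (A ⊑ x) × T (K (x ∪ A))
    kA  : T (K A)
    kC  : T (K′ C)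

ex-sym : ∀ {n} {K K′ : Pred n} {A C} → Ex K K′ A C → Ex K′ K C A
ex-sym e = record { e1 = e1′ ; e1′ = e1 ; e2 = e2′ ; e2′ = e2 ; kA = kC ; kC = kA }
  where open Ex e

iso-≗ : ∀ {m} {K L : RawComplex m} → (∀ σ → K σ ≡ L σ) → Iso K L
iso-≗ {L = L} p = mk↔ₛ′ id id (λ _ → refl) (λ _ → refl) ,
  λ σ → trans (p σ) (cong L (sym (Vecₚ.tabulate∘lookup σ)))

lookup→∈ : ∀ {m} (σ : Subset m) j → T (lookup σ j) → j ∈ σ
lookup→∈ σ j t = Vecₚ.lookup⇒[]= j σ (T→≡ t)

∈→lookup : ∀ {m} (σ : Subset m) j → j ∈ σ → T (lookup σ j)
∈→lookup σ j p = ≡→T (Vecₚ.[]=⇒lookup p)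

module _ {n d} {K : Pred n} (G : PLG d K) (cl : Closed K) where
  open PLG G

  is-complex : IsComplex (λ σ → K (emb σ))
  is-complex = (λ σ τ s k → T→≡ (cl (mono (λ j t → ∈→lookup σ j (s (lookup→∈ τ j t)))) (≡→T k))) , (λ v → T→≡ (vert v))

module _ {n d} {K K′ : Pred n} (G : PLG d K) (cl : Closed K) (cl′ : Closed K′) {A C} (e : Ex K K′ A C) (rA : 2 ≤ card A) where
  open PLG G
  open Ex e
  private
    small : ∀ {B : Vec Q n} → 2 ≤ card B → ∀ {x : Vec Q n} → card x ≤ 1 → ¬ (B ⊑ x)
    small r s l = ℕₚ.<-irrefl refl (≤-trans r (≤-trans (card-mono l) s))

    vcard : ∀ j → card (emb ⁅ j ⁆) ≤ 1
    vcard j = ≤-reflexive (trans (size ⁅ j ⁆) (Subₚ.∣⁅x⁆∣≡1 j))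

  -- With two vertices in both `A` and `C` the exchange neither creates nor removes a vertex, so one
  -- embedding serves both complexes, and their stellar subdivisions agree face by face.
  plg-flip : 2 ≤ card C → PLG d K′
  plg-flip rC = record { m = m ; E = E ; im = im′ ; vert = vert′ ; pl = pl′ }
    where
    im′ : ∀ {x} → T (K′ x) → Σ (Subset m) λ σ → emb σ ≡ x
    im′ {x} k with T? (sub C x)
    ... | inj₂ q = im (proj₁ (e1′ k (λ l → q (→sub l))))
    -- A face that contains `C` is the union of a vertex of `C` and a face that does not contain
    -- `C`. The vertex alone does not contain `C` either, so both parts are already faces of `K`.
    ... | inj₁ l with drop1 {x = x} (≤-trans (s≤s z≤n) rC) (sub→ l)
    ... | c , x₁ , refl , f with im (proj₁ (e1′ (cl′ (⊑∪l {x = x₁}) k) f))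
                               | im (proj₁ (e1′ (cl′ (⊑∪r {x = x₁}) k) (small rC (≤-reflexive (single-card c)))))
    ... | σ , p | τ , q = σ ∪ₛ τ , trans (emb-∪ σ τ) (cong₂ _∪_ p q)
    vert′ : ∀ j → T (K′ (emb ⁅ j ⁆))
    vert′ j = proj₁ (e1 (vert j) (small rA (vcard j)))
    cx′ : IsComplex (λ σ → K′ (emb σ))
    cx′ = (λ σ τ s k → T→≡ (cl′ (mono (λ j t → ∈→lookup σ j (s (lookup→∈ τ j t)))) (≡→T k))) , (λ v → T→≡ (vert′ v))
    pl′ : PLEquiv (λ σ → K′ (emb σ)) (boundarySimplex d)
    pl′ with im kA | im′ kC
    ... | α , refl | γ , refl = PLEquiv.trans (PLEquiv.subdiv _ γ cx′ (T→≡ kC) (subst (2 ≤_) (size γ) rC))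
        (PLEquiv.trans (PLEquiv.iso (iso-≗ eq)) (PLEquiv.trans (PLEquiv.symm (PLEquiv.subdiv _ α (is-complex G cl) (T→≡ kA) (subst (2 ≤_) (size α) rA))) pl))
      where
      eq : ∀ σ → stellar (λ σ → K′ (emb σ)) γ σ ≡ stellar (λ σ → K (emb σ)) α σ
      eq (false ∷ τ) = T-≡
        (λ t → let r = e1′ (∧-r {not (subB γ τ)} t) (λ l → ¬-e (∧-l t) (emb-sub l)) in
               ∧-i (¬-i (λ s → proj₂ r (sub-emb s))) (proj₁ r))
        (λ t → let r = e1 (∧-r {not (subB α τ)} t) (λ l → ¬-e (∧-l t) (emb-sub l)) in
               ∧-i (¬-i (λ s → proj₂ r (sub-emb s))) (proj₁ r))
      eq (true ∷ τ) = T-≡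
        (λ t → let r = e2′ (λ l → ¬-e (∧-l t) (emb-sub l)) (subst (T ∘ K′) (emb-∪ τ γ) (∧-r {not (subB γ τ)} t)) in
               ∧-i (¬-i (λ s → proj₁ r (sub-emb s))) (subst (T ∘ K) (sym (emb-∪ τ α)) (proj₂ r)))
        (λ t → let r = e2 (λ l → ¬-e (∧-l t) (emb-sub l)) (subst (T ∘ K) (emb-∪ τ α) (∧-r {not (subB α τ)} t)) in
               ∧-i (¬-i (λ s → proj₁ r (sub-emb s))) (subst (T ∘ K′) (sym (emb-∪ τ γ)) (proj₂ r)))

  -- When `C` is a vertex that `K` lacks, `K′` itself is the stellar subdivision of `K` at `A`, with
  -- `C` as its new vertex.
  plg-new : ∀ v → C ≡ single v → (∀ {x} → T (K x) → ¬ T (bit x v)) → PLG d K′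
  plg-new v refl ghost = record { m = suc m ; E = E′ ; im = im′ ; vert = vert′ ; pl = pl′ }
    where
    v∉ : ∀ j → g j ≢ v
    v∉ j q = ghost (vert j) (subst (T ∘ bit (emb ⁅ j ⁆)) q (subst T (sym (p1 ⁅ j ⁆ j)) (∈→lookup ⁅ j ⁆ j (Subₚ.x∈⁅x⁆ j))))
    v∉e : ∀ σ → ¬ T (bit (emb σ) v)
    v∉e σ t = v∉ (proj₁ (p2 σ v t)) (proj₂ (p2 σ v t))
    nC : ∀ σ → ¬ (single v ⊑ emb σ)
    nC σ l = v∉e σ (⊑single l)
    emb′ : Subset (suc m) → Vec Q n
    emb′ (false ∷ σ) = emb σ
    emb′ (true ∷ σ) = emb σ ∪ single v
    g′ : Fin (suc m) → Vertex n
    g′ zero = v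
    g′ (suc j) = g j
    p1′ : ∀ σ j → bit (emb′ σ) (g′ j) ≡ lookup σ j
    p1′ (false ∷ σ) zero = ¬T→≡ (v∉e σ)
    p1′ (true ∷ σ) zero = T→≡ (bit-mono (⊑∪r {x = emb σ}) v (bit-single v))
    p1′ (false ∷ σ) (suc j) = p1 σ j
    p1′ (true ∷ σ) (suc j) = trans (T-≡ (λ t → [ id , (λ r → ⊥-elim (v∉ j (bit-single⁻ v (g j) r))) ]′ (bit-∪ (emb σ) (single v) (g j) t))
                                        (bit-mono (⊑∪l {x = emb σ} {single v}) (g j))) (p1 σ j)
    p2′ : ∀ σ w → T (bit (emb′ σ) w) → Σ (Fin (suc m)) λ j → g′ j ≡ w
    p2′ (false ∷ σ) w t = suc (proj₁ (p2 σ w t)) , proj₂ (p2 σ w t)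
    p2′ (true ∷ σ) w t = [ (λ r → suc (proj₁ (p2 σ w r)) , proj₂ (p2 σ w r)) , (λ r → zero , sym (bit-single⁻ v w r)) ]′
                         (bit-∪ (emb σ) (single v) w t)
    size′ : ∀ σ → card (emb′ σ) ≡ ∣ σ ∣
    size′ (false ∷ σ) = size σ
    size′ (true ∷ σ) = trans (card-∪ {x = emb σ} (⊥single v (v∉e σ)))
      (trans (cong₂ _+_ (size σ) (single-card v)) (ℕₚ.+-comm ∣ σ ∣ 1))
    E′ : Emb (suc m) n
    E′ = record { emb = emb′ ; g = g′ ; p1 = p1′ ; p2 = p2′ ; size = size′ }
    im′ : ∀ {x} → T (K′ x) → Σ (Subset (suc m)) λ σ → emb′ σ ≡ x
    im′ {x} k with T? (bit x v)
    ... | inj₂ q = let r = im (proj₁ (e1′ k (λ l → q (⊑single l)))) in false ∷ proj₁ r , proj₂ r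
    ... | inj₁ l with drop1 (≤-reflexive (sym (single-card v))) (single⊑ {x = x} l)
    ... | c , x₁ , refl , f with bit-∪ x₁ (single c) v l
    ... | inj₁ r = ⊥-elim (f (single⊑ r))
    ... | inj₂ r with bit-single⁻ c v r
    ... | refl with im (cl (⊑∪l {x = x₁}) (proj₂ (e2′ f k)))
    ... | σ , p = true ∷ σ , cong (_∪ single v) p
    vert′ : ∀ j → T (K′ (emb′ ⁅ j ⁆))
    vert′ zero = cl′ (∪-lub (bits⊑ (λ w t → ⊥-elim (nil w (p2 _ w t) t))) ⊑-refl) kC
      where
      nil : ∀ w → Σ (Fin m) (λ j → g j ≡ w) → T (bit (emb _) w) → ⊥
      nil w (j , refl) t = subst T (trans (p1 _ j) (Vecₚ.lookup-replicate j outside)) t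
    vert′ (suc j) = proj₁ (e1 (vert j) (small rA (vcard j)))
    pl′ : PLEquiv (λ σ → K′ (emb′ σ)) (boundarySimplex d)
    pl′ with im kA
    ... | α , refl = PLEquiv.trans (PLEquiv.iso (iso-≗ eq))
        (PLEquiv.trans (PLEquiv.symm (PLEquiv.subdiv _ α (is-complex G cl) (T→≡ kA) (subst (2 ≤_) (size α) rA))) pl)
      where
      eq : ∀ σ → K′ (emb′ σ) ≡ stellar (λ σ → K (emb σ)) α σ
      eq (false ∷ τ) = T-≡
        (λ t → let r = e1′ t (nC τ) in ∧-i (¬-i (λ s → proj₂ r (sub-emb s))) (proj₁ r))
        (λ t → proj₁ (e1 (∧-r {not (subB α τ)} t) (λ l → ¬-e (∧-l t) (emb-sub l))))
      eq (true ∷ τ) = T-≡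
        (λ t → let r = e2′ (nC τ) t in ∧-i (¬-i (λ s → proj₁ r (sub-emb s))) (subst (T ∘ K) (sym (emb-∪ τ α)) (proj₂ r)))
        (λ t → proj₂ (e2 (λ l → ¬-e (∧-l t) (emb-sub l)) (subst (T ∘ K) (emb-∪ τ α) (∧-r {not (subB α τ)} t))))

-- Coning over the boundary of a ball.

-- The new vertex v, at the head, is coned over the boundary of the ball of s, and -v over minus the boundary of the ball of t.
cone : ∀ {n} → Pred n → St n → St n → Pred (suc n)
cone D s t (O ∷ x) = D x ∧ (not (I s 0 x) ∧ not (I t 0 (neg' x)))
cone D s t (P ∷ x) = B s 0 x ∧ not (I s 0 x)
cone D s t (M ∷ x) = B t 0 (neg' x) ∧ not (I t 0 (neg' x))
cone D s t (X ∷ x) = false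

Opp : ∀ {n} → St n → St n → Set
Opp s t = ∀ x → T (B s 0 x) → T (I t 0 (neg' x)) → ⊥

module _ {n} {D : Pred n} {N J : Fam n} (am : Amb (Both D) N J) (D-sym : ∀ {x} → T (D x) → T (D (neg' x))) where
  private module Am = Amb am

  cone-cl : ∀ {s t} → Good (Both D) N J s → Good (Both D) N J t → Opp s t → Opp t s → Closed (cone D s t)
  cone-cl {s} {t} gs gt o₁ o₂ = cl
    where
    module S = Good gs
    module R = Good gt
    cl : Closed (cone D s t)
    cl (O≤ {O} ∷ l) p = let r = ∧-r {D _} p in ∧-i (Am.D-cl true l (∧-l p))
      (∧-i (¬-i (λ i → ¬-e (∧-l r) (S.I-op 0 l (∧-l p) i)))
           (¬-i (λ i → ¬-e (∧-r {not (I s 0 _)} r) (R.I-op 0 (neg-mono l) (D-sym (∧-l p)) i))))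
    cl (O≤ {P} ∷ l) p = let d = Am.N⊂D 0 (S.B⊂N 0 (∧-l p)) in ∧-i (Am.D-cl true l d)
      (∧-i (¬-i (λ i → ¬-e (∧-r {B s 0 _} p) (S.I-op 0 l d i)))
           (¬-i (λ i → o₁ _ (∧-l p) (R.I-op 0 (neg-mono l) (D-sym d) i))))
    cl {y = M ∷ y} (O≤ ∷ l) p = ∧-i (Am.D-cl true l d′)
      (∧-i (¬-i (λ i → o₂ _ (∧-l p) (subst (T ∘ I s 0) (sym (neg-inv y)) (S.I-op 0 l d′ i))))
           (¬-i (λ i → ¬-e (∧-r {B t 0 _} p) (R.I-op 0 (neg-mono l) d i))))
      where
      d = Am.N⊂D 0 (R.B⊂N 0 (∧-l p))
      d′ = subst (T ∘ D) (neg-inv y) (D-sym d)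
    cl (PP ∷ l) p = ∧-i (S.B-cl 0 l (∧-l p)) (¬-i (λ i → ¬-e (∧-r {B s 0 _} p)
      (S.I-op 0 l (Am.N⊂D 0 (S.B⊂N 0 (∧-l p))) i)))
    cl (MM ∷ l) p = ∧-i (R.B-cl 0 (neg-mono l) (∧-l p)) (¬-i (λ i → ¬-e (∧-r {B t 0 _} p)
      (R.I-op 0 (neg-mono l) (Am.N⊂D 0 (R.B⊂N 0 (∧-l p))) i)))

  -- Write L for the link of `A ∪ C`. Before the growth `A` lies on the boundary of the ball:
  -- outside it stands C * L, and the new vertex v sees ∂C * L, so the link of `A` is the boundary
  -- of {v} ∪ C joined with L. Afterwards {v} ∪ C is a face with link ∂A * L.
  cone-ex : ∀ {s s′ t A C} → Good (Both D) N J s → Good (Both D) N J s′ → Good (Both D) N J t →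
            Opp s′ t → Opp t s′ → El (Both D) s s′ 0 A C → 1 ≤ card A →
            Ex (cone D s t) (cone D s′ t) (O ∷ A) (P ∷ C)
  cone-ex {s} {s′} {t} {A} {C} gs gs′ gt d₁ d₂ l rA =
    record { e1 = λ { {v ∷ x} → f1 v x } ; e1′ = λ { {v ∷ x} → f1′ v x }
           ; e2 = λ { {v ∷ x} → f2 v x } ; e2′ = λ { {v ∷ x} → f2′ v x } ; kA = ka ; kC = kc }
    where
    module S = Good gs
    module S′ = Good gs′
    module R = Good gt
    open Add (El.add l)
    ka : T (cone D s t (O ∷ A))
    ka = ∧-i (Am.D-cl true ⊑∪l dAC) (∧-i (¬-i (λ i → a1 ⊑∪r (S.I⊂B 0 (S.I-op 0 ⊑∪l dAC i))))
           (¬-i (d₁ _ (S′.I⊂B 0 (I'A ⊑-refl (Am.D-cl true ⊑∪l dAC))))))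
    kc : T (cone D s′ t (P ∷ C))
    kc = ∧-i (B'C ⊑-refl (subst (T ∘ D) (∪-comm A C) dAC))
             (¬-i (λ i → [ (λ k → a1 ⊑-refl (S.I⊂B 0 k)) , (λ a → ℕₚ.n≮n 0 (≤-trans rA (≤-reflexive (⊥v-¬⊑ dis a)))) ]′ (I'→ i)))
    B→D : ∀ {x} → T (B s 0 x) → T (D x)
    B→D b = Am.N⊂D 0 (S.B⊂N 0 b)
    -- an interior face of s′ does not lie in the closed ball opposite to t
    far : ∀ {x} → A ⊑ x → T (B t 0 (neg' x)) → ⊥
    far {x} a b = d₂ (neg' x) b (subst (T ∘ I s′ 0) (sym (neg-inv x))
      (I'A a (subst (T ∘ D) (neg-inv x) (D-sym (Am.N⊂D 0 (R.B⊂N 0 b))))))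
    f1 : ∀ v x → T (cone D s t (v ∷ x)) → ¬ ((O ∷ A) ⊑ (v ∷ x)) → T (cone D s′ t (v ∷ x)) × ¬ ((P ∷ C) ⊑ (v ∷ x))
    f1 O x p na = ∧-i {D x} (∧-l p) (∧-i (¬-i (λ i → [ ¬-e (∧-l (∧-r {D x} p)) , (λ a → na (O≤ ∷ a)) ]′ (I'→ i)))
                                   (∧-r {not (I s 0 x)} (∧-r {D x} p))) , (λ { (() ∷ _) })
    f1 P x p na = ∧-i (B≤ (∧-l p)) (¬-i (λ i → [ ¬-e (∧-r {B s 0 x} p) , (λ a → na (O≤ ∷ a)) ]′ (I'→ i)))
                , (λ { (_ ∷ c) → a1 c (∧-l p) })
    f1 M x p na = p , (λ { (() ∷ _) })
    f1′ : ∀ v x → T (cone D s′ t (v ∷ x)) → ¬ ((P ∷ C) ⊑ (v ∷ x)) → T (cone D s t (v ∷ x)) × ¬ ((O ∷ A) ⊑ (v ∷ x))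
    f1′ O x p nc = ∧-i {D x} (∧-l p) (∧-i (¬-i (λ i → ¬-e (∧-l (∧-r {D x} p)) (I≤ i))) (∧-r {not (I s′ 0 x)} (∧-r {D x} p)))
                 , (λ { (_ ∷ a) → ¬-e (∧-l (∧-r {D x} p)) (I'A a (∧-l p)) })
    f1′ P x p nc with B'→ (∧-l p)
    ... | inj₂ (c , _) = ⊥-elim (nc (PP ∷ c))
    ... | inj₁ b = ∧-i b (¬-i (λ i → ¬-e (∧-r {B s′ 0 x} p) (I≤ i)))
                 , (λ { (_ ∷ a) → ¬-e (∧-r {B s′ 0 x} p) (I'A a (B→D b)) })
    f1′ M x p nc = p , (λ { (_ ∷ a) → far a (∧-l p) })
    to : ∀ {x} → ¬ (A ⊑ x) → T (D (x ∪ A)) → ¬ T (I s 0 (x ∪ A)) → T (B s′ 0 (x ∪ C) ∧ not (I s′ 0 (x ∪ C)))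
    to {x} na d ni = ∧-i (B'C ⊑∪r (Am.D-cl true (∪-lub (∪-lub (⊑-trans ⊑∪l ⊑∪l) ⊑∪r) (⊑-trans (⊑∪r {x = x}) ⊑∪l)) (proj₁ (a2 ⊑∪r d ni))))
      (¬-i (λ i → [ (λ k → a1 ⊑∪r (S.I⊂B 0 k)) , (λ a → na (⊥v-drop dis a)) ]′ (I'→ i)))
    from : ∀ {x} → T (B s′ 0 (x ∪ C)) → ¬ T (I s′ 0 (x ∪ C)) → ¬ (A ⊑ x) × T (D (x ∪ A)) × ¬ T (I s 0 (x ∪ A))
    from {x} b ni with B'→ b
    ... | inj₁ k = ⊥-elim (a1 ⊑∪r k)
    ... | inj₂ (_ , d) = (λ a → ni (I'A (⊑-trans a ⊑∪l) (Am.D-cl true ⊑∪l d)))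
                       , Am.D-cl true (∪-mono ⊑∪l ⊑-refl) d
                       , (λ i → a1 (⊑-trans (⊑∪r {x = x}) ⊑∪l) (S.I⊂B 0 (S.I-op 0 (∪-mono ⊑∪l ⊑-refl) d i)))
    f2 : ∀ v x → ¬ ((O ∷ A) ⊑ (v ∷ x)) → T (cone D s t ((v ∷ x) ∪ (O ∷ A))) →
         ¬ ((P ∷ C) ⊑ (v ∷ x)) × T (cone D s′ t ((v ∷ x) ∪ (P ∷ C)))
    f2 O x na p = (λ { (() ∷ _) }) , to (λ a → na (O≤ ∷ a)) (∧-l p) (¬-e (∧-l (∧-r {D (x ∪ A)} p)))
    f2 P x na p = (λ { (_ ∷ c) → a1 (⊑-trans c ⊑∪l) (∧-l p) })
                , to (λ a → na (O≤ ∷ a)) (B→D (∧-l p)) (¬-e (∧-r {B s 0 (x ∪ A)} p))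
    f2 M x na p = ⊥-elim (far ⊑∪r (∧-l p))
    f2′ : ∀ v x → ¬ ((P ∷ C) ⊑ (v ∷ x)) → T (cone D s′ t ((v ∷ x) ∪ (P ∷ C))) →
          ¬ ((O ∷ A) ⊑ (v ∷ x)) × T (cone D s t ((v ∷ x) ∪ (O ∷ A)))
    f2′ O x nc p with from (∧-l p) (¬-e (∧-r {B s′ 0 (x ∪ C)} p))
    ... | na , d , ni = (λ { (_ ∷ a) → na a })
                      , ∧-i d (∧-i (¬-i ni) (¬-i (d₁ _ (S′.I⊂B 0 (I'A ⊑∪r d)))))
    f2′ P x nc p with from (∧-l p) (¬-e (∧-r {B s′ 0 (x ∪ C)} p))
    ... | na , d , ni = (λ { (_ ∷ a) → na a })
                      , ∧-i ([ (λ c → ⊥-elim (nc (PP ∷ ⊥v-drop (⊥v-sym dis) c))) , id ]′ (proj₂ (a2 ⊑∪r d ni))) (¬-i ni)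

neg-bit : ∀ {n} (x : Vec Q n) v → bit (neg' x) v ≡ bit x (proj₁ v , not (proj₂ v))
neg-bit (O ∷ x) (zero , true) = refl
neg-bit (O ∷ x) (zero , false) = refl
neg-bit (P ∷ x) (zero , true) = refl
neg-bit (P ∷ x) (zero , false) = refl
neg-bit (M ∷ x) (zero , true) = refl
neg-bit (M ∷ x) (zero , false) = refl
neg-bit (X ∷ x) (zero , true) = refl
neg-bit (X ∷ x) (zero , false) = refl
neg-bit (a ∷ x) (suc i , s) = neg-bit x (i , s)

not-inv : ∀ b → not (not b) ≡ b
not-inv true = refl
not-inv false = refl

plg-neg : ∀ {n d} {K K′ : Pred n} → (∀ x → K′ (neg' x) ≡ K x) → PLG d K → PLG d K′
plg-neg {n} {K = K} {K′} q G = record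
  { m = m
  ; E = record { emb = neg' ∘ emb ; g = λ j → proj₁ (g j) , not (proj₂ (g j))
               ; p1 = λ σ j → trans (neg-bit (emb σ) _) (trans (cong (λ b → bit (emb σ) (proj₁ (g j) , b)) (not-inv _)) (p1 σ j))
               ; p2 = λ σ v t → let r = p2 σ _ (subst T (neg-bit (emb σ) v) t) in
                    proj₁ r , trans (cong (λ w → proj₁ w , not (proj₂ w)) (proj₂ r)) (cong (proj₁ v ,_) (not-inv _))
               ; size = λ σ → trans (card-neg (emb σ)) (size σ) }
  ; im = λ {x} k → let r = im (subst T (trans (cong K′ (sym (neg-inv x))) (q (neg' x))) k) in
      proj₁ r , trans (cong neg' (proj₂ r)) (neg-inv x)
  ; vert = λ j → subst T (sym (q (emb ⁅ j ⁆))) (vert j)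
  ; pl = PLEquiv.trans (PLEquiv.iso (iso-≗ (λ σ → q (emb σ)))) pl }
  where open PLG G

plg-≗ : ∀ {n d} {K K′ : Pred n} → (∀ x → K′ x ≡ K x) → PLG d K → PLG d K′
plg-≗ {K = K} q G = record { m = m ; E = E ; im = λ k → im (subst T (q _) k) ; vert = λ j → subst T (sym (q _)) (vert j)
                   ; pl = PLEquiv.trans (PLEquiv.iso (iso-≗ (λ σ → q (emb σ)))) pl }
  where open PLG G

plg-shift : ∀ {n d} {K : Pred n} {K′ : Pred (suc n)} → (∀ x → K′ (O ∷ x) ≡ K x) → (∀ {v x} → T (K′ (v ∷ x)) → v ≡ O) →
            PLG d K → PLG d K′
plg-shift {K = K} {K′} q h G = record
  { m = m
  ; E = record { emb = λ σ → O ∷ emb σ ; g = upV ∘ g ; p1 = p1 ; p2 = p2′ ; size = size }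
  ; im = im′
  ; vert = λ j → subst T (sym (q _)) (vert j)
  ; pl = PLEquiv.trans (PLEquiv.iso (iso-≗ (λ σ → q (emb σ)))) pl }
  where
  open PLG G
  p2′ : ∀ σ v → T (bit (O ∷ emb σ) v) → Σ (Fin m) λ j → upV (g j) ≡ v
  p2′ σ (zero , true) ()
  p2′ σ (zero , false) ()
  p2′ σ (suc i , s) t = let r = p2 σ (i , s) t in proj₁ r , cong upV (proj₂ r)
  im′ : ∀ {x} → T (K′ x) → Σ (Subset m) λ σ → O ∷ emb σ ≡ x
  im′ {v ∷ x} k with h k
  ... | refl = let r = im (subst T (q x) k) in proj₁ r , cong (O ∷_) (proj₂ r)

card0 : ∀ {n} (x : Vec Q n) → card x ≡ 0 → x ≡ ∅
card0 [] _ = refl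
card0 (O ∷ x) p = cong (O ∷_) (card0 x p)

module _ {n} {D : Pred n} {N J : Fam n} (am : Amb (Both D) N J) (D-sym : ∀ {x} → T (D x) → T (D (neg' x))) {d : ℕ} where
  private
    OU = OkU (Both D) N J

    opp : ∀ {s t : St n} → Disj00 t → Near s t → Opp s t × Opp t s
    opp dt nr = (λ x b i → dt x (Near.B≤ nr 0 b) i) , (λ x b i → dt x b (Near.I≤ nr 0 i))

    swap : ∀ {s t} x → cone D s t (neg' x) ≡ cone D t s x
    swap {s} {t} (O ∷ x) = trans (cong₂ _∧_ (T-≡ (λ r → subst (T ∘ D) (neg-inv x) (D-sym r)) D-sym) refl)
      (trans (cong (λ y → D x ∧ (not (I s 0 (neg' x)) ∧ not (I t 0 y))) (neg-inv x)) (cong (D x ∧_) (∧c (not (I s 0 (neg' x))) (not (I t 0 x)))))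
      where
      ∧c : ∀ a b → a ∧ b ≡ b ∧ a
      ∧c true true = refl
      ∧c true false = refl
      ∧c false true = refl
      ∧c false false = refl
    swap {s} {t} (P ∷ x) = cong (λ y → B t 0 y ∧ not (I t 0 y)) (neg-inv x)
    swap {s} {t} (M ∷ x) = refl
    swap {s} {t} (X ∷ x) = refl

    ghost : ∀ {s s′ t A} → El (Both D) s s′ 0 A ∅ → ∀ {x} → T (cone D s t x) → ¬ T (bit x (zero , true))
    ghost l {P ∷ x} k b = Add.a1 (El.add l) ∅⊑ (∧-l k)

    grow₁ : ∀ {s s′ t A C} → Good (Both D) N J s → Good (Both D) N J s′ → Good (Both D) N J t → Opp s t → Opp t s →
            Opp s′ t → Opp t s′ → El (Both D) s s′ 0 A C → 2 ≤ card A → PLG d (cone D s t) → PLG d (cone D s′ t)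
    grow₁ {s} {s′} {t} {A} {C} gs gs′ gt o₁ o₂ o₃ o₄ l r G with card C in q
    ... | suc k = plg-flip G (cone-cl am D-sym gs gt o₁ o₂) (cone-cl am D-sym gs′ gt o₃ o₄)
                    (cone-ex am D-sym gs gs′ gt o₃ o₄ l (≤-trans (s≤s z≤n) r)) r (s≤s (subst (1 ≤_) (sym q) (s≤s z≤n)))
    ... | zero with card0 C q
    ... | refl = plg-new G (cone-cl am D-sym gs gt o₁ o₂) (cone-cl am D-sym gs′ gt o₃ o₄)
                    (cone-ex am D-sym gs gs′ gt o₃ o₄ l (≤-trans (s≤s z≤n) r)) r (zero , true) refl (λ {x} → ghost {s} {s′} {t} l {x})

    shrink₁ : ∀ {s s′ t A C} → Good (Both D) N J s → Good (Both D) N J s′ → Good (Both D) N J t → Opp s t → Opp t s →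
            Opp s′ t → Opp t s′ → El (Both D) s s′ 0 A C → 2 ≤ card A → 1 ≤ card C → PLG d (cone D s′ t) → PLG d (cone D s t)
    shrink₁ gs gs′ gt o₁ o₂ o₃ o₄ l r c G =
      plg-flip G (cone-cl am D-sym gs′ gt o₃ o₄) (cone-cl am D-sym gs gt o₁ o₂)
        (ex-sym (cone-ex am D-sym gs gs′ gt o₃ o₄ l (≤-trans (s≤s z≤n) r))) (s≤s c) r

    cone-≗ : ∀ {s t} → s ≈S t → ∀ x → cone D t t x ≡ cone D s s x
    cone-≗ p (O ∷ x) = cong₂ (λ a b → D x ∧ (not a ∧ not b)) (sym (_≈S_.≈I p 0 x)) (sym (_≈S_.≈I p 0 (neg' x)))
    cone-≗ p (P ∷ x) = cong₂ (λ a b → a ∧ not b) (sym (_≈S_.≈B p 0 x)) (sym (_≈S_.≈I p 0 x))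
    cone-≗ p (M ∷ x) = cong₂ (λ a b → a ∧ not b) (sym (_≈S_.≈B p 0 (neg' x))) (sym (_≈S_.≈I p 0 (neg' x)))
    cone-≗ p (X ∷ x) = refl

    skip : ∀ {s t e A C} → El (Both D) s t (suc e) A C → ∀ x → cone D t t x ≡ cone D s s x
    skip l (O ∷ x) = cong₂ (λ a b → D x ∧ (not a ∧ not b)) (sym (El.oI l 0 (λ ()) x)) (sym (El.oI l 0 (λ ()) (neg' x)))
    skip l (P ∷ x) = cong₂ (λ a b → a ∧ not b) (sym (El.oB l 0 (λ ()) x)) (sym (El.oI l 0 (λ ()) x))
    skip l (M ∷ x) = cong₂ (λ a b → a ∧ not b) (sym (El.oB l 0 (λ ()) (neg' x))) (sym (El.oI l 0 (λ ()) (neg' x)))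
    skip l (X ∷ x) = refl

  -- The balls at v and -v change one after the other; in between, the cone is taken over two
  -- different states, and `swap` reduces the second change to the first by reflection. Nearness
  -- keeps each ball away from the opposite interior in that mixed stage.
  path-plg : ∀ {s t} → OU s → Path (Both D) OU 2 s t → PLG d (cone D s s) → PLG d (cone D t t)
  path-plg os done G = G
  path-plg os (same p oy w) G = path-plg oy w (plg-≗ (cone-≗ p) G)
  path-plg os (grow {e = suc e} oy l r w) G = path-plg oy w (plg-≗ (skip l) G)
  path-plg os (shrink {e = suc e} oy l r c w) G = path-plg oy w (plg-≗ (λ x → sym (skip l x)) G)
  path-plg {s} os (grow {y = y} {e = zero} oy l r w) G = path-plg oy w
    (grow₁ (proj₁ os) (proj₁ oy) (proj₁ oy) (proj₁ o) (proj₂ o) (proj₂ oy) (proj₂ oy) l r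
      (plg-neg (swap {s} {y}) (grow₁ (proj₁ os) (proj₁ oy) (proj₁ os) (proj₂ os) (proj₂ os) (proj₂ o) (proj₁ o) l r G)))
    where o = opp {s} {y} (proj₂ oy) (el-near (proj₁ os) (proj₁ oy) l)
  path-plg {s} os (shrink {y = y} {e = zero} oy l r c w) G = path-plg oy w
    (shrink₁ (proj₁ oy) (proj₁ os) (proj₁ oy) (proj₂ oy) (proj₂ oy) (proj₂ o) (proj₁ o) l r c
      (plg-neg (swap {s} {y}) (shrink₁ (proj₁ oy) (proj₁ os) (proj₁ os) (proj₁ o) (proj₂ o) (proj₂ os) (proj₂ os) l r c G)))
    where o = opp {y} {s} (proj₂ os) (el-near (proj₁ oy) (proj₁ os) l)

  new-pair : OU emptyS → ∀ {s} → Path (Both D) OU 2 emptyS s → PLG d D → PLG d (cone D s s)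
  new-pair o w G = path-plg o w (plg-shift (λ x → T-≡ ∧-l (λ t → ∧-i t tt)) h G)
    where
    h : ∀ {v x} → T (cone D emptyS emptyS (v ∷ x)) → v ≡ O
    h {O} _ = refl

-- Open families in the boundary of a suspended ball.

selI-view : ∀ p v {a b} → T (selI p v a b) → (v ≡ sgn p × T a) ⊎ (v ≢ sgn p × T b)
selI-view true O t = inj₂ ((λ ()) , t)
selI-view false O t = inj₂ ((λ ()) , t)
selI-view true P t = inj₁ (refl , t)
selI-view true M t = inj₂ ((λ ()) , t)
selI-view false P t = inj₂ ((λ ()) , t)
selI-view false M t = inj₁ (refl , t)
selI-view _ X ()

selI-same : ∀ p {v a b} → v ≡ sgn p → T a → T (selI p v a b)
selI-same true refl t = t
selI-same false refl t = t

selI-other : ∀ p {v a b} → T (okq v) → v ≢ sgn p → T b → T (selI p v a b)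
selI-other _ {O} k q t = t
selI-other true {P} k q t = ⊥-elim (q refl)
selI-other true {M} k q t = t
selI-other false {P} k q t = t
selI-other false {M} k q t = ⊥-elim (q refl)

selI-not : ∀ p v {a b} → T (okq v) → ¬ T (selI p v a b) → (v ≡ sgn p × ¬ T a) ⊎ (v ≢ sgn p × ¬ T b)
selI-not true O k f = inj₂ ((λ ()) , f)
selI-not false O k f = inj₂ ((λ ()) , f)
selI-not true P k f = inj₁ (refl , f)
selI-not true M k f = inj₂ ((λ ()) , f)
selI-not false P k f = inj₂ ((λ ()) , f)
selI-not false M k f = inj₁ (refl , f)

selB-view : ∀ p v {a b} → T (selB p v a b) → (v ≢ sgn (not p) × T a) ⊎ (v ≡ sgn (not p) × T b)
selB-view true O t = inj₁ ((λ ()) , t)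
selB-view false O t = inj₁ ((λ ()) , t)
selB-view true P t = inj₁ ((λ ()) , t)
selB-view true M t = inj₂ (refl , t)
selB-view false P t = inj₂ (refl , t)
selB-view false M t = inj₁ ((λ ()) , t)
selB-view _ X ()

selB-neg : ∀ p v a b → selB (not p) v a b ≡ selB p (negq v) a b
selB-neg p O a b = refl
selB-neg true P a b = refl
selB-neg true M a b = refl
selB-neg true X a b = refl
selB-neg false P a b = refl
selB-neg false M a b = refl
selB-neg false X a b = refl

selI-neg : ∀ p v a b → selI (not p) v a b ≡ selI p (negq v) a b
selI-neg p O a b = refl
selI-neg true P a b = refl
selI-neg true M a b = refl
selI-neg true X a b = refl
selI-neg false P a b = refl
selI-neg false M a b = refl
selI-neg false X a b = refl

sgn-dec : ∀ p v → T (okq v) → (v ≡ sgn p) ⊎ (v ≢ sgn p)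
sgn-dec true O _ = inj₂ (λ ())
sgn-dec false O _ = inj₂ (λ ())
sgn-dec true P _ = inj₁ refl
sgn-dec false P _ = inj₂ (λ ())
sgn-dec true M _ = inj₂ (λ ())
sgn-dec false M _ = inj₁ refl

selBI-not : ∀ p v {a b c d} → (T a → ¬ T c) → (T b → ¬ T d) → (T d → T c) → T (selB p v a b) → ¬ T (selI p v c d)
selBI-not _ O f g h t u = f t (h u)
selBI-not true P f g h t u = f t u
selBI-not true M f g h t u = g t u
selBI-not false P f g h t u = g t u
selBI-not false M f g h t u = f t u

sgn-inj : ∀ {p q} → sgn p ≡ sgn q → p ≡ q
sgn-inj {true} {true} _ = refl
sgn-inj {false} {false} _ = refl
sgn-inj {true} {false} ()
sgn-inj {false} {true} ()

negq-sgn : ∀ p → negq (sgn p) ≡ sgn (not p)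
negq-sgn true = refl
negq-sgn false = refl

par-≢ : ∀ {p q} → q ≤ p → par p ≢ par q → q < p
par-≢ l n = ℕₚ.≤∧≢⇒< l (λ { refl → n refl })

b≢not : ∀ b → b ≢ not b
b≢not true ()
b≢not false ()

par-≡ : ∀ {p q} → q < p → par p ≡ par q → suc q < p
par-≡ {q = q} l e = ℕₚ.≤∧≢⇒< l (λ { refl → b≢not (par q) (sym e) })

¬≢not : ∀ {a b} → a ≢ not b → a ≡ b
¬≢not {true} {true} _ = refl
¬≢not {false} {false} _ = refl
¬≢not {true} {false} f = ⊥-elim (f refl)
¬≢not {false} {true} f = ⊥-elim (f refl)

dec* : ∀ {n} {F : Fam n} → (∀ e {x} → T (F (suc e) x) → T (F e x)) → ∀ {d e} → d ≤ e → ∀ {x} → T (F e x) → T (F d x)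
dec* {F = F} f {d} {e} l {x} t = go _ (ℕₚ.m+[n∸m]≡n l) t
  where
  go : ∀ k {e} → d + k ≡ e → T (F e x) → T (F d x)
  go zero refl t = subst (λ j → T (F j x)) (ℕₚ.+-identityʳ d) t
  go (suc k) refl t = go k refl (f (d + k) (subst (λ j → T (F j x)) (ℕₚ.+-suc d k) t))

-- How a family Z (bounding the balls of the next complex) sits in the boundaries of the balls of s.
record Dyn {n} (s : St n) (J ZN ZJ : Fam n) : Set where
  field
    ZN-dec : ∀ e {x} → T (ZN (suc e) x) → T (ZN e x)
    ZJ-dec : ∀ e {x} → T (ZJ (suc e) x) → T (ZJ e x)
    ZJ⊂ZN  : ∀ e {x} → T (ZJ e x) → T (ZN e x)
    G  : ∀ e {x} → T (ZN e x) → T (B s e x) × ¬ T (I s e x)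
    G′ : ∀ e {x} → T (ZN (suc e) x) → T (B s e (neg' x)) × ¬ T (I s e (neg' x))
    K  : ∀ e {x} → T (ZJ (suc e) x) → T (J e (neg' x))
    Pa : ∀ {r q p x y} → r ≤ q → q ≤ p → x ⊑ y → T (B s r y) → ¬ T (I s q y) → T (ZJ p x) → T (ZJ p y)
    Pb : ∀ {r q p x y} → r ≤ q → q < p → x ⊑ y → T (B s r y) → ¬ T (I s q y) → T (ZJ p (neg' x)) → T (ZJ p (neg' y))

module _ {n} {s : St n} {J ZN ZJ : Fam n} (B-dec : ∀ e {x} → T (B s (suc e) x) → T (B s e x))
         (I-dec : ∀ e {x} → T (I s (suc e) x) → T (I s e x)) (dy : Dyn s J ZN ZJ) where
  open Dyn dy

  private
    -- the boundary of a ball of the suspended family, seen from one of its vertices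
    inv : ∀ {r q} v y → r ≤ q → T (selB (par r) v (B s r y) (B s (suc r) y)) → ¬ T (selI (par q) v (I s q y) (I s (suc q) y)) →
          Σ ℕ λ r′ → Σ ℕ λ q′ → r′ ≤ q′ × T (B s r′ y) × ¬ T (I s q′ y) × ((q′ ≡ q) ⊎ (q′ ≡ suc q × v ≢ sgn (par q)))
    inv {r} {q} v y l b i with selI-not (par q) v (selB-ok (par r) v b) i | selB-view (par r) v b
    ... | inj₂ (w , ni) | inj₁ (_ , t) = r , suc q , ≤-trans l (ℕₚ.n≤1+n q) , t , ni , inj₂ (refl , w)
    ... | inj₂ (w , ni) | inj₂ (_ , t) = suc r , suc q , s≤s l , t , ni , inj₂ (refl , w)
    ... | inj₁ (w , ni) | inj₁ (_ , t) = r , q , l , t , ni , inj₁ refl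
    ... | inj₁ (w , ni) | inj₂ (u , t) = suc r , q , par-≢ l (λ e → b≢not (par r) (trans (sym e) (sgn-inj (trans (sym w) u)))) , t , ni , inj₁ refl

    upper : ∀ {q′ q} {X : Set} → (q′ ≡ q) ⊎ (q′ ≡ suc q × X) → q′ ≤ suc q
    upper (inj₁ refl) = ℕₚ.n≤1+n _
    upper (inj₂ (refl , _)) = ≤-refl

    sgn-down : ∀ {u v} p → u ≤q v → T (okq v) → u ≡ sgn p → v ≡ sgn p
    sgn-down true PP k refl = refl
    sgn-down false MM k refl = refl

    neg-ok : ∀ {v} → T (okq v) → T (okq (negq v))
    neg-ok {v} = subst T (sym (okq-neg v))

  -- In a suspension the boundary of a ball contains faces of Bᵣ outside Iᵣ₊₁, so a statement about
  -- boundaries alone would not be inductive; hence the two indices r ≤ q. When q rises by one, the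
  -- apex is not `sgn (par q)`, and if p wants that apex, the parities of p and q differ and q < p
  -- leaves room.
  step-Pa : ∀ {r q p x y} → r ≤ q → q ≤ p → x ⊑ y → T (stepB (B s) r y) → ¬ T (stepI (I s) q y) →
            T (stepI ZJ p x) → T (stepI ZJ p y)
  step-Pa {r} {q} {p} {u ∷ x} {v ∷ y} l k (a ∷ m) b i z with inv v y l b i
  ... | r′ , q′ , l′ , b′ , i′ , w with sgn-dec (par p) v (selB-ok (par r) v b)
  ... | inj₂ nv = selI-other (par p) (selB-ok (par r) v b) nv
        (Pa l′ (≤-trans (upper w) (s≤s k)) m b′ i′ (h (selI-view (par p) u z)))
    where
    h : ∀ {A C : Set} → (u ≡ sgn (par p) × A) ⊎ (u ≢ sgn (par p) × C) → C
    h (inj₁ (e , _)) = ⊥-elim (nv (sgn-down (par p) a (selB-ok (par r) v b) e))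
    h (inj₂ (_ , c)) = c
  ... | inj₁ ev = selI-same (par p) ev (h (selI-view (par p) u z))
    where
    q′≤ : (q′ ≡ q) ⊎ (q′ ≡ suc q × v ≢ sgn (par q)) → q′ ≤ p
    q′≤ (inj₁ refl) = k
    q′≤ (inj₂ (refl , nv)) = par-≢ k (λ e → nv (trans ev (cong sgn e)))
    h : (u ≡ sgn (par p) × T (ZJ p x)) ⊎ (u ≢ sgn (par p) × T (ZJ (suc p) x)) → T (ZJ p y)
    h (inj₁ (_ , t)) = Pa l′ (q′≤ w) m b′ i′ t
    h (inj₂ (_ , t)) = ZJ-dec p (Pa l′ (≤-trans (upper w) (s≤s k)) m b′ i′ t)

  -- Reflection exchanges the apices, so here a rise of q meets equal parities of p and q; together
  -- with q < p this gives q + 1 < p. Hence the strict inequality in the hypothesis.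
  step-Pb : ∀ {r q p x y} → r ≤ q → q < p → x ⊑ y → T (stepB (B s) r y) → ¬ T (stepI (I s) q y) →
            T (stepI ZJ p (neg' x)) → T (stepI ZJ p (neg' y))
  step-Pb {r} {q} {p} {u ∷ x} {v ∷ y} l k (a ∷ m) b i z = go (selI-view (par p) (negq u) z)
    where
    okv′ = selB-ok (par r) v b
    c = inv v y l b i
    q′ = proj₁ (proj₂ c)
    l′ = proj₁ (proj₂ (proj₂ c))
    b′ = proj₁ (proj₂ (proj₂ (proj₂ c)))
    i′ = proj₁ (proj₂ (proj₂ (proj₂ (proj₂ c))))
    w = proj₂ (proj₂ (proj₂ (proj₂ (proj₂ c))))
    q′< : negq v ≡ sgn (par p) → (q′ ≡ q) ⊎ (q′ ≡ suc q × v ≢ sgn (par q)) → q′ < p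
    q′< e (inj₁ f) = subst (_< p) (sym f) k
    q′< e (inj₂ (f , nv)) = subst (_< p) (sym f) (par-≡ k (¬≢not (λ g → nv
      (trans (sym (negq-inv v)) (trans (cong negq e) (trans (cong (negq ∘ sgn) g) (trans (negq-sgn (not (par q))) (cong sgn (not-inv _)))))))))
    next : T (ZJ (suc p) (neg' x)) → T (ZJ (suc p) (neg' y))
    next = Pb l′ (s≤s (≤-trans (upper w) k)) m b′ i′
    go : (negq u ≡ sgn (par p) × T (ZJ p (neg' x))) ⊎ (negq u ≢ sgn (par p) × T (ZJ (suc p) (neg' x))) →
         T (selI (par p) (negq v) (ZJ p (neg' y)) (ZJ (suc p) (neg' y)))
    go (inj₁ (e , t)) = selI-same (par p) e′ (Pb l′ (q′< e′ w) m b′ i′ t)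
      where e′ = sgn-down (par p) (negq-mono a) (neg-ok {v} okv′) e
    go (inj₂ (_ , t)) with sgn-dec (par p) (negq v) (neg-ok {v} okv′)
    ... | inj₁ e = selI-same (par p) e (ZJ-dec p (next t))
    ... | inj₂ e = selI-other (par p) (neg-ok {v} okv′) e (next t)

  step-dyn : Dyn (stepS s) (stepI J) (stepB ZN) (stepI ZJ)
  step-dyn = record
    { ZN-dec = step-N-dec ZN-dec
    ; ZJ-dec = step-J-dec ZJ-dec
    ; ZJ⊂ZN = step-J⊂N ZJ⊂ZN ZN-dec
    ; G = λ { e {v ∷ x} t → selB-mono (par e) v (λ k → proj₁ (G e k)) (λ k → proj₁ (G (suc e) k)) t
                          , selBI-not (par e) v (λ k → proj₂ (G e k)) (λ k → proj₂ (G (suc e) k)) (I-dec e) t }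
    ; G′ = λ { e {v ∷ x} t → selB-mono (par e) (negq v) (λ k → proj₁ (G′ e k)) (λ k → proj₁ (G′ (suc e) k)) (subst T (selB-neg (par e) v _ _) t)
                           , selBI-not (par e) (negq v) (λ k → proj₂ (G′ e k)) (λ k → proj₂ (G′ (suc e) k)) (I-dec e) (subst T (selB-neg (par e) v _ _) t) }
    ; K = λ { e {v ∷ x} t → selI-mono (par e) (negq v) (K e) (K (suc e)) (subst T (selI-neg (par e) v _ _) t) }
    ; Pa = step-Pa
    ; Pb = step-Pb }

-- Passage to the next time.

record Lvl {n} (D : Pred n) (N J : Fam n) (s : St n) : Set where
  field
    am    : Amb (Both D) N J
    D-sym : ∀ {x} → T (D x) → T (D (neg' x))
    ok    : OkU (Both D) N J s
    cov   : ∀ e {x} → T (J e x) → T (B s e x) ⊎ T (I s (suc e) (neg' x))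
    path  : Path (Both D) (OkU (Both D) N J) 2 emptyS s
    d∅    : T (D ∅)

-- Inside `J` the ball Bₑ and the reflected interior of Bₑ₊₁ leave no gap. After an extension this
-- holds at index 0 by construction of the complement. It locates faces of which only absence from
-- certain interiors is known.
Cov : ∀ {n} → Fam n → St n → Set
Cov J s = ∀ e {x} → T (J e x) → T (B s e x) ⊎ T (I s (suc e) (neg' x))

step-cov : ∀ {n} {J : Fam n} {s : St n} → (∀ e {x} → T (B s (suc e) x) → T (B s e x)) → Cov J s → Cov (stepI J) (stepS s)
step-cov {s = s} bd c e {v ∷ x} t with selI-view (par e) v t
... | inj₁ (q , j) = [ (λ b → inj₁ (sB (par e) q b))
                     , (λ i → inj₂ (subst T (sym (selI-neg (par e) (negq v) _ _)) (selI-same (par e) (trans (negq-inv v) q) i))) ]′ (c e j)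
  where
  sB : ∀ p {a b} → v ≡ sgn p → T a → T (selB p v a b)
  sB true refl t = t
  sB false refl t = t
... | inj₂ (q , j) = [ (λ b → inj₁ (sB (par e) v (selI-ok (par e) v t) q b))
                     , (λ i → inj₂ (subst T (sym (selI-neg (par e) (negq v) _ _))
                         (selI-other (par e) (subst (T ∘ okq) (sym (negq-inv v)) (selI-ok (par e) v t)) (λ r → q (trans (sym (negq-inv v)) r)) i))) ]′ (c (suc e) j)
  where
  sB : ∀ p v → T (okq v) → v ≢ sgn p → T (B s (suc e) x) → T (selB p v (B s e x) (B s (suc e) x))
  sB p O _ _ t = bd e t
  sB true P _ q t = ⊥-elim (q refl)
  sB true M _ q t = t
  sB false P _ q t = t
  sB false M _ q t = ⊥-elim (q refl)

ext-cov : ∀ {n} {D : Pred n} {J : Fam n} {s : St n} → Cov J s → Cov (extN D J) (extS D s)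
ext-cov {D = D} {s = s} c zero {x} d with T? (I s 0 x)
... | inj₁ i = inj₂ (subst (T ∘ I s 0) (sym (neg-inv x)) i)
... | inj₂ i = inj₁ (∧-i d (¬-i i))
ext-cov c (suc e) j = c e j

up-lvl : ∀ {n} {D : Pred n} {N J s} {D″ : Pred (suc (suc n))} → Lvl D N J s → Amb (Both D″) (upN D N) (upJ D J) →
         (∀ {x} → T (D″ x) → T (D″ (neg' x))) → T (D″ ∅) → Lvl D″ (upN D N) (upJ D J) (upS D s)
up-lvl {D = D} {N} {J} {s} l am″ sym″ d″ = record
  { am = am″ ; D-sym = sym″ ; ok = up-ok L.am L.D-sym am″ L.ok
  ; cov = step-cov hd (step-cov xd (ext-cov L.cov))
  ; path = up-path L.am L.D-sym am″ L.d∅ L.path ; d∅ = d″ }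
  where
  module L = Lvl l
  ox = ext-ok L.am L.D-sym L.ok L.ok (near-refl (proj₁ L.ok))
  xd : ∀ e {x} → T (B (extS D s) (suc e) x) → T (B (extS D s) e x)
  xd = Good.B-dec (proj₁ ox)
  hd : ∀ e {x} → T (stepB (B (extS D s)) (suc e) x) → T (stepB (B (extS D s)) e x)
  hd = step-N-dec xd

-- The bounds of the next time are suspensions, with the new pair as apices, of families on the old
-- vertices. At level 0 the two sides test a face in different forms, hence implications both ways
-- instead of equations.
record Tim {n} (s : St n) (J : Fam n) (N¹ J¹ : Fam (suc n)) : Set where
  field
    ZN ZJ : Fam n
    dyn   : Dyn s J ZN ZJ
    n→ : ∀ e {x} → T (N¹ e x) → T (stepB ZN e x)
    n← : ∀ e {x} → T (stepB ZN e x) → T (N¹ e x)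
    j→ : ∀ e {x} → T (J¹ e x) → T (stepI ZJ e x)
    j← : ∀ e {x} → T (stepI ZJ e x) → T (J¹ e x)

module _ {n} {D : Pred n} {N J s} (l : Lvl D N J s) where
  private
    module L = Lvl l
    module A = Amb L.am
    module S = Good (proj₁ L.ok)
    D1 = cone D s s

  cone-sym : ∀ {x} → T (D1 x) → T (D1 (neg' x))
  cone-sym {O ∷ x} t = let r = ∧-r {D x} t in
    ∧-i (L.D-sym (∧-l t)) (∧-i (∧-r {not (I s 0 x)} r) (subst (λ y → T (not (I s 0 y))) (sym (neg-inv x)) (∧-l r)))
  cone-sym {P ∷ x} t = subst (λ y → T (B s 0 y ∧ not (I s 0 y))) (sym (neg-inv x)) t
  cone-sym {M ∷ x} t = t

  cone-ok : ∀ {x} → T (D1 x) → T (okv x)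
  cone-ok {O ∷ x} t = A.D-ok true (∧-l t)
  cone-ok {P ∷ x} t = A.D-ok true (A.N⊂D 0 (S.B⊂N 0 (∧-l t)))
  cone-ok {M ∷ x} t = subst T (okv-neg x) (A.D-ok true (A.N⊂D 0 (S.B⊂N 0 (∧-l t))))

  cone-closed : Closed D1
  cone-closed = cone-cl L.am L.D-sym (proj₁ L.ok) (proj₁ L.ok) (proj₂ L.ok) (proj₂ L.ok)

  cone-∅ : ¬ T (I s 0 ∅) → T (D1 ∅)
  cone-∅ f = ∧-i L.d∅ (∧-i (¬-i f) (¬-i (λ i → f (subst (T ∘ I s 0) neg-∅ i))))

  module _ {N¹ J¹ : Fam (suc n)} (tm : Tim s J N¹ J¹) where
    open Tim tm
    open Dyn dyn
    private
      B→D : ∀ e {x} → T (B s e x) → T (D x)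
      B→D e b = A.N⊂D e (S.B⊂N e b)

      nn : ∀ {F : Pred n} {x} → T (F (neg' (neg' x))) → T (F x)
      nn {F} {x} = subst (T ∘ F) (neg-inv x)

      nn⁻ : ∀ {F : Pred n} {x} → T (F x) → T (F (neg' (neg' x)))
      nn⁻ {F} {x} = subst (T ∘ F) (sym (neg-inv x))

      N0⊂D1 : ∀ {x} → T (stepB ZN 0 x) → T (D1 x)
      N0⊂D1 {O ∷ x} t = let r = G 0 t in
        ∧-i (B→D 0 (proj₁ r)) (∧-i (¬-i (proj₂ r)) (¬-i (proj₂ L.ok x (proj₁ r))))
      N0⊂D1 {P ∷ x} t = let r = G 0 t in ∧-i (proj₁ r) (¬-i (proj₂ r))
      N0⊂D1 {M ∷ x} t = let r = G′ 0 t in ∧-i (proj₁ r) (¬-i (proj₂ r))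

      Nd : ∀ e {x} → T (N¹ (suc e) x) → T (N¹ e x)
      Nd e {x} t = n← e {x} (step-N-dec ZN-dec e {x} (n→ (suc e) {x} t))

      Jd : ∀ e {x} → T (J¹ (suc e) x) → T (J¹ e x)
      Jd e {x} t = j← e {x} (step-J-dec ZJ-dec e {x} (j→ (suc e) {x} t))

      sd : Dyn (stepS s) (stepI J) (stepB ZN) (stepI ZJ)
      sd = step-dyn S.B-dec S.I-dec dyn
      module SD = Dyn sd

      Z1 : ∀ {p} → 1 ≤ p → ∀ {x y} → x ⊑ y → T (B s 0 (neg' y)) → ¬ T (I s 0 (neg' y)) → T (ZJ p x) → T (ZJ p y)
      Z1 r m b i z = nn {ZJ _} (Pb z≤n r (neg-mono m) b i (nn⁻ {ZJ _} z))

      op : ∀ p {x y} → x ⊑ y → T (D1 y) → T (stepI ZJ p x) → T (stepI ZJ p y)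
      op p {u ∷ x} {P ∷ y} (a ∷ m) d z = SD.Pa {0} {0} {p} {u ∷ x} {P ∷ y} z≤n z≤n (a ∷ m) (∧-l d) (¬-e (∧-r {B s 0 y} d)) z
      -- Without the new vertex, y only avoids the interiors of both balls. By `K` and openness -y
      -- lies in J₀, and `cov` then places it in B₀, since the alternative would put y into I₁ and
      -- so into I₀.
      op p {O ∷ x} {O ∷ y} (O≤ ∷ m) d z = Z1 (s≤s z≤n) m b (¬-e (∧-r {not (I s 0 y)} (∧-r {D y} d))) z
        where
        k : T (J 0 (neg' y))
        k = A.J-op 0 (neg-mono m) (L.D-sym (∧-l d)) (K 0 (dec* ZJ-dec (s≤s z≤n) z))
        b : T (B s 0 (neg' y))
        b = [ id , (λ i → ⊥-elim (¬-e (∧-l (∧-r {D y} d)) (S.I-dec 0 (nn {I s 1} i)))) ]′ (L.cov 0 k)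
      op p {u ∷ x} {M ∷ y} (a ∷ m) d z = go p z a
        where
        b = ∧-l {B s 0 (neg' y)} d
        i = ¬-e (∧-r {B s 0 (neg' y)} d)
        go : ∀ p → T (stepI ZJ p (u ∷ x)) → u ≤q M → T (stepI ZJ p (M ∷ y))
        go p z O≤ with sgn-dec (par p) M tt
        ... | inj₁ e = selI-same (par p) e (ZJ-dec p (Z1 (s≤s z≤n) m b i z))
        ... | inj₂ e = selI-other (par p) {M} tt e (Z1 (s≤s z≤n) m b i z)
        go p z MM with selI-view (par p) M z
        ... | inj₂ (e , t) = selI-other (par p) {M} tt e (Z1 (s≤s z≤n) m b i t)
        ... | inj₁ (e , t) = selI-same (par p) e (Z1 (pos p e) m b i t)
          where
          pos : ∀ p → M ≡ sgn (par p) → 1 ≤ p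
          pos zero ()
          pos (suc p) _ = s≤s z≤n

    time-amb : Amb (Both D1) N¹ J¹
    time-amb = record
      { D-ok = λ _ {x} → cone-ok {x}
      ; D-cl = λ _ {x} {y} → cone-closed {x} {y}
      ; N⊂D = λ e {x} t → N0⊂D1 {x} (n→ 0 {x} (dec* Nd {0} {e} z≤n {x} t))
      ; J⊂N = λ e {x} t → n← e {x} (step-J⊂N ZJ⊂ZN ZN-dec e {x} (j→ e {x} t))
      ; J-op = λ e {x} {y} m d t → j← e {y} (op e {x} {y} m d (j→ e {x} t))
      ; N-dec = Nd
      ; J-dec = Jd }

    private
      module A1 = Amb time-amb

      -- The new sphere is the boundary of the front ball in the once suspended extended family:
      -- over the positive apex the complement leaves ∂B₀, over the negative one stands -∂B₀, and
      -- between them are the faces outside both interiors.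
      D1→ : ∀ {x} → T (D1 x) → T (stepB (B (extS D s)) 0 x) × ¬ T (stepI (I (extS D s)) 0 x)
      D1→ {O ∷ x} t = ∧-i {D x} (∧-l t) (∧-l {not (I s 0 x)} (∧-r {D x} t)) , ¬-e (∧-r {not (I s 0 x)} (∧-r {D x} t))
      D1→ {P ∷ x} t = ∧-i (B→D 0 (∧-l t)) (∧-r {B s 0 x} t) , (λ r → ¬-e (∧-r {D x} r) (∧-l t))
      D1→ {M ∷ x} t = ∧-l t , ¬-e (∧-r {B s 0 (neg' x)} t)

      →D1 : ∀ {x} → T (stepB (B (extS D s)) 0 x) → ¬ T (stepI (I (extS D s)) 0 x) → T (D1 x)
      →D1 {O ∷ x} b i = ∧-i {D x} (∧-l b) (∧-i {not (I s 0 x)} (∧-r {D x} b) (¬-i i))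
      →D1 {P ∷ x} b i with T? (B s 0 x)
      ... | inj₁ k = ∧-i k (∧-r {D x} b)
      ... | inj₂ k = ⊥-elim (i (∧-i (∧-l b) (¬-i k)))
      →D1 {M ∷ x} b i = ∧-i b (¬-i i)

      shB : ∀ e x → stepB (B (extS D s)) (suc e) x ≡ stepB (B s) e (neg' x)
      shB e (v ∷ x) = selB-neg (par e) v _ _
      shI : ∀ e x → stepI (I (extS D s)) (suc e) x ≡ stepI (I s) e (neg' x)
      shI e (v ∷ x) = selI-neg (par e) v _ _
      shJ : ∀ e x → stepI (extN D J) (suc e) x ≡ stepI J e (neg' x)
      shJ e (v ∷ x) = selI-neg (par e) v _ _

      -- Being above a member of the family puts y into Jᵣ; as it avoids the reflected Iᵣ₊₁, `cov`
      -- puts it into Bᵣ, where the old `Pb` applies. This makes up for how little is known of a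
      -- face of a complement.
      κa : ∀ {r i x y} → suc r ≤ i → x ⊑ y → T (D y) → ¬ T (I s 0 y) → ¬ T (I s (suc r) (neg' y)) →
           T (ZJ i (neg' x)) → T (ZJ i (neg' y))
      κa {r} {i} {x} {y} le m d ni nr z = Pb ≤-refl le m b (λ k → ni (dec* S.I-dec {0} {r} z≤n k)) z
        where
        b : T (B s r y)
        b = [ id , (λ k → ⊥-elim (nr k)) ]′ (L.cov r (A.J-op r m d (nn {J r} (K r (dec* ZJ-dec le z)))))
      κb : ∀ {r i x y} → suc r < i → x ⊑ y → T (D y) → ¬ T (I s 0 y) → ¬ T (I s (suc r) (neg' y)) →
           T (ZJ i x) → T (ZJ i y)
      κb {r} {i} {x} {y} le m d ni nr z = nn {ZJ i} (Pb ≤-refl le (neg-mono m) b nr (nn⁻ {ZJ i} z))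
        where
        b : T (B s (suc r) (neg' y))
        b = [ id , (λ k → ⊥-elim (ni (dec* S.I-dec {0} {suc (suc r)} z≤n (nn {I s (suc (suc r))} k)))) ]′
            (L.cov (suc r) (A.J-op (suc r) (neg-mono m) (L.D-sym d) (K (suc r) (dec* ZJ-dec le z))))

      lim : ∀ q w y → w ≢ P → T (okq w) → ¬ T (stepI (I s) q (w ∷ neg' y)) →
            Σ ℕ λ r → ¬ T (I s (suc r) (neg' y)) × ((suc r ≡ q × w ≡ sgn (par q)) ⊎ (r ≡ q × w ≢ sgn (par q)))
      lim q w y nP k f with selI-not (par q) w k f
      lim zero w y nP k f | inj₁ (e , g) = ⊥-elim (nP e)
      lim (suc q) w y nP k f | inj₁ (e , g) = q , g , inj₁ (refl , e)
      lim q w y nP k f | inj₂ (e , g) = q , g , inj₂ (refl , e)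

      Xa : ∀ {q p x y} v {u} → v ≢ M → T (okq v) → u ≤q v → q ≤ p → x ⊑ y → T (D y) → ¬ T (I s 0 y) →
           ¬ T (stepI (I s) q (neg' (v ∷ y))) → T (stepI ZJ p (neg' (u ∷ x))) → T (stepI ZJ p (neg' (v ∷ y)))
      Xa {q} {p} {x} {y} v {u} nM kv uv le m d ni nq z = go (selI-view (par p) (negq u) z)
        where
        kw : T (okq (negq v))
        kw = subst T (sym (okq-neg v)) kv
        w = lim q (negq v) y (λ e → nM (trans (sym (negq-inv v)) (cong negq e))) kw nq
        r = proj₁ w
        nr = proj₁ (proj₂ w)
        r≤ : (suc r ≡ q × negq v ≡ sgn (par q)) ⊎ (r ≡ q × negq v ≢ sgn (par q)) → suc r ≤ suc p
        r≤ (inj₁ (e , _)) = subst (_≤ suc p) (sym e) (≤-trans le (ℕₚ.n≤1+n p))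
        r≤ (inj₂ (e , _)) = s≤s (subst (_≤ p) (sym e) le)
        r≤′ : negq v ≡ sgn (par p) → (suc r ≡ q × negq v ≡ sgn (par q)) ⊎ (r ≡ q × negq v ≢ sgn (par q)) → suc r ≤ p
        r≤′ e (inj₁ (f , _)) = subst (_≤ p) (sym f) le
        r≤′ e (inj₂ (f , g)) = subst (λ k → suc k ≤ p) (sym f) (par-≢ le (λ h → g (trans e (cong sgn h))))
        nx : T (ZJ (suc p) (neg' x)) → T (ZJ (suc p) (neg' y))
        nx = κa (r≤ (proj₂ (proj₂ w))) m d ni nr
        lift≤ : ∀ {u v} q → u ≤q v → T (okq v) → u ≡ sgn q → v ≡ sgn q
        lift≤ true PP k refl = refl
        lift≤ false MM k refl = refl
        go : (negq u ≡ sgn (par p) × T (ZJ p (neg' x))) ⊎ (negq u ≢ sgn (par p) × T (ZJ (suc p) (neg' x))) →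
             T (stepI ZJ p (neg' (v ∷ y)))
        go (inj₁ (e , t)) = let e′ = lift≤ (par p) (negq-mono uv) kw e in
          selI-same (par p) e′ (κa (r≤′ e′ (proj₂ (proj₂ w))) m d ni nr t)
        go (inj₂ (_ , t)) with sgn-dec (par p) (negq v) kw
        ... | inj₁ e = selI-same (par p) e (ZJ-dec p (nx t))
        ... | inj₂ e = selI-other (par p) kw e (nx t)

      Xb : ∀ {q p x y} v {u} → v ≢ M → T (okq v) → u ≤q v → q < p → x ⊑ y → T (D y) → ¬ T (I s 0 y) →
           ¬ T (stepI (I s) q (neg' (v ∷ y))) → T (stepI ZJ p (u ∷ x)) → T (stepI ZJ p (v ∷ y))
      Xb {q} {p} {x} {y} v {u} nM kv uv le m d ni nq z = go (selI-view (par p) u z)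
        where
        kw : T (okq (negq v))
        kw = subst T (sym (okq-neg v)) kv
        w = lim q (negq v) y (λ e → nM (trans (sym (negq-inv v)) (cong negq e))) kw nq
        r = proj₁ w
        nr = proj₁ (proj₂ w)
        r≤ : (suc r ≡ q × negq v ≡ sgn (par q)) ⊎ (r ≡ q × negq v ≢ sgn (par q)) → suc r < suc p
        r≤ (inj₁ (e , _)) = s≤s (subst (_≤ p) (sym e) (ℕₚ.<⇒≤ le))
        r≤ (inj₂ (e , _)) = s≤s (subst (_< p) (sym e) le)
        r≤′ : v ≡ sgn (par p) → (suc r ≡ q × negq v ≡ sgn (par q)) ⊎ (r ≡ q × negq v ≢ sgn (par q)) → suc r < p
        r≤′ e (inj₁ (f , _)) = subst (_< p) (sym f) le
        r≤′ e (inj₂ (f , g)) = subst (λ k → suc k < p) (sym f)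
          (par-≡ le (¬≢not (λ h → g (trans (cong negq (trans e (cong sgn h))) (trans (negq-sgn _) (cong sgn (not-inv _)))))))
        nx : T (ZJ (suc p) x) → T (ZJ (suc p) y)
        nx = κb (r≤ (proj₂ (proj₂ w))) m d ni nr
        lift≤ : ∀ {u v} q → u ≤q v → T (okq v) → u ≡ sgn q → v ≡ sgn q
        lift≤ true PP k refl = refl
        lift≤ false MM k refl = refl
        go : (u ≡ sgn (par p) × T (ZJ p x)) ⊎ (u ≢ sgn (par p) × T (ZJ (suc p) x)) → T (stepI ZJ p (v ∷ y))
        go (inj₁ (e , t)) = let e′ = lift≤ (par p) uv kv e in
          selI-same (par p) e′ (κb (r≤′ e′ (proj₂ (proj₂ w))) m d ni nr t)
        go (inj₂ (_ , t)) with sgn-dec (par p) v kv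
        ... | inj₁ e = selI-same (par p) e (ZJ-dec p (nx t))
        ... | inj₂ e = selI-other (par p) kv e (nx t)

      nn¹ : ∀ {F : Pred (suc n)} {x} → T (F (neg' (neg' x))) → T (F x)
      nn¹ {F} {x} = subst (T ∘ F) (neg-inv x)

      nn¹⁻ : ∀ {F : Pred (suc n)} {x} → T (F x) → T (F (neg' (neg' x)))
      nn¹⁻ {F} {x} = subst (T ∘ F) (sym (neg-inv x))

      -- Terms of positive index are reflected terms of the old suspended family. At r = 0 the ball
      -- is -B₀ over the negative apex, where the old openness still serves; the remaining faces lie
      -- in the complement, and for positive q they need `Xa`.
      XPa : ∀ {r q p x y} → r ≤ q → q ≤ p → x ⊑ y → T (stepB (B (extS D s)) r y) → ¬ T (stepI (I (extS D s)) q y) →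
            T (extN D1 J¹ p x) → T (extN D1 J¹ p y)
      XPa {suc r} {suc q} {suc p} {x} {y} (s≤s a) (s≤s b) m bb ii z =
        j← p (SD.Pa a b (neg-mono m) (subst T (shB r y) bb) (λ i → ii (subst T (sym (shI q y)) i)) (j→ p z))
      XPa {zero} {zero} {zero} {x} {y} a b m bb ii z = →D1 {y} bb ii
      XPa {zero} {zero} {suc p} {x} {y} a b m bb ii z = A1.J-op p (neg-mono m) (cone-sym {y} (→D1 {y} bb ii)) z
      XPa {zero} {suc q} {suc p} {u ∷ x} {M ∷ y} a (s≤s b) m bb ii z =
        j← p (SD.Pa {0} {q} z≤n b (neg-mono m) bb (λ i → ii (subst T (sym (shI q (M ∷ y))) i)) (j→ p z))
      XPa {zero} {suc q} {suc p} {u ∷ x} {O ∷ y} a (s≤s b) (c ∷ m) bb ii z =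
        j← p (Xa O (λ ()) tt c b m (∧-l bb) (¬-e (∧-r {D y} bb)) (λ i → ii (subst T (sym (shI q (O ∷ y))) i)) (j→ p z))
      XPa {zero} {suc q} {suc p} {u ∷ x} {P ∷ y} a (s≤s b) (c ∷ m) bb ii z =
        j← p (Xa P (λ ()) tt c b m (∧-l bb) (¬-e (∧-r {D y} bb)) (λ i → ii (subst T (sym (shI q (P ∷ y))) i)) (j→ p z))

      XPb : ∀ {r q p x y} → r ≤ q → q < p → x ⊑ y → T (stepB (B (extS D s)) r y) → ¬ T (stepI (I (extS D s)) q y) →
            T (extN D1 J¹ p (neg' x)) → T (extN D1 J¹ p (neg' y))
      XPb {suc r} {suc q} {suc p} {x} {y} (s≤s a) (s≤s b) m bb ii z =
        j← p (SD.Pb a b (neg-mono m) (subst T (shB r y) bb) (λ i → ii (subst T (sym (shI q y)) i)) (j→ p z))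
      XPb {zero} {zero} {suc p} {x} {y} a b m bb ii z = nn¹⁻ {J¹ p} (A1.J-op p m (→D1 {y} bb ii) (nn¹ {J¹ p} z))
      XPb {zero} {suc q} {suc p} {u ∷ x} {M ∷ y} a (s≤s b) m bb ii z =
        j← p (SD.Pb {0} {q} z≤n b (neg-mono m) bb (λ i → ii (subst T (sym (shI q (M ∷ y))) i)) (j→ p z))
      XPb {zero} {suc q} {suc p} {u ∷ x} {O ∷ y} a (s≤s b) (c ∷ m) bb ii z =
        nn¹⁻ {J¹ p} (j← p (Xb O (λ ()) tt c b m (∧-l bb) (¬-e (∧-r {D y} bb)) (λ i → ii (subst T (sym (shI q (O ∷ y))) i))
          (j→ p (nn¹ {J¹ p} {u ∷ x} z))))
      XPb {zero} {suc q} {suc p} {u ∷ x} {P ∷ y} a (s≤s b) (c ∷ m) bb ii z =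
        nn¹⁻ {J¹ p} (j← p (Xb P (λ ()) tt c b m (∧-l bb) (¬-e (∧-r {D y} bb)) (λ i → ii (subst T (sym (shI q (P ∷ y))) i))
          (j→ p (nn¹ {J¹ p} {u ∷ x} z))))

      XK0 : ∀ {x} → T (stepI ZJ 0 x) → T (stepI (extN D J) 0 x)
      XK0 {O ∷ x} t = K 0 t
      XK0 {P ∷ x} t = B→D 0 (proj₁ (G 0 (ZJ⊂ZN 0 t)))
      XK0 {M ∷ x} t = K 0 t

      ext-dyn : Dyn (stepS (extS D s)) (stepI (extN D J)) (extN D1 N¹) (extN D1 J¹)
      ext-dyn = record
        { ZN-dec = Amb.N-dec (ext-amb time-amb (λ {x} → cone-sym {x}))
        ; ZJ-dec = Amb.J-dec (ext-amb time-amb (λ {x} → cone-sym {x}))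
        ; ZJ⊂ZN = Amb.J⊂N (ext-amb time-amb (λ {x} → cone-sym {x}))
        ; G = λ { zero {x} t → D1→ {x} t
                ; (suc e) {x} t → subst T (sym (shB e x)) (proj₁ (SD.G e {neg' x} (n→ e {neg' x} t)))
                                , (λ i → proj₂ (SD.G e {neg' x} (n→ e {neg' x} t)) (subst T (shI e x) i)) }
        ; G′ = λ { zero {x} t → D1→ {neg' x} (N0⊂D1 {neg' x} (n→ 0 {neg' x} t))
                 ; (suc e) {x} t → subst T (sym (shB e (neg' x))) (proj₁ (SD.G′ e {neg' x} (n→ (suc e) {neg' x} t)))
                                 , (λ i → proj₂ (SD.G′ e {neg' x} (n→ (suc e) {neg' x} t)) (subst T (shI e (neg' x)) i)) }
        ; K = λ { zero {x} t → XK0 {neg' x} (j→ 0 {neg' x} t)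
                ; (suc e) {x} t → subst T (sym (shJ e (neg' x))) (SD.K e {neg' x} (j→ (suc e) {neg' x} t)) }
        ; Pa = XPa
        ; Pb = XPb }

    up-tim : Tim (upS D s) (upJ D J) (upN D1 N¹) (upJ D1 J¹)
    up-tim = record
      { ZN = stepB (extN D1 N¹) ; ZJ = stepI (extN D1 J¹)
      ; dyn = step-dyn (step-N-dec xB) (step-J-dec xI) ext-dyn
      ; n→ = λ _ t → t ; n← = λ _ t → t ; j→ = λ _ t → t ; j← = λ _ t → t }
      where
      ox = ext-ok L.am L.D-sym L.ok L.ok (near-refl (proj₁ L.ok))
      xB : ∀ e {x} → T (B (extS D s) (suc e) x) → T (B (extS D s) e x)
      xB = Good.B-dec (proj₁ ox)
      xI : ∀ e {x} → T (I (extS D s) (suc e) x) → T (I (extS D s) e x)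
      xI = Good.I-dec (proj₁ ox)

-- The spheres of all levels and times.

starS : ∀ {n} → Pred n → Vec Q n → St n
starS D f = st (λ { zero x → D (x ∪ f) ; (suc e) x → false }) (λ { zero x → D x ∧ sub f x ; (suc e) x → false })

-- A sequence of faces f m, each containing the newest vertex, along which a 3-sphere is repeatedly subdivided.
-- The vertices are counted by pairs, and the length argument of `o` is meaningful only when it equals m + 4.
Seq : Set
Seq = ℕ → ∀ n → Vec Q n

start : ∀ n → Vec Q n
start (suc (suc n)) = P ∷ P ∷ ∅
start _ = ∅

face : Seq → ℕ → ∀ n → Vec Q n
face o zero n = start n
face o (suc m) (suc n) = P ∷ o m n
face o (suc m) zero = []

mutual
  Δ : Seq → ℕ → ℕ → ∀ n → Pred n
  Δ o L zero n = okv
  Δ o L (suc m) zero = λ _ → false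
  Δ o L (suc m) (suc n) = cone (Δ o L m n) (U o L m n) (U o L m n)

  U : Seq → ℕ → ℕ → ∀ n → St n
  U o zero m n = starS (Δ o zero m n) (face o m n)
  U o (suc L) m (suc (suc n)) = upS (Δ o L m n) (U o L m n)
  U o (suc L) m _ = emptyS

-- The recursion is that of `U` with the whole lower sphere in place of the complement, so that the
-- bounds hold for all balls along a path and not only for the last one.
NN JJ : Seq → ℕ → ℕ → ∀ n → Fam n
NN o zero m n = B (U o zero m n)
NN o (suc L) m (suc (suc n)) = upN (Δ o L m n) (NN o L m n)
NN o (suc L) m _ = λ _ _ → false
JJ o zero m n = I (U o zero m n)
JJ o (suc L) m (suc (suc n)) = upJ (Δ o L m n) (JJ o L m n)
JJ o (suc L) m _ = λ _ _ → false

len : ℕ → ℕ → ℕ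
len zero m = m + 4
len (suc L) m = suc (suc (len L m))

len-suc : ∀ L m → len L (suc m) ≡ suc (len L m)
len-suc zero m = refl
len-suc (suc L) m = cong (λ k → suc (suc k)) (len-suc L m)

-- `o-in` and `o-out` place `o m` on the boundary of the star of the current edge, hence in the link
-- of the vertex added next, so that the next edge exists.
record Adm (o : Seq) : Set where
  field
    o-card : ∀ m → 1 ≤ card (o m (m + 4))
    o-in   : ∀ m → T (Δ o 0 m (m + 4) (o m (m + 4) ∪ face o m (m + 4)))
    o-out  : ∀ m → ¬ (face o m (m + 4) ⊑ o m (m + 4))

ok-clash : ∀ {n} {f z : Vec Q n} → f ⊑ z → neg' f ⊑ z → T (okv z) → card f ≡ 0
ok-clash [] [] _ = refl
ok-clash {f = O ∷ f} (_ ∷ l) (_ ∷ m) k = ok-clash l m (∧-r {okq _} k)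
ok-clash {f = P ∷ f} {X ∷ z} (PX ∷ l) (MX ∷ m) ()
ok-clash {f = M ∷ f} {X ∷ z} (MX ∷ l) (PX ∷ m) ()
ok-clash {f = X ∷ f} {X ∷ z} (XX ∷ l) (XX ∷ m) ()

module _ {n} {D : Pred n} {f : Vec Q n} (D-ok : ∀ {x} → T (D x) → T (okv x)) (D-cl : Closed D)
         (D-sym : ∀ {x} → T (D x) → T (D (neg' x))) (fD : T (D f)) (f2 : 2 ≤ card f) where
  private
    s = starS D f
    ∪∅ : (x : Vec Q n) → x ∪ ∅ ≡ x
    ∪∅ x = ⊑→∪ ∅⊑

    I→B : ∀ {x} → T (D x ∧ sub f x) → T (D (x ∪ f))
    I→B {x} t = subst (T ∘ D) (sym (⊑→∪ (sub→ {x = f} (∧-r {D x} t)))) (∧-l t)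

    disj : Disj00 s
    disj x b i = ℕₚ.n≮n 1 (≤-trans f2 (≤-trans (≤-reflexive
      (ok-clash {f = f} {x ∪ f} ⊑∪r (⊑-trans (neg-mono⁻ (sub→ {x = f} (∧-r {D (neg' x)} i))) ⊑∪l) (D-ok b))) z≤n))

    op : ∀ {x y} → x ⊑ y → T (D y) → T (D x ∧ sub f x) → T (D y ∧ sub f y)
    op {x} l d t = ∧-i d (→sub (⊑-trans (sub→ {x = f} (∧-r {D x} t)) l))

  star-amb : Amb (Both D) (B s) (I s)
  star-amb = record
    { D-ok = λ _ → D-ok ; D-cl = λ _ → D-cl
    ; N⊂D = λ { zero t → D-cl ⊑∪l t ; (suc e) () }
    ; J⊂N = λ { zero t → I→B t ; (suc e) () }
    ; J-op = λ { zero → op ; (suc e) l d () }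
    ; N-dec = λ { zero () ; (suc e) () } ; J-dec = λ { zero () ; (suc e) () } }

  star-ok : OkU (Both D) (B s) (I s) s
  star-ok = record
    { B-cl = λ { zero l t → D-cl (∪-mono l ⊑-refl) t ; (suc e) l () }
    ; I-op = λ { zero → op ; (suc e) l d () }
    ; I⊂B = λ { zero t → I→B t ; (suc e) () }
    ; B⊂N = λ e t → t ; I⊂J = λ e t → t
    ; B-dec = λ { zero () ; (suc e) () } ; I-dec = λ { zero () ; (suc e) () }
    ; D0 = λ { zero b () ; (suc e) () } } , disj

  star-lvl : Lvl D (B s) (I s) s
  star-lvl = record
    { am = star-amb ; D-sym = D-sym ; ok = star-ok
    ; cov = λ { zero t → inj₁ (I→B t) ; (suc e) () }
    ; path = grow star-ok el f2 done
    ; d∅ = D-cl ∅⊑ fD }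
    where
    el : El (Both D) emptyS s 0 f ∅
    el = record
      { add = record
        { dis = ⊥v-∅
        ; dAC = subst (T ∘ D) (sym (∪∅ f)) fD
        ; a1 = λ _ ()
        ; a2 = λ {x} _ d _ → subst (T ∘ D) (sym (∪∅ x)) d , inj₁ ∅⊑
        ; B'→ = λ b → inj₂ (∅⊑ , b)
        ; B≤ = λ ()
        ; B'C = λ _ d → d
        ; I'→ = λ {x} i → inj₂ (sub→ (∧-r {D x} i))
        ; I≤ = λ ()
        ; I'A = λ a d → ∧-i d (→sub a) }
      ; oB = λ { zero q _ → ⊥-elim (q refl) ; (suc e) q x → refl }
      ; oI = λ { zero q _ → ⊥-elim (q refl) ; (suc e) q x → refl } }

  -- The next edge contains the new vertex, so its star is the cone from that vertex over the star
  -- of `o` in the link. As the terms of positive index are empty, nothing lies over the antipode.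
  star-tim : (o : Vec Q n) → Tim s (I s) (B (starS (cone D s s) (P ∷ o))) (I (starS (cone D s s) (P ∷ o)))
  star-tim o = record
    { ZN = zn ; ZJ = zj
    ; dyn = record
      { ZN-dec = λ { zero () ; (suc e) () } ; ZJ-dec = λ { zero () ; (suc e) () }
      ; ZJ⊂ZN = λ { zero {x} t → subst (λ y → T (cone D s s (P ∷ y))) (sym (⊑→∪ (sub→ {x = o} {x} (∧-l t)))) (∧-r {sub o x} t) ; (suc e) () }
      ; G = λ { zero {x} t → D-cl (∪-mono ⊑∪l ⊑-refl) (∧-l t)
                           , (λ i → ¬-e (∧-r {D ((x ∪ o) ∪ f)} t) (op {x} {x ∪ o} ⊑∪l (D-cl ⊑∪l (∧-l t)) i)) ; (suc e) () }
      ; G′ = λ _ ()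
      ; K = λ _ ()
      ; Pa = λ { {zero} {zero} {zero} {x} a b l bb ii t → ∧-i (→sub (⊑-trans (sub→ {x = o} (∧-l t)) l)) (∧-i bb (¬-i ii))
               ; {q = suc q} {zero} a () ; {p = suc p} a b l bb ii () }
      ; Pb = λ { {p = zero} a () ; {p = suc p} a b l bb ii () } }
    ; n→ = λ { zero {O ∷ x} t → t ; zero {P ∷ x} t → t ; zero {M ∷ x} () ; zero {X ∷ x} () ; (suc e) () }
    ; n← = λ { zero {O ∷ x} t → t ; zero {P ∷ x} t → t ; (suc e) {v ∷ x} t → subst T (selB-ff (par (suc e)) v) t }
    ; j→ = λ { zero {P ∷ x} t → ∧-i (∧-r {cone D s s (P ∷ x)} t) (∧-l t)
             ; zero {O ∷ x} t → ∧-r {cone D s s (O ∷ x)} t ; zero {M ∷ x} t → ∧-r {cone D s s (M ∷ x)} t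
             ; (suc e) () }
    ; j← = λ { zero {P ∷ x} t → ∧-i (∧-r {sub o x} t) (∧-l t)
             ; (suc e) {v ∷ x} t → subst T (selI-ff (par (suc e)) v) t } }
    where
    zn zj : Fam n
    zn zero x = cone D s s (P ∷ (x ∪ o))
    zn (suc e) x = false
    zj zero x = sub o x ∧ cone D s s (P ∷ x)
    zj (suc e) x = false

-- Sizes of faces and neighborliness.

record Sized {n} (r i : ℕ) (s : St n) : Set where
  field
    Bs : ∀ e {x} → T (okv x) → card x + e ≤ r → T (B s e x)
    Is : ∀ e {x} → T (I s e x) → i + e ≤ card x

step-sized : ∀ {n r i} {s : St n} → Sized r i s → Sized r (suc i) (stepS s)
step-sized {r = r} {i} {s} z = record
  { Bs = λ { e {v ∷ x} k l → b (par e) v e x (∧-l k) (∧-r {okq v} k) l }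
  ; Is = λ { e {v ∷ x} t → c (par e) v e x t } }
  where
  open Sized z
  b : ∀ p v e x → T (okq v) → T (okv x) → cardq v + card x + e ≤ r → T (selB p v (B s e x) (B s (suc e) x))
  lo : ∀ e x → suc (card x + e) ≤ r → card x + suc e ≤ r
  lo e x l = subst (_≤ r) (sym (ℕₚ.+-suc (card x) e)) l
  b p O e x _ k l = Bs e k l
  b true P e x _ k l = Bs e k (≤-trans (ℕₚ.n≤1+n _) l)
  b true M e x _ k l = Bs (suc e) k (lo e x l)
  b false P e x _ k l = Bs (suc e) k (lo e x l)
  b false M e x _ k l = Bs e k (≤-trans (ℕₚ.n≤1+n _) l)
  up : ∀ e x → T (I s (suc e) x) → suc (i + e) ≤ card x
  up e x t = subst (_≤ card x) (ℕₚ.+-suc i e) (Is (suc e) t)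
  c : ∀ p v e x → T (selI p v (I s e x) (I s (suc e) x)) → suc (i + e) ≤ cardq v + card x
  c p O e x t = up e x t
  c true P e x t = s≤s (Is e t)
  c true M e x t = ≤-trans (up e x t) (ℕₚ.n≤1+n _)
  c false P e x t = ≤-trans (up e x t) (ℕₚ.n≤1+n _)
  c false M e x t = s≤s (Is e t)
  c _ X e x ()

-- The complement contains every face too small to be interior, and its interior faces are those too
-- large to be guaranteed in the ball. This turns the bounds r, r + 2 into r + 1, r + 1, and two
-- suspensions make them r + 1, r + 3.
ext-sized : ∀ {n r} {D : Pred n} {s : St n} → (∀ {x} → T (D x) → T (okv x)) →
            (∀ {x} → T (okv x) → card x ≤ suc r → T (D x)) → Sized r (suc (suc r)) s → Sized (suc r) (suc r) (extS D s)
ext-sized {r = r} {D} {s} dk dn z = record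
  { Bs = λ { zero {x} k l → let l′ = subst (_≤ suc r) (ℕₚ.+-identityʳ (card x)) l in
               ∧-i (dn k l′) (¬-i (λ i → ℕₚ.n≮n (suc r) (≤-trans (s≤s (ℕₚ.m≤m+n (suc r) 0)) (≤-trans (Is 0 i) l′))))
           ; (suc e) {x} k l → Bs e (subst T (sym (okv-neg x)) k)
               (ℕₚ.≤-pred (subst (_≤ suc r) (trans (cong (_+ suc e) (sym (card-neg x))) (ℕₚ.+-suc (card (neg' x)) e)) l)) }
  ; Is = λ { zero {x} t → [ (λ l → ⊥-elim (¬-e (∧-r {D x} t) (Bs 0 (dk (∧-l t)) (subst (_≤ r) (sym (ℕₚ.+-identityʳ (card x))) (ℕₚ.≤-pred l)))))
                          , (λ l → subst (_≤ card x) (sym (ℕₚ.+-identityʳ (suc r))) l) ]′ (ℕₚ.<-≤-connex (card x) (suc r))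
           ; (suc e) {x} t → subst₂′ (Is e t) (sym (cong suc (ℕₚ.+-suc r e))) (card-neg x) } }
  where
  open Sized z
  subst₂′ : ∀ {a b c d} → a ≤ b → a ≡ c → b ≡ d → c ≤ d
  subst₂′ l refl refl = l

module _ {o : Seq} (adm : Adm o) where
  open Adm adm

  private
    face-card : ∀ m n → n ≡ len 0 m → 2 ≤ card (face o m n)
    face-card zero .4 refl = s≤s (s≤s z≤n)
    face-card (suc m) .(suc (m + 4)) refl = s≤s (o-card m)

    ok-sym : ∀ {n} {x : Vec Q n} → T (okv x) → T (okv (neg' x))
    ok-sym {x = x} = subst T (sym (okv-neg x))

    fD : ∀ m → T (Δ o 0 m (m + 4) (face o m (m + 4)))
    fD zero = tt
    fD (suc m) = ∧-i (o-in m) (¬-i (λ t → o-out m (sub→ (∧-r {Δ o 0 m (m + 4) (o m (m + 4))} t))))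

    ok-∅ : ∀ n → T (okv (∅ {n}))
    ok-∅ zero = tt
    ok-∅ (suc n) = ok-∅ n

    -- at time 0 the complexes are cross-polytopes, in which every set without antipodes is a face
    cross-amb : ∀ {n} {N J : Fam n} → Amb (Both okv) N J → Amb (Both okv) (stepB N) (stepI J)
    cross-amb {n} {N} {J} a = record
      { D-ok = λ _ t → t ; D-cl = λ _ → okv-down
      ; N⊂D = λ { e {v ∷ x} t → ∧-i (selB-ok (par e) v t) ([ A.N⊂D e , A.N⊂D (suc e) ]′ (selB-any (par e) v t)) }
      ; J⊂N = step-J⊂N A.J⊂N A.N-dec
      ; J-op = λ { e {u ∷ x} {v ∷ y} (p ∷ l) k j → up (par e) p (∧-l k) (A.J-op e l (∧-r {okq v} k))
                     (λ r → A.J-op e l (∧-r {okq v} k) (A.J-dec e r)) (A.J-op (suc e) l (∧-r {okq v} k)) j }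
      ; N-dec = step-N-dec A.N-dec ; J-dec = step-J-dec A.J-dec }
      where
      module A = Amb a
      up : ∀ p {u v a b a′ b′} → u ≤q v → T (okq v) → (T a → T a′) → (T b → T a′) → (T b → T b′) →
           T (selI p u a b) → T (selI p v a′ b′)
      up true {v = O} O≤ k f g h = h
      up true {v = P} O≤ k f g h = g
      up true {v = M} O≤ k f g h = h
      up false {v = O} O≤ k f g h = h
      up false {v = P} O≤ k f g h = h
      up false {v = M} O≤ k f g h = g
      up true PP k f g h = f
      up false PP k f g h = h
      up true MM k f g h = h
      up false MM k f g h = f

  mutual
    -- A level at time m + 1 rests on the same level at time m and on the level below at time m + 1.
    -- Neighborliness of the lower sphere gives the sizes one level up, and these keep the empty set
    -- out of the interiors.
    lvl : ∀ L m n → n ≡ len L m → Lvl (Δ o L m n) (NN o L m n) (JJ o L m n) (U o L m n)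
    lvl zero zero .4 refl = star-lvl (λ t → t) okv-down (λ {x} → ok-sym {x = x}) tt (s≤s (s≤s z≤n))
    lvl zero (suc m) .(suc (m + 4)) refl =
      star-lvl (λ {x} → cone-ok (lvl zero m _ refl) {x}) (λ {x} {y} → cone-closed (lvl zero m _ refl) {x} {y})
        (λ {x} → cone-sym (lvl zero m _ refl) {x}) (fD (suc m)) (face-card (suc m) _ refl)
    lvl (suc L) zero .(suc (suc (len L zero))) refl =
      up-lvl (lvl L zero _ refl) (cross-amb {N = stepB (extN okv (NN o L 0 (len L 0)))} {stepI (extN okv (JJ o L 0 (len L 0)))}
        (cross-amb {N = extN okv (NN o L 0 (len L 0))} {extN okv (JJ o L 0 (len L 0))}
          (ext-amb (Lvl.am (lvl L zero _ refl)) (λ {x} → Lvl.D-sym (lvl L zero _ refl) {x}))))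
        (λ {x} → ok-sym {x = x}) (ok-∅ (suc (suc (len L 0))))
    lvl (suc L) (suc m) n q = go n (trans q (len-suc (suc L) m))
      where
      go : ∀ n → n ≡ suc (suc (suc (len L m))) → Lvl (Δ o (suc L) (suc m) n) (NN o (suc L) (suc m) n) (JJ o (suc L) (suc m) n) (U o (suc L) (suc m) n)
      go ._ refl = up-lvl (lvl L (suc m) _ (sym (len-suc L m))) (time-amb (lvl (suc L) m _ refl) (tim (suc L) m _ refl))
        (λ {x} → cone-sym (lvl (suc L) m _ refl) {x}) (cone-∅ (lvl (suc L) m _ refl) (λ t → no-∅ {n = suc (suc (len L m))} (Sized.Is (sized (suc L) m _ refl) 0 {∅} t)))

    no-∅ : ∀ {a n} → ¬ (suc a ≤ card (∅ {n}))
    no-∅ {n = n} l with subst (_ ≤_) (card-∅ {n}) l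
    ... | ()

    tim : ∀ L m n → n ≡ len L m → Tim (U o L m n) (JJ o L m n) (NN o L (suc m) (suc n)) (JJ o L (suc m) (suc n))
    tim zero zero .4 refl = star-tim (λ t → t) okv-down (λ {x} → ok-sym {x = x}) tt (s≤s (s≤s z≤n)) (o zero 4)
    tim zero (suc m) .(suc (m + 4)) refl =
      star-tim (λ {x} → cone-ok (lvl zero m _ refl) {x}) (λ {x} {y} → cone-closed (lvl zero m _ refl) {x} {y})
        (λ {x} → cone-sym (lvl zero m _ refl) {x})
        (fD (suc m)) (face-card (suc m) _ refl) (o (suc m) _)
    tim (suc L) m .(suc (suc (len L m))) refl = up-tim (lvl L m _ refl) (tim L m _ refl)

    sized : ∀ L m n → n ≡ len L m → Sized L (suc (suc L)) (U o L m n)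
    sized zero m .(m + 4) refl = record
      { Bs = λ { zero {x} k l → subst (T ∘ Δ o 0 m (m + 4)) (∅∪ x l) (fD m)
               ; (suc e) {x} k l → ⊥-elim (ℕₚ.n≮n 0 (≤-trans (s≤s z≤n) (subst (_≤ 0) (ℕₚ.+-suc (card x) e) l))) }
      ; Is = λ { zero {x} t → ≤-trans (face-card m _ refl) (card-mono (sub→ {x = face o m (m + 4)} {x} (∧-r {Δ o 0 m (m + 4) x} t))) ; (suc e) () } }
      where
      ∅∪ : ∀ x → card x + 0 ≤ 0 → face o m (m + 4) ≡ x ∪ face o m (m + 4)
      ∅∪ x l = trans (sym (⊑→∪ {x = x} (subst (_⊑ face o m (m + 4)) (sym (card0 x (ℕₚ.n≤0⇒n≡0 (subst (_≤ 0) (ℕₚ.+-identityʳ (card x)) l)))) ∅⊑)))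
                     (∪-comm (face o m (m + 4)) x)
    sized (suc L) m .(suc (suc (len L m))) refl =
      step-sized (step-sized (ext-sized (Amb.D-ok (Lvl.am (lvl L m _ refl)) true) (nbly L m _ refl) (sized L m _ refl)))

    -- Beside the new vertex there are at most L others: few enough to span a face of B₀ and too few
    -- for an interior face, so they lie on ∂B₀.
    nbly : ∀ L m n → n ≡ len L m → ∀ {x} → T (okv x) → card x ≤ suc L → T (Δ o L m n x)
    nbly L zero n q k l = k
    nbly L (suc m) zero q k l with trans q (len-suc L m)
    ... | ()
    nbly L (suc m) (suc n) q {v ∷ x} k l = go v (ℕₚ.suc-injective (trans q (len-suc L m))) k l
      where
      go : ∀ v → n ≡ len L m → T (okq v ∧ okv x) → cardq v + card x ≤ suc L → T (Δ o L (suc m) (suc n) (v ∷ x))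
      go v r k l = h v k l
        where
        module Z = Sized (sized L m n r)
        nI : ∀ {y} → card y ≤ suc L → ¬ T (I (U o L m n) 0 y)
        nI {y} c t = ℕₚ.n≮n (suc L) (≤-trans (subst (_≤ card y) (ℕₚ.+-identityʳ (suc (suc L))) (Z.Is 0 {y} t)) c)
        bB : ∀ {y} → T (okv y) → card y ≤ L → T (B (U o L m n) 0 y)
        bB {y} k c = Z.Bs 0 k (subst (_≤ L) (sym (ℕₚ.+-identityʳ (card y))) c)
        cn : ∀ {k} → card x ≤ k → card (neg' x) ≤ k
        cn {k} = subst (_≤ k) (sym (card-neg x))
        h : ∀ v → T (okq v ∧ okv x) → cardq v + card x ≤ suc L → T (Δ o L (suc m) (suc n) (v ∷ x))
        h O k c = ∧-i (nbly L m n r k c) (∧-i (¬-i (nI c)) (¬-i (nI (cn c))))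
        h P k (s≤s c) = ∧-i (bB k c) (¬-i (nI (≤-trans c (ℕₚ.n≤1+n L))))
        h M k (s≤s c) = ∧-i (bB (ok-sym {x = x} k) (cn c)) (¬-i (nI (cn (≤-trans c (ℕₚ.n≤1+n L)))))

-- Cross-polytopes are combinatorial spheres.

-- The simplex on +1, …, +n, -n, and its boundary.
simp bsimp : ∀ {n} → Pred n
simp [] = false
simp (q ∷ []) = true
simp (O ∷ y ∷ x) = simp (y ∷ x)
simp (P ∷ y ∷ x) = simp (y ∷ x)
simp (M ∷ y ∷ x) = false
simp (X ∷ y ∷ x) = false
bsimp [] = false
bsimp (q ∷ []) = okq q
bsimp (O ∷ y ∷ x) = simp (y ∷ x)
bsimp (P ∷ y ∷ x) = bsimp (y ∷ x)
bsimp (M ∷ y ∷ x) = false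
bsimp (X ∷ y ∷ x) = false

top : ∀ n → Vec Q n
top zero = []
top (suc zero) = X ∷ []
top (suc (suc n)) = P ∷ top (suc n)

simp→ : ∀ {n} {x : Vec Q n} → T (simp x) → x ⊑ top n
simp→ {x = O ∷ []} _ = O≤ ∷ []
simp→ {x = P ∷ []} _ = PX ∷ []
simp→ {x = M ∷ []} _ = MX ∷ []
simp→ {x = X ∷ []} _ = XX ∷ []
simp→ {x = O ∷ y ∷ x} t = O≤ ∷ simp→ {x = y ∷ x} t
simp→ {x = P ∷ y ∷ x} t = PP ∷ simp→ {x = y ∷ x} t

→simp : ∀ {n} {x : Vec Q (suc n)} → x ⊑ top (suc n) → T (simp x)
→simp {zero} {q ∷ []} _ = tt
→simp {suc n} {O ∷ y ∷ x} (_ ∷ l) = →simp l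
→simp {suc n} {P ∷ y ∷ x} (_ ∷ l) = →simp l

bsimp→ : ∀ {n} {x : Vec Q n} → T (bsimp x) → T (simp x) × ¬ (top n ⊑ x)
bsimp→ {x = O ∷ []} t = tt , (λ { (() ∷ _) })
bsimp→ {x = P ∷ []} t = tt , (λ { (() ∷ _) })
bsimp→ {x = M ∷ []} t = tt , (λ { (() ∷ _) })
bsimp→ {x = O ∷ y ∷ x} t = t , (λ { (() ∷ _) })
bsimp→ {x = P ∷ y ∷ x} t = tail (bsimp→ {x = y ∷ x} t)
  where
  tail : ∀ {m} {z : Vec Q (suc m)} → T (simp z) × ¬ (top (suc m) ⊑ z) → T (simp z) × ¬ (P ∷ top (suc m) ⊑ P ∷ z)
  tail (a , f) = a , (λ { (_ ∷ l) → f l })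

→bsimp : ∀ {n} {x : Vec Q n} → T (simp x) → ¬ (top n ⊑ x) → T (bsimp x)
→bsimp {x = O ∷ []} t f = tt
→bsimp {x = P ∷ []} t f = tt
→bsimp {x = M ∷ []} t f = tt
→bsimp {x = X ∷ []} t f = ⊥-elim (f (XX ∷ []))
→bsimp {x = O ∷ y ∷ x} t f = t
→bsimp {x = P ∷ y ∷ x} t f = →bsimp {x = y ∷ x} t (λ l → f (PP ∷ l))

-- The join of a cross-polytope on the first j pairs with the boundary of the simplex on the others.
mixed : ∀ {n} → ℕ → Pred n
mixed zero x = bsimp x
mixed (suc j) [] = false
mixed (suc j) (q ∷ x) = okq q ∧ mixed j x

pole : ∀ {n} (j : ℕ) → suc (suc j) ≤ n → Vertex n
pole zero (s≤s l) = zero , false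
pole (suc j) (s≤s l) = upV (pole j l)

pole-A : ℕ → ∀ n → Vec Q n
pole-A j zero = []
pole-A zero (suc n) = O ∷ top n
pole-A (suc j) (suc n) = O ∷ pole-A j n

mixed-cl : ∀ {n} j → Closed (mixed {n} j)
mixed-cl {zero} zero [] ()
mixed-cl {suc n} zero {x} {y} l t = →bsimp {x = x} (→simp (⊑-trans l (simp→ {x = y} (proj₁ (bsimp→ {x = y} t)))))
  (λ m → proj₂ (bsimp→ {x = y} t) (⊑-trans m l))
mixed-cl (suc j) {q ∷ x} {r ∷ y} (p ∷ l) t = ∧-i (okq-down p (∧-l t)) (mixed-cl j l (∧-r {okq r} t))

ex-join : ∀ {n} {K K′ : Pred n} {A C} → Ex K K′ A C →
          Ex (λ { (q ∷ x) → okq q ∧ K x }) (λ { (q ∷ x) → okq q ∧ K′ x }) (O ∷ A) (O ∷ C)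
ex-join {K = K} {K′} {A} {C} e = record
  { e1 = λ { {q ∷ x} k f → let r = e1 (∧-r {okq q} k) (λ l → f (O≤ ∷ l)) in
             ∧-i (∧-l k) (proj₁ r) , (λ { (_ ∷ l) → proj₂ r l }) }
  ; e1′ = λ { {q ∷ x} k f → let r = e1′ (∧-r {okq q} k) (λ l → f (O≤ ∷ l)) in
             ∧-i (∧-l k) (proj₁ r) , (λ { (_ ∷ l) → proj₂ r l }) }
  ; e2 = λ { {q ∷ x} f k → let r = e2 (λ l → f (O≤ ∷ l)) (∧-r {okq (q ∪q O)} k) in
             (λ { (_ ∷ l) → proj₁ r l }) , ∧-i (∧-l k) (proj₂ r) }
  ; e2′ = λ { {q ∷ x} f k → let r = e2′ (λ l → f (O≤ ∷ l)) (∧-r {okq (q ∪q O)} k) in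
             (λ { (_ ∷ l) → proj₁ r l }) , ∧-i (∧-l k) (proj₂ r) }
  ; kA = kA ; kC = kC }
  where open Ex e

Ex-≗ : ∀ {n} {K K′ L L′ : Pred n} {A C} → (∀ x → L x ≡ K x) → (∀ x → L′ x ≡ K′ x) → Ex K K′ A C → Ex L L′ A C
Ex-≗ p q e = record
  { e1 = λ {x} k f → let r = e1 (subst T (p x) k) f in subst T (sym (q x)) (proj₁ r) , proj₂ r
  ; e1′ = λ {x} k f → let r = e1′ (subst T (q x) k) f in subst T (sym (p x)) (proj₁ r) , proj₂ r
  ; e2 = λ f k → let r = e2 f (subst T (p _) k) in proj₁ r , subst T (sym (q _)) (proj₂ r)
  ; e2′ = λ f k → let r = e2′ f (subst T (q _) k) in proj₁ r , subst T (sym (p _)) (proj₂ r)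
  ; kA = subst T (sym (p _)) kA ; kC = subst T (sym (q _)) kC }
  where open Ex e

-- For j = 0, subdividing the facet opposite to +1 introduces -1 and leaves the suspension of the
-- boundary of the simplex on the other vertices. For larger j the same is joined with the
-- cross-polytope in front.
mixed-ex : ∀ {n} j (l : suc (suc j) ≤ n) → Ex (mixed {n} j) (mixed (suc j)) (pole-A j n) (single (pole j l))
mixed-ex {suc (suc r)} zero (s≤s (s≤s l)) = record
  { e1 = λ { {O ∷ y ∷ x} k f → →bsimp {x = y ∷ x} k (λ m → f (O≤ ∷ m)) , (λ { (() ∷ _) })
           ; {P ∷ y ∷ x} k f → k , (λ { (() ∷ _) }) }
  ; e1′ = λ { {O ∷ y ∷ x} k f → proj₁ (bsimp→ {x = y ∷ x} k) , (λ { (_ ∷ m) → proj₂ (bsimp→ {x = y ∷ x} k) m })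
            ; {P ∷ y ∷ x} k f → k , (λ { (_ ∷ m) → proj₂ (bsimp→ {x = y ∷ x} k) m })
            ; {M ∷ y ∷ x} k f → ⊥-elim (f (MM ∷ ∅⊑)) }
  ; e2 = λ { {O ∷ y ∷ x} f k → (λ { (() ∷ _) })
               , subst (T ∘ bsimp) (sym (⊑→∪ {x = ∅} {y ∷ x} ∅⊑)) (→bsimp {x = y ∷ x}
                   (→simp (⊑-trans (⊑∪l {x = y ∷ x} {top (suc r)}) (simp→ {x = (y ∷ x) ∪ top (suc r)} (nz y x k)))) (λ m → f (O≤ ∷ m)))
           ; {P ∷ y ∷ x} f k → ⊥-elim (proj₂ (bsimp→ {x = (y ∷ x) ∪ top (suc r)} (nb y x k)) (⊑∪r {x = y ∷ x}))
           ; {M ∷ y ∷ x} f k → ⊥-elim (nm y x k) ; {X ∷ y ∷ x} f k → ⊥-elim (nx y x k) }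
  ; e2′ = λ { {O ∷ y ∷ x} f k → let b = subst (T ∘ bsimp) (⊑→∪ {x = ∅} {y ∷ x} ∅⊑) k in
                (λ { (_ ∷ m) → proj₂ (bsimp→ {x = y ∷ x} b) m })
                , zn y x (→simp (∪-lub (simp→ {x = y ∷ x} (proj₁ (bsimp→ {x = y ∷ x} b))) ⊑-refl))
            ; {M ∷ y ∷ x} f k → ⊥-elim (f (MM ∷ ∅⊑)) ; {X ∷ y ∷ x} f k → ⊥-elim (f (MX ∷ ∅⊑)) }
  ; kA = zA r
  ; kC = zC r }
  where
  nz : ∀ y x → T (bsimp (O ∷ ((y ∷ x) ∪ top (suc r)))) → T (simp ((y ∷ x) ∪ top (suc r)))
  nz y x k with (y ∷ x) ∪ top (suc r)
  ... | z ∷ zs = k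
  zn : ∀ y x → T (simp ((y ∷ x) ∪ top (suc r))) → T (bsimp (O ∷ ((y ∷ x) ∪ top (suc r))))
  zn y x k with (y ∷ x) ∪ top (suc r)
  ... | z ∷ zs = k
  nb : ∀ y x → T (bsimp (P ∷ ((y ∷ x) ∪ top (suc r)))) → T (bsimp ((y ∷ x) ∪ top (suc r)))
  nb y x k with (y ∷ x) ∪ top (suc r)
  ... | z ∷ zs = k
  nm : ∀ y x → ¬ T (bsimp (M ∷ ((y ∷ x) ∪ top (suc r))))
  nm y x k with (y ∷ x) ∪ top (suc r)
  nm y x () | z ∷ zs
  nx : ∀ y x → ¬ T (bsimp (X ∷ ((y ∷ x) ∪ top (suc r))))
  nx y x k with (y ∷ x) ∪ top (suc r)
  nx y x () | z ∷ zs
  zA : ∀ r → T (bsimp (O ∷ top (suc r)))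
  zA zero = tt
  zA (suc r) = →simp {suc r} {P ∷ top (suc r)} ⊑-refl
  zC : ∀ r → T (bsimp (∅ {suc r}))
  zC zero = tt
  zC (suc r) = →simp {r} ∅⊑
mixed-ex {suc n} (suc j) (s≤s l) = Ex-≗ (λ { (q ∷ x) → refl }) (λ { (q ∷ x) → refl }) (ex-join (mixed-ex j l))

pole-card : ∀ {n} j → suc (suc j) ≤ n → 2 ≤ card (pole-A j n)
pole-card {suc (suc r)} zero (s≤s (s≤s l)) = go r
  where
  go : ∀ r → 2 ≤ card (top (suc r))
  go zero = s≤s (s≤s z≤n)
  go (suc r) = ≤-trans (go r) (ℕₚ.n≤1+n _)
pole-card {suc n} (suc j) (s≤s l) = pole-card j l

pole-ghost : ∀ {n} j (l : suc (suc j) ≤ n) {x} → T (mixed {n} j x) → ¬ T (bit x (pole j l))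
pole-ghost zero (s≤s (s≤s l)) {O ∷ y ∷ x} k ()
pole-ghost zero (s≤s (s≤s l)) {P ∷ y ∷ x} k ()
pole-ghost (suc j) (s≤s l) {q ∷ x} k b = pole-ghost j l (∧-r {okq q} k) b

simplex-emb : ∀ r → Emb (suc (suc r)) (suc r)
simplex-emb zero = record { emb = e ; g = h ; p1 = q1 ; p2 = q2 ; size = sz }
  where
  two : Bool → Bool → Q
  two false false = O
  two true false = P
  two false true = M
  two true true = X
  e : Subset 2 → Vec Q 1
  e (a ∷ b ∷ []) = two a b ∷ []
  h : Fin 2 → Vertex 1
  h zero = zero , true
  h (suc zero) = zero , false
  q1 : ∀ σ j → bit (e σ) (h j) ≡ lookup σ j
  q1 (false ∷ false ∷ []) zero = refl
  q1 (false ∷ true ∷ []) zero = refl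
  q1 (true ∷ false ∷ []) zero = refl
  q1 (true ∷ true ∷ []) zero = refl
  q1 (false ∷ false ∷ []) (suc zero) = refl
  q1 (false ∷ true ∷ []) (suc zero) = refl
  q1 (true ∷ false ∷ []) (suc zero) = refl
  q1 (true ∷ true ∷ []) (suc zero) = refl
  q2 : ∀ σ v → T (bit (e σ) v) → Σ (Fin 2) λ j → h j ≡ v
  q2 σ (zero , true) t = zero , refl
  q2 σ (zero , false) t = suc zero , refl
  sz : ∀ σ → card (e σ) ≡ ∣ σ ∣
  sz (false ∷ false ∷ []) = refl
  sz (true ∷ false ∷ []) = refl
  sz (false ∷ true ∷ []) = refl
  sz (true ∷ true ∷ []) = refl
simplex-emb (suc r) = record { emb = e ; g = h ; p1 = q1 ; p2 = q2 ; size = sz }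
  where
  module S = Emb (simplex-emb r)
  e : Subset (suc (suc (suc r))) → Vec Q (suc (suc r))
  e (true ∷ σ) = P ∷ S.emb σ
  e (false ∷ σ) = O ∷ S.emb σ
  h : Fin (suc (suc (suc r))) → Vertex (suc (suc r))
  h zero = zero , true
  h (suc j) = upV (S.g j)
  q1 : ∀ σ j → bit (e σ) (h j) ≡ lookup σ j
  q1 (true ∷ σ) zero = refl
  q1 (false ∷ σ) zero = refl
  q1 (true ∷ σ) (suc j) = S.p1 σ j
  q1 (false ∷ σ) (suc j) = S.p1 σ j
  q2 : ∀ σ v → T (bit (e σ) v) → Σ (Fin (suc (suc (suc r)))) λ j → h j ≡ v
  q2 σ (zero , true) t = zero , refl
  q2 (true ∷ σ) (zero , false) ()
  q2 (false ∷ σ) (zero , false) ()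
  q2 (true ∷ σ) (suc i , b) t = suc (proj₁ (S.p2 σ (i , b) t)) , cong upV (proj₂ (S.p2 σ (i , b) t))
  q2 (false ∷ σ) (suc i , b) t = suc (proj₁ (S.p2 σ (i , b) t)) , cong upV (proj₂ (S.p2 σ (i , b) t))
  sz : ∀ σ → card (e σ) ≡ ∣ σ ∣
  sz (true ∷ σ) = cong suc (S.size σ)
  sz (false ∷ σ) = S.size σ

simp-cons : ∀ {n} (x : Vec Q (suc n)) → simp (O ∷ x) ≡ simp x × simp (P ∷ x) ≡ simp x × bsimp (O ∷ x) ≡ simp x × bsimp (P ∷ x) ≡ bsimp x
simp-cons (a ∷ x) = refl , refl , refl , refl

simp-emb : ∀ r σ → simp (Emb.emb (simplex-emb r) σ) ≡ true
simp-emb zero (a ∷ b ∷ []) = refl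
simp-emb (suc r) (true ∷ σ) = trans (proj₁ (proj₂ (simp-cons (Emb.emb (simplex-emb r) σ)))) (simp-emb r σ)
simp-emb (suc r) (false ∷ σ) = trans (proj₁ (simp-cons (Emb.emb (simplex-emb r) σ))) (simp-emb r σ)

bsimp-emb : ∀ r σ → bsimp (Emb.emb (simplex-emb r) σ) ≡ boundarySimplex (suc (suc r)) σ
bsimp-emb zero (false ∷ false ∷ []) = refl
bsimp-emb zero (true ∷ false ∷ []) = refl
bsimp-emb zero (false ∷ true ∷ []) = refl
bsimp-emb zero (true ∷ true ∷ []) = refl
bsimp-emb (suc r) (true ∷ σ) = trans (proj₂ (proj₂ (proj₂ (simp-cons (Emb.emb (simplex-emb r) σ))))) (bsimp-emb r σ)
bsimp-emb (suc r) (false ∷ σ) = trans (proj₁ (proj₂ (proj₂ (simp-cons (Emb.emb (simplex-emb r) σ))))) (simp-emb r σ)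

simplex-im : ∀ r {x} → T (simp x) → Σ (Subset (suc (suc r))) λ σ → Emb.emb (simplex-emb r) σ ≡ x
simplex-im zero {O ∷ []} t = false ∷ false ∷ [] , refl
simplex-im zero {P ∷ []} t = true ∷ false ∷ [] , refl
simplex-im zero {M ∷ []} t = false ∷ true ∷ [] , refl
simplex-im zero {X ∷ []} t = true ∷ true ∷ [] , refl
simplex-im (suc r) {O ∷ y ∷ x} t = let q = simplex-im r {y ∷ x} t in false ∷ proj₁ q , cong (O ∷_) (proj₂ q)
simplex-im (suc r) {P ∷ y ∷ x} t = let q = simplex-im r {y ∷ x} t in true ∷ proj₁ q , cong (P ∷_) (proj₂ q)

simplex-plg : ∀ r → PLG (suc (suc r)) (bsimp {suc r})
simplex-plg r = record
  { m = suc (suc r) ; E = simplex-emb r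
  ; im = λ {x} t → simplex-im r (proj₁ (bsimp→ {x = x} t))
  ; vert = λ j → →bsimp {x = e ⁅ j ⁆} (≡→T (simp-emb r ⁅ j ⁆))
      (λ l → ℕₚ.n≮n 1 (≤-trans (tc r) (≤-trans (card-mono l) (≤-reflexive (trans (Emb.size (simplex-emb r) ⁅ j ⁆) (Subₚ.∣⁅x⁆∣≡1 j))))))
  ; pl = PLEquiv.iso (iso-≗ (bsimp-emb r)) }
  where
  e = Emb.emb (simplex-emb r)
  tc : ∀ r → 2 ≤ card (top (suc r))
  tc zero = s≤s (s≤s z≤n)
  tc (suc r) = ≤-trans (tc r) (ℕₚ.n≤1+n _)

mixed-plg : ∀ j r → suc j ≤ suc r → PLG (suc (suc r)) (mixed {suc r} j)
mixed-plg zero r l = simplex-plg r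
mixed-plg (suc j) r l = plg-new (mixed-plg j r (ℕₚ.<⇒≤ l)) (mixed-cl j) (mixed-cl (suc j)) (mixed-ex j l) (pole-card j l)
  (pole j l) refl (λ {x} → pole-ghost j l {x})

-- On the last pair the simplex is the edge from +n to -n, whose boundary is already a
-- cross-polytope, so r subdivisions suffice for r + 1 pairs.
cross-plg : ∀ r → PLG (suc (suc r)) (okv {suc r})
cross-plg r = plg-≗ (eq r) (mixed-plg r r ≤-refl)
  where
  eq : ∀ r (x : Vec Q (suc r)) → okv x ≡ mixed r x
  eq zero (O ∷ []) = refl
  eq zero (P ∷ []) = refl
  eq zero (M ∷ []) = refl
  eq zero (X ∷ []) = refl
  eq (suc r) (q ∷ x) = cong (okq q ∧_) (eq r x)

Δ-plg : ∀ {o} → Adm o → ∀ L m n → n ≡ len L m → PLG (suc (len L 0)) (Δ o L m n)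
Δ-plg adm zero zero .4 refl = cross-plg 3
Δ-plg adm (suc L) zero n refl = cross-plg (suc (len L 0))
Δ-plg adm L (suc m) zero q with trans q (len-suc L m)
... | ()
Δ-plg {o} adm L (suc m) (suc n) q =
  new-pair (Lvl.am l) (λ {x} → Lvl.D-sym l {x}) empty-ok (Lvl.path l) (Δ-plg adm L m n r)
  where
  r = ℕₚ.suc-injective (trans q (len-suc L m))
  l = lvl adm L m n r

-- Translation to complexes on the vertex set of the theorem.

two : Bool → Bool → Q
two false false = O
two true false = P
two false true = M
two true true = X

vtx : ∀ n → Fin (n + n) → Vertex n
vtx n v = [ (λ i → i , true) , (λ i → i , false) ]′ (splitAt n v)

idx : ∀ n → Vertex n → Fin (n + n)
idx n (i , true) = i ↑ˡ n
idx n (i , false) = n ↑ʳ i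

vtx-idx : ∀ n v → vtx n (idx n v) ≡ v
vtx-idx n (i , true) = cong [ (λ i → i , true) , (λ i → i , false) ]′ (Finₚ.splitAt-↑ˡ n i n)
vtx-idx n (i , false) = cong [ (λ i → i , true) , (λ i → i , false) ]′ (Finₚ.splitAt-↑ʳ n n i)

idx-vtx : ∀ n v → idx n (vtx n v) ≡ v
idx-vtx n v with splitAt n v in q
... | inj₁ i = Finₚ.splitAt⁻¹-↑ˡ q
... | inj₂ i = Finₚ.splitAt⁻¹-↑ʳ q

flip : ∀ {n} → Vertex n → Vertex n
flip (i , s) = i , not s

vtx-neg : ∀ n v → vtx n (neg n v) ≡ flip (vtx n v)
vtx-neg n v with splitAt n v
... | inj₁ i = vtx-idx n (i , false)
... | inj₂ i = vtx-idx n (i , true)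

signed : ∀ n → Subset (n + n) → Vec Q n
signed n σ = tabulate (λ i → two (lookup σ (i ↑ˡ n)) (lookup σ (n ↑ʳ i)))

bit-two : ∀ s a b → leq (sgn s) (two a b) ≡ (if s then a else b)
bit-two true false false = refl
bit-two true true false = refl
bit-two true false true = refl
bit-two true true true = refl
bit-two false false false = refl
bit-two false true false = refl
bit-two false false true = refl
bit-two false true true = refl

bit-signed : ∀ n σ v → bit (signed n σ) v ≡ lookup σ (idx n v)
bit-signed n σ (i , s) = trans (cong (leq (sgn s)) (Vecₚ.lookup∘tabulate (λ i → two (lookup σ (i ↑ˡ n)) (lookup σ (n ↑ʳ i))) i)) (h s)
  where
  h : ∀ s → leq (sgn s) (two (lookup σ (i ↑ˡ n)) (lookup σ (n ↑ʳ i))) ≡ lookup σ (idx n (i , s))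
  h true = bit-two true _ _
  h false = bit-two false _ _

bits≡ : ∀ {n} {x y : Vec Q n} → (∀ v → bit x v ≡ bit y v) → x ≡ y
bits≡ f = ⊑-antisym (bits⊑ (λ v → subst T (f v))) (bits⊑ (λ v → subst T (sym (f v))))

card-two : ∀ {n} (x y : Vec Bool n) → card (tabulate (λ i → two (lookup x i) (lookup y i))) ≡ ∣ x ∣ + ∣ y ∣
card-two [] [] = refl
card-two (false ∷ x) (false ∷ y) = card-two x y
card-two (true ∷ x) (false ∷ y) = cong suc (card-two x y)
card-two (false ∷ x) (true ∷ y) = trans (cong suc (card-two x y)) (sym (ℕₚ.+-suc ∣ x ∣ ∣ y ∣))
card-two (true ∷ x) (true ∷ y) = cong suc (trans (cong suc (card-two x y)) (sym (ℕₚ.+-suc ∣ x ∣ ∣ y ∣)))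

∣∣-++ : ∀ {m n} (x : Vec Bool m) (y : Vec Bool n) → ∣ x Data.Vec.++ y ∣ ≡ ∣ x ∣ + ∣ y ∣
∣∣-++ [] y = refl
∣∣-++ (true ∷ x) y = cong suc (∣∣-++ x y)
∣∣-++ (false ∷ x) y = ∣∣-++ x y

card-signed : ∀ n σ → card (signed n σ) ≡ ∣ σ ∣
card-signed n σ with Data.Vec.splitAt n σ
... | x , y , refl = trans (cong card (Vecₚ.tabulate-cong (λ i → cong₂ two (Vecₚ.lookup-++ˡ x y i) (Vecₚ.lookup-++ʳ x y i))))
                           (trans (card-two x y) (sym (∣∣-++ x y)))

okv-bits : ∀ {n} (x : Vec Q n) → (∀ v → T (bit x v) → ¬ T (bit x (flip v))) → T (okv x)
okv-bits [] f = tt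
okv-bits (O ∷ x) f = okv-bits x (λ { (i , s) → f (suc i , s) })
okv-bits (P ∷ x) f = okv-bits x (λ { (i , s) → f (suc i , s) })
okv-bits (M ∷ x) f = okv-bits x (λ { (i , s) → f (suc i , s) })
okv-bits (X ∷ x) f = f (zero , true) tt tt

bits-okv : ∀ {n} (x : Vec Q n) → T (okv x) → ∀ v → T (bit x v) → ¬ T (bit x (flip v))
bits-okv (O ∷ x) k (zero , true) () u
bits-okv (O ∷ x) k (zero , false) () u
bits-okv (P ∷ x) k (zero , true) t ()
bits-okv (P ∷ x) k (zero , false) () u
bits-okv (M ∷ x) k (zero , false) t ()
bits-okv (M ∷ x) k (zero , true) () u
bits-okv (a ∷ x) k (suc i , s) t u = bits-okv x (∧-r {okq a} k) (i , s) t u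

okv-single : ∀ {n} (v : Vertex n) → T (okv (single v))
okv-single v = okv-bits (single v) (λ w t u → h v w (bit-single⁻ v w t) (bit-single⁻ v (flip w) u))
  where
  h : ∀ {n} (v w : Vertex n) → w ≡ v → flip w ≡ v → ⊥
  h v (i , s) refl q = b≢not s (sym (cong proj₂ q))

toRaw : ∀ {n} → Pred n → RawComplex (n + n)
toRaw {n} K σ = K (signed n σ)

module _ {n} {K : Pred n} (cl : Closed K) (K-ok : ∀ {x} → T (K x) → T (okv x)) (K-sym : ∀ {x} → T (K x) → T (K (neg' x))) where

  signed-neg : ∀ σ → signed n (pull (neg n) σ) ≡ neg' (signed n σ)
  signed-neg σ = bits≡ (λ v → trans (bit-signed n (pull (neg n) σ) v)
    (trans (Vecₚ.lookup∘tabulate (λ j → lookup σ (neg n j)) (idx n v))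
      (trans (cong (lookup σ) (h v)) (sym (trans (neg-bit (signed n σ) v) (bit-signed n σ (flip v)))))))
    where
    h : ∀ v → neg n (idx n v) ≡ idx n (flip v)
    h v = trans (sym (idx-vtx n _)) (cong (idx n) (trans (vtx-neg n (idx n v)) (cong flip (vtx-idx n v))))

  raw-sym : CentSym n (toRaw K)
  raw-sym = (λ σ t → T→≡ (subst (T ∘ K) (sym (signed-neg σ)) (K-sym (≡→T t))))
          , (λ σ v p q → ¬T→≡ (λ t → bits-okv (signed n σ) (K-ok t) (vtx n v) (at σ v p) (subst (T ∘ bit (signed n σ)) (vtx-neg n v) (at σ (neg n v) q))))
    where
    at : ∀ σ v → v ∈ σ → T (bit (signed n σ) (vtx n v))
    at σ v p = subst T (sym (trans (bit-signed n σ (vtx n v)) (cong (lookup σ) (idx-vtx n v)))) (∈→lookup σ v p)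

  raw-nb : ∀ {r} → (∀ {x} → T (okv x) → card x ≤ r → T (K x)) → CSNeighborly n r (toRaw K)
  raw-nb {r} f σ l h = T→≡ (f (okv-bits (signed n σ) (λ v t u → h (idx n v) (on σ v t)
      (subst (_∈ σ) (trans (sym (idx-vtx n (idx n (flip v)))) (idx-neg v)) (on σ (flip v) u))))
    (subst (_≤ r) (sym (card-signed n σ)) l))
    where
    on : ∀ σ v → T (bit (signed n σ) v) → idx n v ∈ σ
    on σ v t = lookup→∈ σ (idx n v) (subst T (bit-signed n σ v) t)
    idx-neg : ∀ v → idx n (vtx n (idx n (flip v))) ≡ neg n (idx n v)
    idx-neg v = trans (cong (idx n) (trans (vtx-idx n (flip v)) (trans (cong flip (sym (vtx-idx n v))) (sym (vtx-neg n (idx n v))))))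
                      (idx-vtx n _)

  -- Since every vertex of Vₙ is a face, the vertices listed in `PLG` exhaust Vₙ, and the list is a
  -- bijection between the two ground sets.
  raw-sphere : (∀ v → T (K (single v))) → ∀ {d} → PLG (suc (suc d)) K → CombSphere d (toRaw K)
  raw-sphere sv G = cx , PLEquiv.trans (PLEquiv.iso raw-iso) pl
    where
    open PLG G
    cx : IsComplex (toRaw K)
    cx = (λ σ τ s t → T→≡ (cl (bits⊑ (λ v r → subst T (sym (bit-signed n σ v))
             (∈→lookup σ (idx n v) (s (lookup→∈ τ (idx n v) (subst T (bit-signed n τ v) r)))))) (≡→T t)))
       , (λ v → T→≡ (subst (T ∘ K) (sym (bits≡ (λ w → T-≡ (a v w) (b v w)))) (sv (vtx n v))))
      where
      a : ∀ v w → T (bit (signed n ⁅ v ⁆) w) → T (bit (single (vtx n v)) w)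
      a v w t = subst (T ∘ bit (single (vtx n v)))
        (trans (cong (vtx n) (sym (Subₚ.x∈⁅y⁆⇒x≡y v (lookup→∈ ⁅ v ⁆ (idx n w) (subst T (bit-signed n ⁅ v ⁆ w) t))))) (vtx-idx n w))
        (bit-single (vtx n v))
      b : ∀ v w → T (bit (single (vtx n v)) w) → T (bit (signed n ⁅ v ⁆) w)
      b v w t with bit-single⁻ (vtx n v) w t
      ... | refl = subst T (sym (trans (bit-signed n ⁅ v ⁆ (vtx n v)) (cong (lookup ⁅ v ⁆) (idx-vtx n v)))) (∈→lookup ⁅ v ⁆ v (Subₚ.x∈⁅x⁆ v))
    find : ∀ v → Σ (Fin m) λ j → g j ≡ v
    find v = let r = im (sv v) in p2 (proj₁ r) v (subst (λ x → T (bit x v)) (sym (proj₂ r)) (bit-single v))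
    g-inj : ∀ {j k} → g j ≡ g k → j ≡ k
    g-inj {j} {k} q = sym (Subₚ.x∈⁅y⁆⇒x≡y j (lookup→∈ ⁅ j ⁆ k (subst T (p1 ⁅ j ⁆ k)
      (subst (T ∘ bit (emb ⁅ j ⁆)) q (subst T (sym (p1 ⁅ j ⁆ j)) (∈→lookup ⁅ j ⁆ j (Subₚ.x∈⁅x⁆ j)))))))
    to : Fin (n + n) → Fin m
    to v = proj₁ (find (vtx n v))
    from : Fin m → Fin (n + n)
    from j = idx n (g j)
    raw-iso : Iso (toRaw K) (λ σ → K (emb σ))
    raw-iso = mk↔ₛ′ to from (λ j → g-inj (trans (proj₂ (find (vtx n (from j)))) (vtx-idx n (g j))))
                        (λ v → trans (cong (idx n) (proj₂ (find (vtx n v)))) (idx-vtx n v))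
        , (λ σ → cong K (bits≡ (λ v → h σ v (find v))))
      where
      h : ∀ σ v → Σ (Fin m) (λ j → g j ≡ v) → bit (signed n σ) v ≡ bit (emb (pull from σ)) v
      h σ v (j , refl) = trans (bit-signed n σ (g j)) (trans (sym (Vecₚ.lookup∘tabulate (λ i → lookup σ (from i)) j)) (sym (p1 (pull from σ) j)))

dim : ∀ L → len L 0 ≡ suc (suc L) + suc (suc L)
dim zero = refl
dim (suc L) = cong (λ k → suc (suc k)) (trans (dim L) (sym (cong suc (ℕₚ.+-suc L (suc (suc L)))) ))

Δ-sphere : ∀ {o} → Adm o → ∀ L m n → n ≡ len L m →
           CombSphere (2 * suc (suc L) ∸ 1) (toRaw (Δ o L m n)) × CentSym n (toRaw (Δ o L m n)) × CSNeighborly n (suc L) (toRaw (Δ o L m n))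
Δ-sphere {o} adm L m n q =
    raw-sphere (λ {x} {y} → Amb.D-cl A true {x} {y}) (λ {x} → Amb.D-ok A true {x}) (λ {x} → Lvl.D-sym l {x})
      (λ v → nb (okv-single v) (subst (_≤ suc L) (sym (single-card v)) (s≤s z≤n)))
      (subst (λ d → PLG d (Δ o L m n)) dm (Δ-plg adm L m n q))
  , raw-sym (λ {x} {y} → Amb.D-cl A true {x} {y}) (λ {x} → Amb.D-ok A true {x}) (λ {x} → Lvl.D-sym l {x})
  , raw-nb (λ {x} {y} → Amb.D-cl A true {x} {y}) (λ {x} → Amb.D-ok A true {x}) (λ {x} → Lvl.D-sym l {x}) nb
  where
  l = lvl adm L m n q
  A = Lvl.am l
  nb : ∀ {x} → T (okv x) → card x ≤ suc L → T (Δ o L m n x)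
  nb = nbly adm L m n q
  dm : suc (len L 0) ≡ suc (suc (2 * suc (suc L) ∸ 1))
  dm = cong suc (trans (dim L) (cong (λ k → suc (suc L) + k) (sym (ℕₚ.+-identityʳ (suc (suc L))))))

-- Octahedra and the choice of edges.

init : ∀ n → Fin 3 → Bool → Vec Q n
-- The starting edge joins the first two positive vertices. Its star is bounded by the octahedron
-- whose opposite vertices are the two ends of the edge and, twice, the vertices of one of the last
-- two pairs.
init (suc (suc (suc (suc n)))) zero true = P ∷ ∅
init (suc (suc (suc (suc n)))) zero false = O ∷ P ∷ ∅
init (suc (suc (suc (suc n)))) (suc zero) true = O ∷ O ∷ P ∷ ∅
init (suc (suc (suc (suc n)))) (suc zero) false = O ∷ O ∷ M ∷ ∅
init (suc (suc (suc (suc n)))) (suc (suc zero)) true = O ∷ O ∷ O ∷ P ∷ ∅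
init (suc (suc (suc (suc n)))) (suc (suc zero)) false = O ∷ O ∷ O ∷ M ∷ ∅
init _ _ _ = ∅

pick : ∀ {n} → Bool → Bool → Vec Q n → Vec Q n → Vec Q (suc n)
pick true true o x = P ∷ ∅
pick true false o x = O ∷ o
pick false _ o x = O ∷ x

eq3 : Fin 3 → Fin 3 → Bool
eq3 zero zero = true
eq3 (suc zero) (suc zero) = true
eq3 (suc (suc zero)) (suc (suc zero)) = true
eq3 _ _ = false

eq3-refl : ∀ i → eq3 i i ≡ true
eq3-refl zero = refl
eq3-refl (suc zero) = refl
eq3-refl (suc (suc zero)) = refl

eq3→ : ∀ i j → T (eq3 i j) → i ≡ j
eq3→ zero zero _ = refl
eq3→ (suc zero) (suc zero) _ = refl
eq3→ (suc (suc zero)) (suc (suc zero)) _ = refl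

-- The boundary of the star of an edge of a 3-sphere is an octahedron with antipodal vertices oct i true and oct i false.
-- The next edge joins the new vertex to oct (c m) true, and its octahedron has these two as antipodes in place of the pair c m.
oct : (ℕ → Fin 3) → ℕ → ∀ n → Fin 3 → Bool → Vec Q n
oct c zero n i b = init n i b
oct c (suc m) (suc n) i b = pick (eq3 (c m) i) b (oct c m n i true) (oct c m n i b)
oct c (suc m) zero i b = []

walk : (ℕ → Fin 3) → Seq
walk c m n = oct c m n (c m) true

⋃ : ∀ {n} → (Fin 3 → Vec Q n) → Vec Q n
⋃ f = f zero ∪ f (suc zero) ∪ f (suc (suc zero))

⊑⋃ : ∀ {n} (f : Fin 3 → Vec Q n) i → f i ⊑ ⋃ f
⊑⋃ f zero = ⊑∪l
⊑⋃ f (suc zero) = ⊑-trans ⊑∪l (⊑∪r {x = f zero})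
⊑⋃ f (suc (suc zero)) = ⊑-trans (⊑∪r {x = f (suc zero)}) (⊑∪r {x = f zero})

⋃-lub : ∀ {n} (f : Fin 3 → Vec Q n) {z} → (∀ i → f i ⊑ z) → ⋃ f ⊑ z
⋃-lub f h = ∪-lub (h zero) (∪-lub (h (suc zero)) (h (suc (suc zero))))

module _ (c : ℕ → Fin 3) where
  private
    o : Seq
    o = walk c
    D : ℕ → ∀ n → Pred n
    D = Δ o 0

  Oct : ℕ → ∀ n → Pred n
  Oct m n x = D (suc m) (suc n) (P ∷ x)

  -- `touch` gives the current edge a vertex labelled `false` in its octahedron. It later keeps the
  -- antipode of the new vertex away from the triangle of all vertices so labelled.
  record Stage (m : ℕ) : Set where
    field
      sD-ok  : ∀ {x} → T (D m (m + 4) x) → T (okv x)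
      sD-cl  : Closed (D m (m + 4))
      sD-sym : ∀ {x} → T (D m (m + 4) x) → T (D m (m + 4) (neg' x))
      sf     : T (D m (m + 4) (face o m (m + 4)))
      s2     : 2 ≤ card (face o m (m + 4))
      facet  : ∀ (b : Fin 3 → Bool) → T (Oct m (m + 4) (⋃ (λ i → oct c m (m + 4) i (b i))))
      apart  : ∀ i → ¬ T (Oct m (m + 4) (oct c m (m + 4) i true ∪ oct c m (m + 4) i false))
      one    : ∀ i b → card (oct c m (m + 4) i b) ≡ 1
      touch  : Σ (Fin 3) λ i → oct c m (m + 4) i false ⊑ face o m (m + 4)

  stage-lvl : ∀ {m} (S : Stage m) → Lvl (D m (m + 4)) (B (starS (D m (m + 4)) (face o m (m + 4)))) (I (starS (D m (m + 4)) (face o m (m + 4)))) (starS (D m (m + 4)) (face o m (m + 4)))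
  stage-lvl S = star-lvl (λ {x} → sD-ok {x}) (λ {x} {y} → sD-cl {x} {y}) (λ {x} → sD-sym {x}) sf s2
    where open Stage S

  oct-closed : ∀ {m} → Stage m → ∀ {x y} → x ⊑ y → T (Oct m (m + 4) y) → T (Oct m (m + 4) x)
  oct-closed S {x} {y} l = cone-closed (stage-lvl S) {P ∷ x} {P ∷ y} (PP ∷ l)

  private
    stage0 : Stage 0
    stage0 = record
      { sD-ok = λ t → t ; sD-cl = okv-down ; sD-sym = λ {x} → subst T (sym (okv-neg x)) ; sf = tt ; s2 = s≤s (s≤s z≤n)
      ; facet = λ b → f (b zero) (b (suc zero)) (b (suc (suc zero)))
      ; apart = λ { zero () ; (suc zero) () ; (suc (suc zero)) () }
      ; one = λ { zero true → refl ; zero false → refl ; (suc zero) true → refl ; (suc zero) false → refl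
                ; (suc (suc zero)) true → refl ; (suc (suc zero)) false → refl }
      ; touch = zero , O≤ ∷ PP ∷ O≤ ∷ O≤ ∷ [] }
      where
      f : ∀ a b d → T (Oct 0 4 (init 4 zero a ∪ init 4 (suc zero) b ∪ init 4 (suc (suc zero)) d))
      f true true true = tt
      f true true false = tt
      f true false true = tt
      f true false false = tt
      f false true true = tt
      f false true false = tt
      f false false true = tt
      f false false false = tt

    next : ∀ {m} → Stage m → Stage (suc m)
    next {m} S = record
      { sD-ok = λ {x} → cone-ok (stage-lvl S) {x} ; sD-cl = λ {x} {y} → cone-closed (stage-lvl S) {x} {y}
      ; sD-sym = λ {x} → cone-sym (stage-lvl S) {x} ; sf = inO ; s2 = s≤s (≤-reflexive (sym (one k true)))
      ; facet = fac ; apart = ap ; one = on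
      ; touch = k , subst (λ b → pick b false ok₁ ok₂ ⊑ P ∷ ok₁) (sym (eq3-refl k)) (O≤ ∷ ⊑-refl) }
      where
      open Stage S
      n = m + 4
      k = c m
      v : Fin 3 → Bool → Vec Q n
      v = oct c m n
      v′ : Fin 3 → Bool → Vec Q (suc n)
      v′ = oct c (suc m) (suc n)
      ok₁ = v k true
      ok₂ = v k false
      D′ = D (suc m) (suc n)
      cl : ∀ {x y} → x ⊑ y → T (Oct m n y) → T (Oct m n x)
      cl = oct-closed S
      inO : T (D′ (P ∷ ok₁))
      inO = cl (⊑⋃ (λ i → v i true) k) (facet (λ _ → true))
      lvl′ : Lvl D′ (B (starS D′ (P ∷ ok₁))) (I (starS D′ (P ∷ ok₁))) (starS D′ (P ∷ ok₁))
      lvl′ = star-lvl (λ {x} → cone-ok (stage-lvl S) {x}) (λ {x} {y} → cone-closed (stage-lvl S) {x} {y})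
               (λ {x} → cone-sym (stage-lvl S) {x}) inO (s≤s (≤-reflexive (sym (one k true))))
      cl′ : ∀ {x y} → x ⊑ y → T (Oct (suc m) (suc n) y) → T (Oct (suc m) (suc n) x)
      cl′ {x} {y} l = cone-closed lvl′ {P ∷ x} {P ∷ y} (PP ∷ l)
      fac : (b : Fin 3 → Bool) → T (Oct (suc m) (suc n) (⋃ (λ i → v′ i (b i))))
      fac b with b k in q
      -- The vertex from pair k is now the previous newest vertex. The other two span a face of its
      -- link together with `ok₁`, but do not contain `ok₁`: they lie in the star of the edge and
      -- not in its interior.
      ... | true = cl′ (⋃-lub _ up) (∧-i (cl (∪-lub (⋃-lub rest le) (subst (λ w → v k w ⊑ y) q (⊑⋃ (λ i → v i (b i)) k))) (facet b))
                     (¬-i (λ t → bad (sub→ {x = ok₁} (∧-r {D′ (P ∷ ⋃ rest)} t)))))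
        where
        y = ⋃ (λ i → v i (b i))
        y′ : Fin 3 → Vec Q n
        y′ i = if eq3 k i then v i false else v i (b i)
        rest : Fin 3 → Vec Q n
        rest i = if eq3 k i then ∅ else v i (b i)
        le : ∀ i → rest i ⊑ y
        le i with eq3 k i
        ... | true = ∅⊑
        ... | false = ⊑⋃ (λ i → v i (b i)) i
        up : ∀ i → v′ i (b i) ⊑ P ∷ ⋃ rest
        up i with eq3 k i in e | ⊑⋃ rest i
        ... | false | l = O≤ ∷ l
        ... | true | l with eq3→ k i (≡→T e)
        ... | refl = subst (λ w → pick true w (v k true) (v k w) ⊑ P ∷ ⋃ rest) (sym q) (PP ∷ ∅⊑)
        b′ : Fin 3 → Bool
        b′ i = if eq3 k i then false else b i
        vb : ∀ i → rest i ⊑ v i (b′ i)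
        vb i with eq3 k i
        ... | true = ∅⊑
        ... | false = ⊑-refl
        -- Turning pair k to `false` gives a triangle that contains `rest` and the vertex opposite
        -- to `ok₁`, so `ok₁` inside `rest` would contradict `apart`.
        bad : ¬ (ok₁ ⊑ ⋃ rest)
        bad l = apart k (cl (∪-lub (⊑-trans l (⋃-lub rest (λ i → ⊑-trans (vb i) (⊑⋃ (λ i → v i (b′ i)) i))))
                                   (subst (λ w → v k w ⊑ ⋃ (λ i → v i (b′ i))) (b′k) (⊑⋃ (λ i → v i (b′ i)) k))) (facet b′))
          where
          b′k : b′ k ≡ false
          b′k = cong (λ w → if w then false else b k) (eq3-refl k)
      ... | false = cl′ (⋃-lub _ up) (∧-i (cl (∪-lub ⊑-refl (subst (_⊑ y) (cong (v k) bk) (⊑⋃ (λ i → v i (b₁ i)) k))) (facet b₁))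
                     (¬-i (λ t → nP (sub→ {x = P ∷ ok₁} {O ∷ y} (∧-r {D′ (O ∷ y)} t)))))
        where
        b₁ : Fin 3 → Bool
        b₁ i = if eq3 k i then true else b i
        bk : b₁ k ≡ true
        bk = cong (λ w → if w then true else b k) (eq3-refl k)
        y = ⋃ (λ i → v i (b₁ i))
        nP : ¬ ((P ∷ ok₁) ⊑ (O ∷ y))
        nP (() ∷ _)
        up : ∀ i → v′ i (b i) ⊑ O ∷ y
        up i with eq3 k i in e | ⊑⋃ (λ i → v i (b₁ i)) i
        ... | false | l = O≤ ∷ l
        ... | true | l with eq3→ k i (≡→T e)
        ... | refl = subst (λ w → pick true w (v k true) (v k w) ⊑ O ∷ y) (sym q) (O≤ ∷ l)
      ap : ∀ i → ¬ T (Oct (suc m) (suc n) (v′ i true ∪ v′ i false))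
      ap i t with eq3 k i in e
      ... | false = apart i (cl ⊑∪l (∧-l t))
      ... | true with eq3→ k i (≡→T e)
      ... | refl = ¬-e (∧-r {D′ (P ∷ ((∅ ∪ ok₁) ∪ ok₁))} t)
                     (∧-i (cone-closed (stage-lvl S) {P ∷ (∅ ∪ ok₁)} {P ∷ ((∅ ∪ ok₁) ∪ ok₁)} (PP ∷ ⊑∪l) (∧-l t)) (→sub {x = ok₁} (⊑∪r {x = ∅})))
      on : ∀ i b → card (v′ i b) ≡ 1
      on i b with eq3 k i
      on i true | true = cong suc (card-∅ {n})
      on i false | true = one i true
      on i b | false = one i b

  stage : ∀ m → Stage m
  stage zero = stage0
  stage (suc m) = next (stage m)

  walk-adm : Adm (walk c)
  walk-adm = record
    { o-card = λ m → ≤-reflexive (sym (Stage.one (stage m) (c m) true))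
    ; o-in = λ m → ∧-l (on m)
    ; o-out = λ m l → ¬-e (∧-r {D m (m + 4) (o m (m + 4) ∪ face o m (m + 4))} (on m))
        (∧-i (Stage.sD-cl (stage m) (⊑∪l {y = face o m (m + 4)}) (∧-l (on m))) (→sub l)) }
    where
    on : ∀ m → T (Oct m (m + 4) (o m (m + 4)))
    on m = oct-closed (stage m) (⊑⋃ (λ i → oct c m (m + 4) i true) (c m)) (Stage.facet (stage m) (λ _ → true))

-- Faces that persist, and edges that vanish, in the 3-spheres.

dbl : ℕ → ℕ
dbl zero = zero
dbl (suc L) = suc (suc (dbl L))

len-dbl : ∀ L m → dbl L + (m + 4) ≡ len L m
len-dbl zero m = refl
len-dbl (suc L) m = cong (λ k → suc (suc k)) (len-dbl L m)

tops : ∀ L → Vec Q (dbl L)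
tops L = replicate (dbl L) P

infixr 5 _+++_
_+++_ : ∀ {m n} → Vec Q m → Vec Q n → Vec Q (m + n)
x +++ y = x Data.Vec.++ y

++-mono : ∀ {m n} {x x′ : Vec Q m} {y y′ : Vec Q n} → x ⊑ x′ → y ⊑ y′ → x +++ y ⊑ x′ +++ y′
++-mono [] q = q
++-mono (p ∷ l) q = p ∷ ++-mono l q

++-⊑ : ∀ {m n} {x : Vec Q m} {y : Vec Q n} {x′ y′} → x +++ y ⊑ x′ +++ y′ → x ⊑ x′ × y ⊑ y′
++-⊑ {x = []} {x′ = []} l = [] , l
++-⊑ {x = a ∷ x} {x′ = b ∷ x′} (p ∷ l) = let r = ++-⊑ {x = x} {x′ = x′} l in p ∷ proj₁ r , proj₂ r

split-pos : ∀ a {b} (i : Fin (a + b)) → (Σ (Fin a) λ k → i ≡ k ↑ˡ b) ⊎ (Σ (Fin b) λ k → i ≡ a ↑ʳ k)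
split-pos a {b} i with splitAt a i in q
... | inj₁ k = inj₁ (k , sym (Finₚ.splitAt⁻¹-↑ˡ q))
... | inj₂ k = inj₂ (k , sym (Finₚ.splitAt⁻¹-↑ʳ q))

bit-↑ˡ : ∀ {a b} (x : Vec Q a) (y : Vec Q b) i s → bit (x +++ y) (i ↑ˡ b , s) ≡ bit x (i , s)
bit-↑ˡ x y i s = cong (leq (sgn s)) (Vecₚ.lookup-++ˡ x y i)

bit-↑ʳ : ∀ {a b} (x : Vec Q a) (y : Vec Q b) i s → bit (x +++ y) (a ↑ʳ i , s) ≡ bit y (i , s)
bit-↑ʳ x y i s = cong (leq (sgn s)) (Vecₚ.lookup-++ʳ x y i)

tops-bit : ∀ n i s → T (bit (replicate n P) (i , s)) → s ≡ true
tops-bit (suc n) zero true t = refl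
tops-bit (suc n) zero false ()
tops-bit (suc n) (suc i) s t = tops-bit n i s t

module _ {o : Seq} (adm : Adm o) where
  -- Level by level the two newest positive vertices are removed; their link is the sphere one level
  -- down, where `J-op` at these two apices gives one inclusion and `N⊂D` the other.
  link : ∀ L m k → k ≡ m + 4 → ∀ {x} → T (Δ o L m (dbl L + k) (tops L +++ x)) → T (Δ o 0 m k x)
  link zero m k q t = t
  link (suc L) m k refl {x} t = link L m k refl (Amb.J-op (Lvl.am l) 0 {P ∷ P ∷ ∅} {P ∷ P ∷ (tops L +++ x)} (PP ∷ PP ∷ ∅⊑) t
      (Lvl.d∅ (lvl adm L m (dbl L + (m + 4)) (len-dbl L m))))
    where l = lvl adm (suc L) m (dbl (suc L) + (m + 4)) (len-dbl (suc L) m)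

  link⁻ : ∀ L m k → k ≡ m + 4 → ∀ {x} → T (Δ o 0 m k x) → T (Δ o L m (dbl L + k) (tops L +++ x))
  link⁻ zero m k q t = t
  link⁻ (suc L) m k refl {x} t = Amb.N⊂D (Lvl.am l) 0 {P ∷ P ∷ (tops L +++ x)} (link⁻ L m k refl t)
    where l = lvl adm (suc L) m (dbl (suc L) + (m + 4)) (len-dbl (suc L) m)

  Δ-cl : ∀ L m n → n ≡ len L m → Closed (Δ o L m n)
  Δ-cl L m n q {x} {y} = Amb.D-cl (Lvl.am (lvl adm L m n q)) true {x} {y}

  Δ-ok : ∀ L m n → n ≡ len L m → ∀ {x} → T (Δ o L m n x) → T (okv x)
  Δ-ok L m n q {x} = Amb.D-ok (Lvl.am (lvl adm L m n q)) true {x}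

  Δ-sym : ∀ L m n → n ≡ len L m → ∀ {x} → T (Δ o L m n x) → T (Δ o L m n (neg' x))
  Δ-sym L m n q {x} = Lvl.D-sym (lvl adm L m n q) {x}

later : ∀ r j → r + suc (j + 4) ≡ (r + suc j) + 4
later r j = sym (ℕₚ.+-assoc r (suc j) 4)

module _ (c : ℕ → Fin 3) where
  private
    o : Seq
    o = walk c
    adm = walk-adm c
    D : ℕ → ∀ n → Pred n
    D = Δ o 0

  anti : ∀ j → Vec Q (j + 4)
  anti j = ⋃ (λ i → oct c j (j + 4) i false)

  private
    -- The antipode of the vertex of time j is joined only to faces whose reflection spans a face
    -- with the edge of that time. The vertex common to this edge and the triangle (`touch`) would
    -- there meet its own antipode.
    new : ∀ j {q ρ} → T (D (suc j) (suc (j + 4)) (q ∷ ρ)) → anti j ⊑ ρ → q ≤q P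
    new j {O} d l = O≤
    new j {P} d l = PP
    new j {M} {ρ} d l with Stage.touch (stage c j)
    ... | i , t = ⊥-elim (ℕₚ.0≢1+n (trans (sym (ok-clash {f = w} {neg' ρ ∪ face o j (j + 4)} (⊑-trans t (⊑∪r {x = neg' ρ}))
                    (⊑-trans (neg-mono (⊑-trans (⊑⋃ (λ i → oct c j (j + 4) i false) i) l)) ⊑∪l)
                    (Stage.sD-ok (stage c j) (∧-l d)))) (Stage.one (stage c j) i false)))
      where w = oct c j (j + 4) i false

  -- No vertex added later than time j is joined to the triangle anti j, so that this triangle singles out the vertex of time j.
  lonely : ∀ j r (y : Vec Q r) {q ρ} → T (D (r + suc j) (r + suc (j + 4)) (y +++ q ∷ ρ)) → anti j ⊑ ρ → y ≡ ∅ × q ≤q P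
  lonely j zero [] d l = refl , new j d l
  lonely j (suc r) (O ∷ y) d l = let e = lonely j r y (∧-l d) l in cong (O ∷_) (proj₁ e) , proj₂ e
  lonely j (suc r) (P ∷ y) {q} {ρ} d l = ⊥-elim (go r y (∧-l d))
    where
    go : ∀ r (y : Vec Q r) → T (D (r + suc j) (r + suc (j + 4)) ((y +++ q ∷ ρ) ∪ face o (r + suc j) (r + suc (j + 4)))) → ⊥
    -- The edge in question starts at the vertex of time j and ends in `oct c j _ (c j) true`,
    -- whereas the triangle contains the vertex opposite to this end.
    go zero [] b = Stage.apart (stage c j) (c j) (oct-closed c (stage c j) (∪-lub ⊑∪r
      (⊑-trans (⊑-trans (⊑⋃ (λ i → oct c j (j + 4) i false) (c j)) l) ⊑∪l)) (Δ-cl adm 0 (suc j) _ refl {P ∷ (ρ ∪ o j (j + 4))} (⊑∪q ∷ ⊑-refl) b))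
      where
      ⊑∪q : P ≤q q ∪q P
      ⊑∪q = subst (P ≤q_) (∪q-comm P q) (≤q∪l P q)
    -- Otherwise the edge starts at a vertex that is itself later than time j, and the triangle is
    -- not joined to it by induction.
    go (suc r) (a ∷ y) b with lonely j (suc r) (P ∷ ∅) {O} {anti j}
      (Δ-cl adm 0 (suc r + suc j) _ (later (suc r) j) (subst (P ≤q_) (∪q-comm P a) (≤q∪l P a) ∷ ⊑-trans (++-mono {x = ∅} {y} ∅⊑ (O≤ {q} ∷ l)) ⊑∪l) b) ⊑-refl
    ... | () , _
  lonely j (suc r) (M ∷ y) {q} {ρ} d l = ⊥-elim (go r y (∧-l d))
    where
    go : ∀ r (y : Vec Q r) → T (D (r + suc j) (r + suc (j + 4)) (neg' (y +++ q ∷ ρ) ∪ face o (r + suc j) (r + suc (j + 4)))) → ⊥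
    go zero [] b with new j {M} {anti j} (Δ-cl adm 0 (suc j) _ refl {y = neg' ((negq q ∪q P) ∷ (neg' ρ ∪ o j (j + 4)))}
      (M≤ (negq q) ∷ subst (anti j ⊑_) (sym (neg-∪ (neg' ρ) _)) (⊑-trans l (subst (_⊑ neg' (neg' ρ) ∪ neg' (o j (j + 4))) (neg-inv ρ) ⊑∪l)))
      (Δ-sym adm 0 (suc j) _ refl {(negq q ∪q P) ∷ (neg' ρ ∪ o j (j + 4))} b)) ⊑-refl
      where
      M≤ : ∀ a → M ≤q negq (a ∪q P)
      M≤ a = negq-mono (subst (P ≤q_) (∪q-comm P a) (≤q∪l P a))
    ... | ()
    go (suc r) (a ∷ y) b with lonely j (suc r) (M ∷ ∅) {O} {anti j}
      (Δ-cl adm 0 (suc r + suc j) _ (later (suc r) j) (subst (M ∷ (∅ {r} +++ O ∷ anti j) ⊑_) (cong₂ _∷_ refl (sym (neg-∪ (neg' (y +++ q ∷ ρ)) f′)))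
          (M≤ (negq a) ∷ ⊑-trans (++-mono {x = ∅} {y} ∅⊑ (O≤ {q} ∷ l)) (subst (_⊑ neg' (neg' (y +++ q ∷ ρ)) ∪ neg' f′) (neg-inv (y +++ q ∷ ρ)) ⊑∪l)))
        (Δ-sym adm 0 (suc r + suc j) _ (later (suc r) j) {(negq a ∪q P) ∷ (neg' (y +++ q ∷ ρ) ∪ f′)} b)) ⊑-refl
      where
      f′ = o (r + suc j) (r + suc (j + 4))
      M≤ : ∀ a → M ≤q negq (a ∪q P)
      M≤ a = negq-mono (subst (P ≤q_) (∪q-comm P a) (≤q∪l P a))
    ... | () , _

  -- Every edge after the next one contains a vertex newer than all of x, so only the next
  -- subdivision could destroy x.
  survive : ∀ j r {x} → T (D (suc j) (suc (j + 4)) x) → ¬ (face o (suc j) (suc (j + 4)) ⊑ x) → ¬ (face o (suc j) (suc (j + 4)) ⊑ neg' x) →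
            T (D (r + suc j) (r + suc (j + 4)) (∅ {r} +++ x))
  survive j zero d f g = d
  survive j (suc zero) {x} d f g = ∧-i d (∧-i (¬-i (λ i → f (sub→ (∧-r {D (suc j) _ x} i)))) (¬-i (λ i → g (sub→ (∧-r {D (suc j) _ (neg' x)} i)))))
  survive j (suc (suc r)) {x} d f g = ∧-i (survive j (suc r) d f g)
    (∧-i (¬-i (λ i → nO (sub→ {x = P ∷ o (r + suc j) (r + suc (j + 4))} {∅ {suc r} +++ x} (∧-r {D (suc r + suc j) _ (∅ {suc r} +++ x)} i))))
         (¬-i (λ i → nO (sub→ {x = P ∷ o (r + suc j) (r + suc (j + 4))} {neg' (∅ {suc r} +++ x)} (∧-r {D (suc r + suc j) _ (neg' (∅ {suc r} +++ x))} i)))))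
    where
    nO : ∀ {m} {a b : Vec Q m} → ¬ ((P ∷ a) ⊑ (O ∷ b))
    nO (() ∷ _)

  gone : ∀ j r → ¬ T (D (suc r + suc j) (suc r + suc (j + 4)) (∅ {suc r} +++ face o (suc j) (suc (j + 4))))
  gone j zero d = ¬-e (∧-l {not (D (suc j) _ f ∧ sub f f)} (∧-r {D (suc j) _ f} d)) (∧-i {D (suc j) _ f} (∧-l {D (suc j) _ f} d) (→sub {x = f} ⊑-refl))
    where f = face o (suc j) (suc (j + 4))
  gone j (suc r) d = gone j r (∧-l d)

oct-agree : ∀ c c′ j n → (∀ i → i < j → c i ≡ c′ i) → ∀ i b → oct c j n i b ≡ oct c′ j n i b
oct-agree c c′ zero n h i b = refl
oct-agree c c′ (suc j) zero h i b = refl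
oct-agree c c′ (suc j) (suc n) h i b
  rewrite h j ≤-refl | oct-agree c c′ j n (λ i l → h i (≤-trans l (ℕₚ.n≤1+n j))) i b
        | oct-agree c c′ j n (λ i l → h i (≤-trans l (ℕₚ.n≤1+n j))) i true = refl

∪≤ : ∀ {n} (x y : Vec Q n) → card (x ∪ y) ≤ card x + card y
∪≤ [] [] = z≤n
∪≤ (a ∷ x) (b ∷ y) = ≤-trans (ℕₚ.+-mono-≤ (q a b) (∪≤ x y)) (≤-reflexive (sw (cardq a) (cardq b) (card x) (card y)))
  where
  q : ∀ a b → cardq (a ∪q b) ≤ cardq a + cardq b
  q O b = ≤-refl
  q P O = ≤-refl
  q P P = s≤s z≤n
  q P M = ≤-refl
  q P X = s≤s (s≤s z≤n)
  q M O = ≤-refl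
  q M P = ≤-refl
  q M M = s≤s z≤n
  q M X = s≤s (s≤s z≤n)
  q X O = ≤-refl
  q X P = s≤s (s≤s z≤n)
  q X M = s≤s (s≤s z≤n)
  q X X = s≤s (s≤s z≤n)
  sw : ∀ a b c d → (a + b) + (c + d) ≡ (a + c) + (b + d)
  sw a b c d = trans (ℕₚ.+-assoc a b (c + d))
    (trans (cong (a +_) (trans (sym (ℕₚ.+-assoc b c d)) (trans (cong (_+ d) (ℕₚ.+-comm b c)) (ℕₚ.+-assoc c b d))))
           (sym (ℕₚ.+-assoc a c (b + d))))

-- Rigidity of isomorphisms.

module Action {N : ℕ} (h : Fin (N + N) ↔ Fin (N + N)) where
  open Inverse h using (to; from)

  h⁺ : Vertex N → Vertex N
  h⁺ v = vtx N (to (idx N v))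

  private
    h⁻ : Vertex N → Vertex N
    h⁻ v = vtx N (from (idx N v))

    h⁺h⁻ : ∀ v → h⁺ (h⁻ v) ≡ v
    h⁺h⁻ v = trans (cong (vtx N ∘ to) (idx-vtx N _)) (trans (cong (vtx N) (Inverse.strictlyInverseˡ h (idx N v))) (vtx-idx N v))

    h⁻h⁺ : ∀ v → h⁻ (h⁺ v) ≡ v
    h⁻h⁺ v = trans (cong (vtx N ∘ from) (idx-vtx N _)) (trans (cong (vtx N) (Inverse.strictlyInverseʳ h (idx N v))) (vtx-idx N v))

  h⁺-inj : ∀ {v w} → h⁺ v ≡ h⁺ w → v ≡ w
  h⁺-inj {v} {w} q = trans (sym (h⁻h⁺ v)) (trans (cong h⁻ q) (h⁻h⁺ w))

  unsigned : Vec Q N → Subset (N + N)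
  unsigned x = tabulate (λ v → bit x (vtx N v))

  signed-un : ∀ x → signed N (unsigned x) ≡ x
  signed-un x = bits≡ (λ v → trans (bit-signed N (unsigned x) v)
    (trans (Vecₚ.lookup∘tabulate (λ v → bit x (vtx N v)) (idx N v)) (cong (bit x) (vtx-idx N v))))

  act : Vec Q N → Vec Q N
  act x = signed N (pull from (unsigned x))

  bit-act : ∀ x v → bit (act x) v ≡ bit x (h⁻ v)
  bit-act x v = trans (bit-signed N (pull from (unsigned x)) v) (trans (Vecₚ.lookup∘tabulate (λ j → lookup (unsigned x) (from j)) (idx N v))
    (Vecₚ.lookup∘tabulate (λ v → bit x (vtx N v)) (from (idx N v))))

  act-on : ∀ x v → bit (act x) (h⁺ v) ≡ bit x v
  act-on x v = trans (bit-act x (h⁺ v)) (cong (bit x) (h⁻h⁺ v))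

  act-inv : ∀ x w → T (bit (act x) w) → Σ (Vertex N) λ v → h⁺ v ≡ w × T (bit x v)
  act-inv x w t = h⁻ w , h⁺h⁻ w , subst T (bit-act x w) t

  act-mono : ∀ {x y} → x ⊑ y → act x ⊑ act y
  act-mono {x} {y} l = bits⊑ (λ v t → subst T (sym (bit-act y v)) (bit-mono l (h⁻ v) (subst T (bit-act x v) t)))

  act-fix : ∀ x → (∀ v → T (bit x v) → h⁺ v ≡ v) → act x ≡ x
  act-fix x f = ⊑-antisym (bits⊑ (λ w t → let r = act-inv x w t in
                    subst (T ∘ bit x) (trans (sym (f (proj₁ r) (proj₂ (proj₂ r)))) (proj₁ (proj₂ r))) (proj₂ (proj₂ r))))
                  (bits⊑ (λ v t → subst (T ∘ bit (act x)) (f v t) (subst T (sym (act-on x v)) t)))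

  act-iso : ∀ {K K′ : Pred N} → (∀ σ → toRaw K σ ≡ toRaw K′ (pull from σ)) → ∀ x → K x ≡ K′ (act x)
  act-iso {K} e x = trans (cong K (sym (signed-un x))) (e (unsigned x))

  module _ {K K′ : Pred N} (e : ∀ x → K x ≡ K′ (act x)) (K-ok : ∀ {x} → T (K x) → T (okv x))
           (K-cl : Closed K′) (nb : ∀ {x} → T (okv x) → card x ≤ 2 → T (K′ x)) where

    -- Antipodal pairs are the only pairs of vertices that are not edges.
    act-neg : ∀ v → h⁺ v ≡ v → h⁺ (flip v) ≡ flip v
    act-neg v q = concl (dec w (flip v))
      where
      w = h⁺ (flip v)
      x = single v ∪ single (flip v)
      dec : (a b : Vertex N) → (a ≡ b) ⊎ (a ≢ b)
      dec (i , s) (j , t) with i Finₚ.≟ j | s Data.Bool.≟ t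
      ... | yes refl | yes refl = inj₁ refl
      ... | no p | _ = inj₂ (λ { refl → p refl })
      ... | yes _ | no p = inj₂ (λ { refl → p refl })
      im : ∀ a → T (bit (single v ∪ single w) a) → (a ≡ v) ⊎ (a ≡ w)
      im a t = [ (λ r → inj₁ (bit-single⁻ v a r)) , (λ r → inj₂ (bit-single⁻ w a r)) ]′ (bit-∪ (single v) (single w) a t)
      le : act x ⊑ single v ∪ single w
      le = bits⊑ (λ a t → let r = act-inv x a t in
        [ (λ p → bit-mono (⊑∪l {x = single v} {single w}) a (subst (T ∘ bit (single v)) (trans (sym (trans (cong h⁺ (bit-single⁻ v _ p)) q)) (proj₁ (proj₂ r))) (bit-single v)))
        , (λ p → bit-mono (⊑∪r {x = single v} {single w}) a (subst (T ∘ bit (single w)) (trans (sym (cong h⁺ (bit-single⁻ (flip v) _ p))) (proj₁ (proj₂ r))) (bit-single w))) ]′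
        (bit-∪ (single v) (single (flip v)) _ (proj₂ (proj₂ r))))
      fl : ∀ {a b : Vertex N} → a ≡ flip b → flip a ≡ b
      fl {a} {i , s} refl = cong (i ,_) (not-inv s)
      okk : w ≢ flip v → T (okv (single v ∪ single w))
      okk ne = okv-bits (single v ∪ single w) (λ a t u → k a (im a t) (im (flip a) u))
        where
        k : ∀ a → (a ≡ v) ⊎ (a ≡ w) → (flip a ≡ v) ⊎ (flip a ≡ w) → ⊥
        k a (inj₁ p) (inj₁ r) = b≢not (proj₂ a) (cong proj₂ (trans p (sym r)))
        k a (inj₂ p) (inj₂ r) = b≢not (proj₂ a) (cong proj₂ (trans p (sym r)))
        k a (inj₁ refl) (inj₂ r) = ne (sym r)
        k a (inj₂ refl) (inj₁ r) = ne (sym (fl (sym r)))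
      concl : (w ≡ flip v) ⊎ (w ≢ flip v) → w ≡ flip v
      concl (inj₁ p) = p
      concl (inj₂ p) = ⊥-elim (bits-okv x (K-ok (subst T (sym (e x)) (K-cl le (nb (okk p)
          (≤-trans (∪≤ (single v) (single w)) (≤-reflexive (cong₂ _+_ (single-card v) (single-card w))))))))
          v (bit-mono (⊑∪l {x = single v} {single (flip v)}) v (bit-single v))
          (bit-mono (⊑∪r {x = single v} {single (flip v)}) (flip v) (bit-single (flip v))))

-- An isomorphism that fixes the last j + 4 pairs and the apices of all levels also fixes the pair added at time j, and
-- the two complexes subdivide the same edge at that time.
module _ (c c′ : ℕ → Fin 3) (L r j : ℕ) (agree : ∀ i → i < j → c i ≡ c′ i) where
  private
    k = j + 4
    N = dbl (suc L) + (r + suc k)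
    m = r + suc j
    K = Δ (walk c) (suc L) m N
    K′ = Δ (walk c′) (suc L) m N
    len≡ : N ≡ len (suc L) m
    len≡ = trans (cong (dbl (suc L) +_) (later r j)) (len-dbl (suc L) m)

  apex : Fin (dbl (suc L)) → Fin N
  apex i = i ↑ˡ (r + suc k)

  low : Fin (suc k) → Fin N
  low i = dbl (suc L) ↑ʳ (r ↑ʳ i)

  module Rigid (h : Fin (N + N) ↔ Fin (N + N)) (e : ∀ x → K x ≡ K′ (Action.act {N} h x))
               (fixT : ∀ i → Action.h⁺ {N} h (apex i , true) ≡ (apex i , true))
               (fixO : ∀ i s → Action.h⁺ {N} h (low (suc i) , s) ≡ (low (suc i) , s)) where
    open Action {N} h
    private
      A = walk-adm c
      A′ = walk-adm c′
      -- Joining with all positive apices moves questions about the spheres to the 3-spheres through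
      -- `link`. The empty block in the middle belongs to the pairs added after time j.
      whole : Q → Vec Q k → Vec Q N
      whole q ρ = tops (suc L) +++ (∅ {r} +++ (q ∷ ρ))
      v : Vertex N
      v = low zero , true

      bits-whole : ∀ q ρ w → T (bit (whole q ρ) w) →
                   (Σ (Fin (dbl (suc L))) λ i → w ≡ (apex i , true)) ⊎
                   (Σ (Fin (suc k)) λ i → Σ Bool λ s → w ≡ (low i , s) × T (bit (q ∷ ρ) (i , s)))
      bits-whole q ρ (i , s) t with split-pos (dbl (suc L)) i
      ... | inj₁ (i′ , refl) = inj₁ (i′ , cong (apex i′ ,_) (tops-bit _ i′ s (subst T (bit-↑ˡ (tops (suc L)) (∅ {r} +++ (q ∷ ρ)) i′ s) t)))
      ... | inj₂ (i′ , refl) with split-pos r i′ | subst T (bit-↑ʳ (tops (suc L)) (∅ {r} +++ (q ∷ ρ)) i′ s) t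
      ... | inj₁ (i″ , refl) | u = ⊥-elim (bit-∅ (i″ , s) (subst T (bit-↑ˡ (∅ {r}) (q ∷ ρ) i″ s) u))
      ... | inj₂ (i″ , refl) | u = inj₂ (i″ , s , refl , subst T (bit-↑ʳ (∅ {r}) (q ∷ ρ) i″ s) u)

      fix-old : ∀ ρ → act (whole O ρ) ≡ whole O ρ
      fix-old ρ = act-fix _ (λ w t → h′ w (bits-whole O ρ w t))
        where
        h′ : ∀ w → _ → h⁺ w ≡ w
        h′ w (inj₁ (i , refl)) = fixT i
        h′ w (inj₂ (zero , true , refl , ()))
        h′ w (inj₂ (zero , false , refl , ()))
        h′ w (inj₂ (suc i , s , refl , _)) = fixO i s

      anti≡ : anti c j ≡ anti c′ j
      anti≡ = ⊑-antisym (⋃-lub _ (λ i → subst (_⊑ anti c′ j) (sym (oct-agree c c′ j k agree i false)) (⊑⋃ (λ i → oct c′ j k i false) i)))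
                        (⋃-lub _ (λ i → subst (_⊑ anti c j) (oct-agree c c′ j k agree i false) (⊑⋃ (λ i → oct c j k i false) i)))

      face-in : T (K (whole P (anti c j)))
      face-in = link⁻ A (suc L) m (r + suc k) (later r j) (survive c j r
        (Stage.facet (stage c j) (λ _ → false))
        (λ { (_ ∷ l) → Stage.apart (stage c j) (c j) (oct-closed c (stage c j) (∪-lub l (⊑⋃ (λ i → oct c j k i false) (c j)))
               (Stage.facet (stage c j) (λ _ → false))) })
        (λ { (() ∷ _) }))

      img : T (K′ (act (whole P (anti c j))))
      img = subst T (e _) face-in

      O⊑P : whole O (anti c j) ⊑ act (whole P (anti c j))
      O⊑P = subst (_⊑ act (whole P (anti c j))) (fix-old (anti c j))
        (act-mono {whole O (anti c j)} {whole P (anti c j)} (++-mono {x = tops (suc L)} ⊑-refl (++-mono {x = ∅ {r}} ⊑-refl (O≤ ∷ ⊑-refl))))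

      shape : ∀ {n} (z : Vec Q n) → replicate n P ⊑ z → T (okv z) → z ≡ replicate n P
      shape [] _ _ = refl
      shape (P ∷ z) (PP ∷ l) t = cong (P ∷_) (shape z l t)
      shape (X ∷ z) (PX ∷ l) ()

      ok-l : ∀ {a b} (x : Vec Q a) {y : Vec Q b} → T (okv (x +++ y)) → T (okv x)
      ok-l [] t = tt
      ok-l (a ∷ x) t = ∧-i {okq a} (∧-l t) (ok-l x (∧-r {okq a} t))

      at-v : T (bit (act (whole P (anti c j))) (h⁺ v))
      at-v = subst T (sym (act-on (whole P (anti c j)) v))
        (subst T (sym (trans (bit-↑ʳ (tops (suc L)) (∅ {r} +++ (P ∷ anti c j)) (r ↑ʳ zero) true) (bit-↑ʳ (∅ {r}) (P ∷ anti c j) zero true))) tt)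

      low≢ : ∀ {i} → low zero ≢ low (suc i)
      low≢ {i} q with Finₚ.↑ʳ-injective r _ _ (Finₚ.↑ʳ-injective (dbl (suc L)) _ _ q)
      ... | ()

      low≢apex : ∀ {i} → low zero ≢ apex i
      low≢apex {i} q with trans (sym (Finₚ.splitAt-↑ʳ (dbl (suc L)) (r + suc k) (r ↑ʳ zero))) (trans (cong (splitAt (dbl (suc L))) q) (Finₚ.splitAt-↑ˡ (dbl (suc L)) i (r + suc k)))
      ... | ()

      parts : ∀ z → z ≡ act (whole P (anti c j)) → Σ Q λ q → Σ (Vec Q k) λ ρ → z ≡ whole q ρ × q ≤q P
      parts z eq with Data.Vec.splitAt (dbl (suc L)) z
      ... | z₁ , z₂ , refl with Data.Vec.splitAt r z₂
      ... | z₃ , (q ∷ ρ) , refl = q , ρ , cong₂ _+++_ s₁ (cong (_+++ (q ∷ ρ)) (proj₁ lo)) , proj₂ lo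
        where
        big : whole O (anti c j) ⊑ z₁ +++ (z₃ +++ (q ∷ ρ))
        big = subst (whole O (anti c j) ⊑_) (sym eq) O⊑P
        in′ : T (K′ (z₁ +++ (z₃ +++ (q ∷ ρ))))
        in′ = subst (T ∘ K′) (sym eq) img
        s₁ : z₁ ≡ tops (suc L)
        s₁ = shape z₁ (proj₁ (++-⊑ {x = tops (suc L)} {x′ = z₁} big)) (ok-l z₁ (Δ-ok A′ (suc L) m N len≡ in′))
        tl : anti c j ⊑ ρ
        tl with proj₂ (++-⊑ {x = ∅ {r}} {x′ = z₃} (proj₂ (++-⊑ {x = tops (suc L)} {x′ = z₁} big)))
        ... | _ ∷ l = l
        lo = lonely c′ j r z₃ {q} {ρ} (link A′ (suc L) m (r + suc k) (later r j)
               (subst (λ w → T (K′ (w +++ (z₃ +++ (q ∷ ρ))))) s₁ in′)) (subst (_⊑ ρ) anti≡ tl)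

    -- All vertices of `whole P (anti c j)` except v are fixed. Its image is a face above the same
    -- triangle and the same apices, so by `lonely` it has no later vertex and not -v; the image of
    -- v is no fixed vertex either, and only v remains.
    fix-new⁺ : h⁺ v ≡ v
    fix-new⁺ with parts _ refl
    ... | q , ρ , eq , le = done′ (bits-whole q ρ (h⁺ v) (subst (λ x → T (bit x (h⁺ v))) eq at-v))
      where
      done′ : _ → h⁺ v ≡ v
      done′ (inj₁ (i , p)) = ⊥-elim (low≢apex (cong proj₁ (h⁺-inj {v} {apex i , true} (trans p (sym (fixT i))))))
      done′ (inj₂ (suc i , s , p , _)) = ⊥-elim (low≢ (cong proj₁ (h⁺-inj {v} {low (suc i) , s} (trans p (sym (fixO i s))))))
      done′ (inj₂ (zero , true , p , _)) = p
      done′ (inj₂ (zero , false , p , t)) = ⊥-elim (nm le t)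
        where
        nm : ∀ {q} → q ≤q P → ¬ T (leq M q)
        nm O≤ ()
        nm PP ()

    fix-new : ∀ s → h⁺ (low zero , s) ≡ (low zero , s)
    fix-new true = fix-new⁺
    fix-new false = act-neg e (Δ-ok A (suc L) m N len≡) (Δ-cl A′ (suc L) m N len≡)
      (λ {x} o l → nbly A′ (suc L) m N len≡ {x} o (≤-trans l (s≤s (s≤s z≤n)))) v fix-new⁺

    -- The isomorphism fixes both ends of the edge that the first complex subdivides next. If the
    -- second complex chose another end, this edge would survive there, while it is gone in the
    -- first.
    same-edge : ¬ T (Δ (walk c) 0 m (r + suc k) (∅ {r} +++ face (walk c) (suc j) (suc k))) → c j ≡ c′ j
    same-edge gn with c j Finₚ.≟ c′ j
    ... | yes p = p
    ... | no p = ⊥-elim (gn (link A (suc L) m (r + suc k) (later r j) (subst T (sym (trans (e x) (cong K′ fx))) in′)))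
      where
      ρ = oct c j k (c j) true
      x = whole P ρ
      fx : act x ≡ x
      fx = act-fix x (λ w t → h′ w (bits-whole P ρ w t))
        where
        h′ : ∀ w → _ → h⁺ w ≡ w
        h′ w (inj₁ (i , refl)) = fixT i
        h′ w (inj₂ (zero , s , refl , _)) = fix-new s
        h′ w (inj₂ (suc i , s , refl , _)) = fixO i s
      ρ′ : ρ ≡ oct c′ j k (c j) true
      ρ′ = oct-agree c c′ j k agree (c j) true
      -- A triangle with the pair of `c j` at `true` and the pair of `c′ j` at `false`: if the edge
      -- of the second complex lay in x, this face would contain both vertices of the pair of
      -- `c′ j`, against `apart`.
      b : Fin 3 → Bool
      b i = not (eq3 (c′ j) i)
      b₁ : b (c j) ≡ true
      b₁ = cong not (¬T→≡ (λ t → p (sym (eq3→ (c′ j) (c j) t))))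
      b₂ : b (c′ j) ≡ false
      b₂ = cong not (eq3-refl (c′ j))
      all : Fin 3 → Vec Q k
      all i = oct c′ j k i (b i)
      in′ : T (K′ x)
      in′ = link⁻ A′ (suc L) m (r + suc k) (later r j) (survive c′ j r
        (subst (λ y → T (Oct c′ j k y)) (sym ρ′) (oct-closed c′ (stage c′ j) (⊑⋃ (λ i → oct c′ j k i true) (c j)) (Stage.facet (stage c′ j) (λ _ → true))))
        (λ { (_ ∷ l) → Stage.apart (stage c′ j) (c′ j) (oct-closed c′ (stage c′ j) (∪-lub
               (⊑-trans (subst (_ ⊑_) ρ′ l) (subst (λ w → oct c′ j k (c j) w ⊑ ⋃ all) b₁ (⊑⋃ all (c j))))
               (subst (λ w → oct c′ j k (c′ j) w ⊑ ⋃ all) b₂ (⊑⋃ all (c′ j)))) (Stage.facet (stage c′ j) b)) })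
        (λ { (() ∷ _) }))

module _ (c c′ : ℕ → Fin 3) (L : ℕ) where
  private
    step : ∀ r j m N → m ≡ r + suc j → N ≡ dbl (suc L) + (r + suc (j + 4)) →
           (h : Fin (N + N) ↔ Fin (N + N)) →
           (∀ σ → toRaw (Δ (walk c) (suc L) m N) σ ≡ toRaw (Δ (walk c′) (suc L) m N) (pull (Inverse.from h) σ)) →
           (∀ i → toℕ i < dbl (suc L) → Action.h⁺ {N} h (i , true) ≡ (i , true)) →
           (∀ i → i < j → c i ≡ c′ i) →
           (∀ i s → N ≤ toℕ i + (j + 4) → Action.h⁺ {N} h (i , s) ≡ (i , s)) →
           (∀ i s → N ≤ toℕ i + (suc j + 4) → Action.h⁺ {N} h (i , s) ≡ (i , s)) × (1 ≤ r → c j ≡ c′ j)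
    step r j ._ ._ refl refl h e fixT agree fix = fix′ , edge r refl
      where
      k = j + 4
      a = dbl (suc L)
      N = a + (r + suc k)
      lo : Fin (suc k) → Fin N
      lo = low c c′ L r j agree
      toℕ-lo : ∀ i → toℕ (lo i) ≡ a + (r + toℕ i)
      toℕ-lo i = trans (Finₚ.toℕ-↑ʳ a (r ↑ʳ i)) (cong (a +_) (Finₚ.toℕ-↑ʳ r i))
      le : ∀ i → N ≤ toℕ (lo (suc i)) + k
      le i = ≤-trans (ℕₚ.+-monoʳ-≤ a (ℕₚ.+-monoʳ-≤ r (s≤s (ℕₚ.m≤n+m k (toℕ i)))))
        (≤-reflexive (trans (cong (a +_) (sym (ℕₚ.+-assoc r (suc (toℕ i)) k)))
          (trans (sym (ℕₚ.+-assoc a (r + suc (toℕ i)) k)) (cong (_+ k) (sym (toℕ-lo (suc i)))))))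
      module Rg = Rigid c c′ L r j agree h (Action.act-iso {N} h {Δ (walk c) (suc L) (r + suc j) N} {Δ (walk c′) (suc L) (r + suc j) N} e)
                    (λ i → fixT (apex c c′ L r j agree i) (subst (_< a) (sym (Finₚ.toℕ-↑ˡ i (r + suc k))) (Finₚ.toℕ<n i)))
                    (λ i s → fix (lo (suc i)) s (le i))
      fix′ : ∀ i s → N ≤ toℕ i + (suc j + 4) → Action.h⁺ {N} h (i , s) ≡ (i , s)
      fix′ i s l with split-pos a i
      ... | inj₁ (i′ , refl) = ⊥-elim (ℕₚ.n≮n N (≤-trans (s≤s (subst (λ t → N ≤ t + suc k) (Finₚ.toℕ-↑ˡ i′ (r + suc k)) l))
              (≤-trans (ℕₚ.+-monoˡ-≤ (suc k) (Finₚ.toℕ<n i′)) (ℕₚ.+-monoʳ-≤ a (ℕₚ.m≤n+m (suc k) r)))))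
      ... | inj₂ (i′ , refl) with split-pos r i′
      ... | inj₁ (i″ , refl) = ⊥-elim (ℕₚ.n≮n N (≤-trans (s≤s (subst (λ t → N ≤ t + suc k)
              (trans (Finₚ.toℕ-↑ʳ a (i″ ↑ˡ suc k)) (cong (a +_) (Finₚ.toℕ-↑ˡ i″ (suc k)))) l))
              (≤-trans (ℕₚ.+-monoˡ-≤ (suc k) (≤-trans (≤-reflexive (sym (ℕₚ.+-suc a _))) (ℕₚ.+-monoʳ-≤ a (Finₚ.toℕ<n i″))))
                (≤-reflexive (ℕₚ.+-assoc a r (suc k))))))
      ... | inj₂ (zero , refl) = Rg.fix-new s
      ... | inj₂ (suc i″ , refl) = fix (lo (suc i″)) s (le i″)
      edge : ∀ r′ → r ≡ r′ → 1 ≤ r′ → c j ≡ c′ j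
      edge (suc r′) refl _ = Rg.same-edge (gone c j r′)

  -- The choice at time j determines the edge subdivided when the following pair is added, so at
  -- time m only choices with `suc j < m` have left a trace.
  rigid : ∀ m N → N ≡ dbl (suc L) + (m + 4) → (h : Fin (N + N) ↔ Fin (N + N)) →
          (∀ σ → toRaw (Δ (walk c) (suc L) m N) σ ≡ toRaw (Δ (walk c′) (suc L) m N) (pull (Inverse.from h) σ)) →
          (∀ i → toℕ i < dbl (suc L) → Action.h⁺ {N} h (i , true) ≡ (i , true)) →
          (∀ i s → N ≤ toℕ i + 4 → Action.h⁺ {N} h (i , s) ≡ (i , s)) →
          ∀ j → suc j < m → c j ≡ c′ j
  rigid m N q h e fixT fix₄ j l = proj₁ (go (suc j) (ℕₚ.<⇒≤ l)) j ≤-refl l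
    where
    go : ∀ j → j ≤ m → (∀ i → i < j → suc i < m → c i ≡ c′ i) ×
                       (∀ i s → N ≤ toℕ i + (j + 4) → Action.h⁺ {N} h (i , s) ≡ (i , s))
    go zero _ = (λ i ()) , fix₄
    go (suc j) l with go j (ℕₚ.<⇒≤ l)
    ... | ag , fx with step (m ∸ suc j) j m N (sym (ℕₚ.m∸n+n≡m l))
          (trans q (cong (dbl (suc L) +_) (trans (cong (_+ 4) (sym (ℕₚ.m∸n+n≡m l))) (ℕₚ.+-assoc (m ∸ suc j) (suc j) 4)))) h e fixT
          (λ i li → ag i li (≤-trans (s≤s li) l)) fx
    ... | fx′ , edge = ag′ , fx′
      where
      ag′ : ∀ i → i < suc j → suc i < m → c i ≡ c′ i
      ag′ i (s≤s li) lm with ℕₚ.m≤n⇒m<n∨m≡n li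
      ... | inj₁ lt = ag i lt lm
      ... | inj₂ refl = edge (ℕₚ.m<n⇒0<n∸m lm)

-- Counting isomorphism classes.

pull-∘ : ∀ {a b c} (f : Fin b → Fin a) (g : Fin c → Fin b) σ → pull (f ∘ g) σ ≡ pull g (pull f σ)
pull-∘ f g σ = Vecₚ.tabulate-cong (λ i → sym (Vecₚ.lookup∘tabulate (λ j → lookup σ (f j)) (g i)))

pull-id : ∀ {a} {f : Fin a → Fin a} → (∀ i → f i ≡ i) → ∀ σ → pull f σ ≡ σ
pull-id {f = f} q σ = trans (Vecₚ.tabulate-cong (λ i → cong (lookup σ) (q i))) (Vecₚ.tabulate∘lookup σ)

module _ {p : ℕ} where
  Iso-sym : {K L : RawComplex p} → Iso K L → Iso L K
  Iso-sym {K} {L} (f , e) = mk↔ₛ′ from to (Inverse.strictlyInverseʳ f) (Inverse.strictlyInverseˡ f) ,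
    λ σ → sym (trans (e (pull to σ)) (cong L (trans (sym (pull-∘ to from σ)) (pull-id (Inverse.strictlyInverseˡ f) σ))))
    where open Inverse f using (to; from)

  Iso-trans : {K L R : RawComplex p} → Iso K L → Iso L R → Iso K R
  Iso-trans {K} {L} {R} (f , e) (g , d) =
    mk↔ₛ′ (G.to ∘ F.to) (F.from ∘ G.from)
      (λ i → trans (cong G.to (F.strictlyInverseˡ (G.from i))) (G.strictlyInverseˡ i))
      (λ i → trans (cong F.from (G.strictlyInverseʳ (F.to i))) (F.strictlyInverseʳ i)) ,
    λ σ → trans (e σ) (trans (d (pull F.from σ)) (cong R (sym (pull-∘ F.from G.from σ))))
    where
    module F = Inverse f
    module G = Inverse g

  -- Removing isomorphic duplicates from a list needs a decision procedure. Both directions of a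
  -- bijection range over `p ^ p` coded functions, and a subset on which the complexes disagree is
  -- found by finite search.
  Iso? : (K L : RawComplex p) → Dec (Iso K L)
  Iso? K L = map′ (λ { (a , b , l , r , e) → mk↔ₛ′ (finToFun a) (finToFun b) l r ,
                        λ σ → decidable-stable (K σ Data.Bool.≟ _) (λ ne → e (σ , ne)) })
                  code
                  (Finₚ.any? λ a → Finₚ.any? λ b → good? (finToFun a) (finToFun b))
    where
    Good′ : (to from : Fin p → Fin p) → Set
    Good′ to from = (∀ i → to (from i) ≡ i) × (∀ i → from (to i) ≡ i) × ¬ Σ (Subset p) λ σ → K σ ≢ L (pull from σ)
    good? : ∀ to from → Dec (Good′ to from)
    good? to from = Finₚ.all? (λ i → to (from i) Finₚ.≟ i) ×-dec Finₚ.all? (λ i → from (to i) Finₚ.≟ i)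
      ×-dec ¬? (Subₚ.anySubset? (λ σ → ¬? (K σ Data.Bool.≟ L (pull from σ))))
    code : Iso K L → Σ (Fin (p ^ p)) λ a → Σ (Fin (p ^ p)) λ b → Good′ (finToFun a) (finToFun b)
    code (f , e) = funToFin to , funToFin from
      , (λ i → trans (ft to _) (trans (cong to (ft from i)) (Inverse.strictlyInverseˡ f i)))
      , (λ i → trans (ft from _) (trans (cong from (ft to i)) (Inverse.strictlyInverseʳ f i)))
      , (λ { (σ , ne) → ne (trans (e σ) (cong L (Vecₚ.tabulate-cong (λ i → cong (lookup σ) (sym (ft from i)))))) })
      where
      open Inverse f using (to; from)
      ft = Finₚ.finToFun-funToFin

  isoSetoid : DecSetoid _ _
  isoSetoid = record
    { Carrier = RawComplex p ; _≈_ = Iso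
    ; isDecEquivalence = record
      { isEquivalence = record { refl = iso-≗ (λ _ → refl) ; sym = λ {K} {L} → Iso-sym {K} {L} ; trans = λ {K} {L} {R} → Iso-trans {K} {L} {R} }
      ; _≟_ = Iso? } }

  reps : ∀ {y} → (Fin y → RawComplex p) → List (RawComplex p)
  reps K = List.deduplicate Iso? (List.tabulate K)

  module _ {y c} (K : Fin y → RawComplex p) (code : (Fin p ↔ Fin p) → Fin c)
           (inj : ∀ {i j R} (f : Iso (K i) R) (g : Iso (K j) R) → code (proj₁ f) ≡ code (proj₁ g) → i ≡ j) where
    private
      rep : ∀ i → Σ (Fin (length (reps K))) λ r → Iso (K i) (List.lookup (reps K) r)
      rep i = index a , Anyₚ.lookup-index a
        where
        a : Any (Iso (K i)) (reps K)
        a = Memₚ.∈-deduplicate⁺ (DecSetoid.setoid isoSetoid) Iso? (λ {_} {L} {R} s t → Iso-trans {_} {L} {R} t (Iso-sym {R} {L} s))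
              (Anyₚ.tabulate⁺ {f = K} i (DecSetoid.refl isoSetoid))

      meet : ∀ {i j} (a : Σ _ λ r → Iso (K i) (List.lookup (reps K) r)) (b : Σ _ λ r → Iso (K j) (List.lookup (reps K) r)) →
             proj₁ a ≡ proj₁ b → code (proj₁ (proj₂ a)) ≡ code (proj₁ (proj₂ b)) → i ≡ j
      meet (r , f) (.r , g) refl q = inj {R = List.lookup (reps K) r} f g q

    -- An index is determined by the representative of its class and the code of the isomorphism to
    -- it, so the indices inject into pairs of these.
    classes : y ≤ length (reps K) * c
    classes = Finₚ.injective⇒≤ {f = λ i → combine (proj₁ (rep i)) (code (proj₁ (proj₂ (rep i))))}
      (λ {i} {j} q → let r = Finₚ.combine-injective _ _ _ _ q in meet (rep i) (rep j) (proj₁ r) (proj₂ r))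

funToFin-injective : ∀ {d m} (f g : Fin d → Fin m) → funToFin f ≡ funToFin g → ∀ i → f i ≡ g i
funToFin-injective f g q i = trans (sym (Finₚ.finToFun-funToFin f i)) (trans (cong (λ a → finToFun a i) q) (Finₚ.finToFun-funToFin g i))

-- Exponential against polynomial growth.

open +-*-Solver

^-distribʳ-* : ∀ d x y → (x * y) ^ d ≡ x ^ d * y ^ d
^-distribʳ-* zero x y = refl
^-distribʳ-* (suc d) x y = trans (cong (x * y *_) (^-distribʳ-* d x y))
  (solve 4 (λ x y a b → x :* y :* (a :* b) := x :* a :* (y :* b)) refl x y (x ^ d) (y ^ d))

-- With x = d + y this is (1 + 1/x) ^ d ≤ x / (x - d), cleared of denominators.
bernoulli : ∀ d y → suc (d + y) ^ d * y ≤ (d + y) ^ suc d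
bernoulli zero y = ≤-reflexive (trans (ℕₚ.+-identityʳ y) (sym (ℕₚ.*-identityʳ y)))
bernoulli (suc d) y = begin
  s * s ^ d * y ≡⟨ solve 3 (λ s a y → s :* a :* y := a :* (s :* y)) refl s (s ^ d) y ⟩
  s ^ d * (s * y) ≤⟨ ℕₚ.*-monoʳ-≤ (s ^ d) le ⟩
  s ^ d * (suc y * x) ≡⟨ sym (ℕₚ.*-assoc (s ^ d) (suc y) x) ⟩
  s ^ d * suc y * x ≤⟨ ℕₚ.*-monoˡ-≤ x (subst (λ x → suc x ^ d * suc y ≤ x ^ suc d) (ℕₚ.+-suc d y) (bernoulli d (suc y))) ⟩
  x ^ suc d * x ≡⟨ ℕₚ.*-comm (x ^ suc d) x ⟩
  x ^ suc (suc d) ∎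
  where
  open ℕₚ.≤-Reasoning
  x = suc d + y
  s = suc x
  le : s * y ≤ suc y * x
  le = ℕₚ.+-mono-≤ (ℕₚ.m≤n+m y (suc d)) (≤-reflexive (ℕₚ.*-comm x y))

-- From x ≥ 3d follows x / (x - d) ≤ 3/2, the ratio of the two exponential bases to be compared.
growth : ∀ d x → 3 * d ≤ x → 2 * suc x ^ d ≤ 3 * x ^ d
-- At x = 0 the cancellation of x is impossible, but the hypothesis then forces d = 0.
growth d zero l rewrite ℕₚ.n≤0⇒n≡0 (≤-trans (ℕₚ.m≤m+n d (d + (d + 0))) l) = s≤s (s≤s z≤n)
growth d x@(suc _) l = ℕₚ.*-cancelʳ-≤ (2 * suc x ^ d) (3 * x ^ d) x (begin
  2 * suc x ^ d * x ≡⟨ solve 2 (λ a x → con 2 :* a :* x := a :* (con 2 :* x)) refl (suc x ^ d) x ⟩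
  suc x ^ d * (2 * x) ≤⟨ ℕₚ.*-monoʳ-≤ (suc x ^ d) le ⟩
  suc x ^ d * (3 * y) ≡⟨ solve 2 (λ a y → a :* (con 3 :* y) := con 3 :* (a :* y)) refl (suc x ^ d) y ⟩
  3 * (suc x ^ d * y) ≤⟨ ℕₚ.*-monoʳ-≤ 3 (subst (λ x → suc x ^ d * y ≤ x ^ suc d) eq (bernoulli d y)) ⟩
  3 * (x * x ^ d) ≡⟨ solve 2 (λ a x → con 3 :* (x :* a) := con 3 :* a :* x) refl (x ^ d) x ⟩
  3 * x ^ d * x ∎)
  where
  open ℕₚ.≤-Reasoning
  y = x ∸ d
  eq : d + y ≡ x
  eq = ℕₚ.m+[n∸m]≡n (≤-trans (ℕₚ.m≤m+n d _) l)
  le : 2 * x ≤ 3 * y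
  le = ℕₚ.+-cancelʳ-≤ (3 * d) (2 * x) (3 * y) (begin
    2 * x + 3 * d ≤⟨ ℕₚ.+-monoʳ-≤ (2 * x) l ⟩
    2 * x + x ≡⟨ solve 1 (λ x → con 2 :* x :+ x := con 3 :* x) refl x ⟩
    3 * x ≡⟨ cong (3 *_) (sym eq) ⟩
    3 * (d + y) ≡⟨ solve 2 (λ d y → con 3 :* (d :+ y) := con 3 :* y :+ con 3 :* d) refl d y ⟩
    3 * y + 3 * d ∎)

beats : ∀ d b → 3 * d ≤ b → ∀ m → 2 ^ m * (m + b) ^ d ≤ b ^ d * 3 ^ m
beats d b l zero = ≤-reflexive (trans (ℕₚ.+-identityʳ (b ^ d)) (sym (ℕₚ.*-identityʳ (b ^ d))))
beats d b l (suc m) = begin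
  2 * 2 ^ m * suc (m + b) ^ d ≡⟨ solve 2 (λ a c → con 2 :* a :* c := a :* (con 2 :* c)) refl (2 ^ m) (suc (m + b) ^ d) ⟩
  2 ^ m * (2 * suc (m + b) ^ d) ≤⟨ ℕₚ.*-monoʳ-≤ (2 ^ m) (growth d (m + b) (≤-trans l (ℕₚ.m≤n+m b m))) ⟩
  2 ^ m * (3 * (m + b) ^ d) ≡⟨ solve 2 (λ a c → a :* (con 3 :* c) := con 3 :* (a :* c)) refl (2 ^ m) ((m + b) ^ d) ⟩
  3 * (2 ^ m * (m + b) ^ d) ≤⟨ ℕₚ.*-monoʳ-≤ 3 (beats d b l m) ⟩
  3 * (b ^ d * 3 ^ m) ≡⟨ solve 2 (λ a c → con 3 :* (a :* c) := a :* (con 3 :* c)) refl (b ^ d) (3 ^ m) ⟩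
  b ^ d * 3 ^ suc m ∎
  where open ℕₚ.≤-Reasoning

-- Here a counts the pairs that involve no choice and d the vertices whose images are recorded.
-- After multiplication by a power of n, `beats` trades 2 ^ m for 3 ^ m; the count of classes brings
-- the power back for cancellation, with a factor 2 ^ d because Vₙ has 2n points.
many : ∀ a d m c → 3 ^ m ≤ c * ((m + a) + (m + a)) ^ d → 1 * 2 ^ (m + a) ≤ (2 ^ a * 2 ^ d * (suc a + 3 * d) ^ d) * c
many a d m c l = ℕₚ.*-cancelʳ-≤ _ _ (n ^ d) ⦃ ℕₚ.m^n≢0 n d ⦄ (begin
  1 * 2 ^ (m + a) * n ^ d ≡⟨ cong (_* n ^ d) (trans (ℕₚ.*-identityˡ _) (ℕₚ.^-distribˡ-+-* 2 m a)) ⟩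
  2 ^ m * 2 ^ a * n ^ d ≡⟨ solve 3 (λ x y z → x :* y :* z := y :* (x :* z)) refl (2 ^ m) (2 ^ a) (n ^ d) ⟩
  2 ^ a * (2 ^ m * n ^ d) ≤⟨ ℕₚ.*-monoʳ-≤ (2 ^ a) (ℕₚ.*-monoʳ-≤ (2 ^ m) (ℕₚ.^-monoˡ-≤ d n≤)) ⟩
  2 ^ a * (2 ^ m * (m + b) ^ d) ≤⟨ ℕₚ.*-monoʳ-≤ (2 ^ a) (beats d b (ℕₚ.m≤n+m (3 * d) (suc a)) m) ⟩
  2 ^ a * (b ^ d * 3 ^ m) ≤⟨ ℕₚ.*-monoʳ-≤ (2 ^ a) (ℕₚ.*-monoʳ-≤ (b ^ d) l′) ⟩
  2 ^ a * (b ^ d * (c * (2 ^ d * n ^ d))) ≡⟨ solve 5 (λ x y z u v → x :* (y :* (z :* (u :* v))) := (x :* u :* y) :* z :* v) refl (2 ^ a) (b ^ d) c (2 ^ d) (n ^ d) ⟩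
  (2 ^ a * 2 ^ d * b ^ d) * c * n ^ d ∎)
  where
  open ℕₚ.≤-Reasoning
  -- The successor makes `n ^ d` nonzero, so that it can be cancelled.
  n = suc (m + a)
  b = suc a + 3 * d
  n≤ : n ≤ m + b
  n≤ = ≤-trans (≤-reflexive (sym (ℕₚ.+-suc m a))) (ℕₚ.+-monoʳ-≤ m (ℕₚ.m≤m+n (suc a) (3 * d)))
  l′ : 3 ^ m ≤ c * (2 ^ d * n ^ d)
  l′ = ≤-trans l (ℕₚ.*-monoʳ-≤ c (≤-trans (ℕₚ.^-monoˡ-≤ d
         (≤-trans (ℕₚ.+-mono-≤ (ℕₚ.n≤1+n _) (ℕₚ.n≤1+n _)) (≤-reflexive (cong (n +_) (sym (ℕₚ.+-identityʳ n))))))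
         (≤-reflexive (^-distribʳ-* d 2 n))))

-- The family of spheres and the final count.

module _ (M : ℕ) where
  choice : Fin (3 ^ M) → ℕ → Fin 3
  choice y j with j ℕₚ.<? M
  ... | yes l = finToFun y (fromℕ< l)
  ... | no _ = zero

  choice-toℕ : ∀ y (i : Fin M) → choice y (toℕ i) ≡ finToFun y i
  choice-toℕ y i with toℕ i ℕₚ.<? M
  ... | yes l = cong (finToFun y) (Finₚ.fromℕ<-toℕ i l)
  ... | no g = ⊥-elim (g (Finₚ.toℕ<n i))

  choice-injective : ∀ {y y′} → (∀ j → suc j < suc M → choice y j ≡ choice y′ j) → y ≡ y′
  choice-injective {y} {y′} f = trans (sym (Finₚ.funToFin-finToFin {M} {3} y))
    (trans (funToFin-cong (λ i → trans (sym (choice-toℕ y i)) (trans (f _ (s≤s (Finₚ.toℕ<n i))) (choice-toℕ y′ i))))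
           (Finₚ.funToFin-finToFin {M} {3} y′))
    where
    funToFin-cong : ∀ {m n} {f g : Fin m → Fin n} → (∀ i → f i ≡ g i) → funToFin f ≡ funToFin g
    funToFin-cong {zero} q = refl
    funToFin-cong {suc m} q = cong₂ combine (q zero) (funToFin-cong (q ∘ suc))

module Family (L M : ℕ) where
  private
    E = dbl (suc L)

  n = E + (suc M + 4)

  -- The first added pair uses the fixed starting edge, so M of the `suc M` additions involve a
  -- choice.
  sphere : Fin (3 ^ M) → RawComplex (n + n)
  sphere y = toRaw (Δ (walk (choice M y)) (suc L) (suc M) n)

  private
    low₄ : Fin 4 → Fin n
    low₄ i = E ↑ʳ (suc M ↑ʳ i)

    -- The vertices whose images are recorded: the positive apices, the only ones in `tops`, and
    -- both signs of the four initial pairs.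
    spec : Fin (E + 8) → Vertex n
    spec d = [ (λ i → i ↑ˡ (suc M + 4) , true) , (λ e → low₄ (proj₁ (vtx 4 e)) , proj₂ (vtx 4 e)) ]′ (splitAt E d)

    code : (Fin (n + n) ↔ Fin (n + n)) → Fin ((n + n) ^ (E + 8))
    code f = funToFin (λ d → Inverse.to f (idx n (spec d)))

    rigid′ : ∀ {y y′ R} (f : Iso (sphere y) R) (g : Iso (sphere y′) R) → code (proj₁ f) ≡ code (proj₁ g) → y ≡ y′
    rigid′ {y} {y′} {R} f g q = choice-injective M (rigid (choice M y) (choice M y′) L (suc M) n refl (proj₁ h) (proj₂ h) fixT fix₄)
      where
      h : Iso (sphere y) (sphere y′)
      h = Iso-trans {K = sphere y} {R} {sphere y′} f (Iso-sym {K = sphere y′} {R} g)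
      h⁺ = Action.h⁺ {n} (proj₁ h)
      at : ∀ {K K′ : RawComplex (n + n)} → Iso K K′ → Fin (E + 8) → Fin (n + n)
      at (f , _) d = Inverse.to f (idx n (spec d))
      fixed : ∀ d → h⁺ (spec d) ≡ spec d
      fixed d = trans (cong (vtx n) (trans (cong (Inverse.from (proj₁ g)) (funToFin-injective (at {K = sphere y} {R} f) (at {K = sphere y′} {R} g) q d)) (Inverse.strictlyInverseʳ (proj₁ g) (idx n (spec d)))))
                      (vtx-idx n (spec d))
      fixT : ∀ i → toℕ i < E → h⁺ (i , true) ≡ (i , true)
      fixT i l with split-pos E i
      ... | inj₁ (k , refl) = subst (λ v → h⁺ v ≡ v) (cong [ _ , _ ]′ (Finₚ.splitAt-↑ˡ E k 8)) (fixed (k ↑ˡ 8))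
      ... | inj₂ (k , refl) = ⊥-elim (ℕₚ.m+n≮m E _ (subst (_< E) (Finₚ.toℕ-↑ʳ E k) l))
      fix₄ : ∀ i s → n ≤ toℕ i + 4 → h⁺ (i , s) ≡ (i , s)
      fix₄ i s l with split-pos E i
      ... | inj₁ (k , refl) = ⊥-elim (ℕₚ.n≮n n (≤-trans (s≤s (subst (λ t → n ≤ t + 4) (Finₚ.toℕ-↑ˡ k (suc M + 4)) l))
              (≤-trans (ℕₚ.+-monoˡ-≤ 4 (Finₚ.toℕ<n k)) (ℕₚ.+-monoʳ-≤ E (ℕₚ.m≤n+m 4 (suc M))))))
      ... | inj₂ (k , refl) with split-pos (suc M) k
      ... | inj₁ (k′ , refl) = ⊥-elim (ℕₚ.n≮n n (≤-trans (s≤s (subst (λ t → n ≤ t + 4)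
              (trans (Finₚ.toℕ-↑ʳ E (k′ ↑ˡ 4)) (cong (E +_) (Finₚ.toℕ-↑ˡ k′ 4))) l))
              (≤-trans (ℕₚ.+-monoˡ-≤ 4 (≤-trans (≤-reflexive (sym (ℕₚ.+-suc E _))) (ℕₚ.+-monoʳ-≤ E (Finₚ.toℕ<n k′))))
                (≤-reflexive (ℕₚ.+-assoc E (suc M) 4)))))
      ... | inj₂ (k′ , refl) = subst (λ v → h⁺ v ≡ v)
              (trans (cong [ _ , _ ]′ (Finₚ.splitAt-↑ʳ E 8 (idx 4 (k′ , s)))) (cong (λ v → low₄ (proj₁ v) , proj₂ v) (vtx-idx 4 (k′ , s))))
              (fixed (E ↑ʳ idx 4 (k′ , s)))

  spheres : List (RawComplex (n + n))
  spheres = reps sphere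

  spheres-many : 3 ^ M ≤ length spheres * (n + n) ^ (E + 8)
  spheres-many = classes sphere code (λ {i} {j} {R} → rigid′ {i} {j} {R})

  spheres-apart : AllPairs (λ K L → ¬ Iso K L) spheres
  spheres-apart = Uniqueₚ.deduplicate-! isoSetoid (List.tabulate sphere)

  spheres-ok : All (λ K → CombSphere (2 * suc (suc (suc L)) ∸ 1) K × CentSym n K × CSNeighborly n (suc (suc L)) K) spheres
  spheres-ok = Allₚ.deduplicate⁺ Iso? (Allₚ.tabulate⁺ {f = sphere} (λ y →
    Δ-sphere (walk-adm (choice M y)) (suc L) (suc M) n (len-dbl (suc L) (suc M))))

theorem6p2 : (k : ℕ) → 3 ≤ k →
    Σ ℕ λ p → Σ ℕ λ q → 0 < p × 0 < q × Σ ℕ λ N → (n : ℕ) → N ≤ n →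
    Σ (List (RawComplex (n + n))) λ Ks →
    (p * 2 ^ n ≤ q * length Ks) ×
    AllPairs (λ K L → ¬ Iso K L) Ks ×
    All (λ K → CombSphere (2 * k ∸ 1) K × CentSym n K × CSNeighborly n (k ∸ 1) K) Ks
theorem6p2 (suc (suc (suc L))) (s≤s (s≤s (s≤s z≤n))) = 1 , q , s≤s z≤n , q>0 , a , λ n l →
    subst Goal (size n l) (family (n ∸ a))
  where
  E = dbl (suc L)
  -- The pairs without a choice: `E` for the apices, the four initial ones and the first added one.
  -- `D` then counts the recorded vertices.
  a = E + 5
  D = E + 8
  q = 2 ^ a * 2 ^ D * (suc a + 3 * D) ^ D
  q>0 : 0 < q
  q>0 = ℕₚ.*-mono-≤ (ℕₚ.*-mono-≤ (ℕₚ.m^n>0 2 a) (ℕₚ.m^n>0 2 D)) (ℕₚ.m^n>0 (suc a + 3 * D) D)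
  Goal : ℕ → Set
  Goal n = Σ (List (RawComplex (n + n))) λ Ks →
    (1 * 2 ^ n ≤ q * length Ks) ×
    AllPairs (λ K L → ¬ Iso K L) Ks ×
    All (λ K → CombSphere (2 * suc (suc (suc L)) ∸ 1) K × CentSym n K × CSNeighborly n (suc (suc L)) K) Ks
  shift : ∀ m → m + a ≡ E + (suc m + 4)
  shift m = solve 2 (λ m e → m :+ (e :+ con 5) := e :+ (con 1 :+ m :+ con 4)) refl m E
  size : ∀ n → a ≤ n → E + (suc (n ∸ a) + 4) ≡ n
  size n l = trans (sym (shift (n ∸ a))) (ℕₚ.m∸n+n≡m l)
  family : ∀ m → Goal (E + (suc m + 4))
  family m = spheres
    , subst (λ n → 1 * 2 ^ n ≤ q * length spheres) (shift m)
        (many a D m (length spheres) (subst (λ n → 3 ^ m ≤ length spheres * (n + n) ^ D) (sym (shift m)) spheres-many))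
    , spheres-apart , spheres-ok
    where open Family L m using (spheres; spheres-many; spheres-apart; spheres-ok)
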